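{- For every integer $t\ge 2$ and all $\varepsilon,d_3>0$ there exists $\delta_3>0$ such that for every $d_2>0$ there exist $\delta_2>0$ and an integer $r\ge 1$ such that the following holds for all sufficiently large, pairwise disjoint finite sets $X$, $Y$, and $Z$. Let $H=(X\cup Y\cup Z,E_H)$ be a tripartite $3$-uniform hypergraph which is $(\delta_3,d_3,r)$-regular with respect to a $(\delta_2,d_2)$-triad $P=(X\cup Y\cup Z,E_P)$. Then all but at most $\varepsilon|X|^t$ of the $t$-tuples of vertices $X'=\{x_1,\dots,x_t\}\subseteq X$ satisfy $$\Big||L_H(X',P)|-d_3^{\,t}\,d_2^{\,2t+1}|Y||Z|\Big|\le \varepsilon\, d_3^{\,t}\,d_2^{\,2t+1}|Y||Z| .$$
   Context: **Regular bipartite graphs and triads.** A bipartite graph $G$ with classes $A,B$ is $(\delta,d)$-regular if $\big|e_G(A',B')-d|A'||B'|\big|\le\delta|A||B|$ for all $A'\subseteq A$, $B'\subseteq B$. A tripartite graph $P$ with vertex classes $X,Y,Z$ is a $(\delta,d)$-triad if each of the bipartite graphs $P[X,Y]$, $P[Y,Z]$, $P[X,Z]$ is $(\delta,d)$-regular. **Triangles.** $\mathcal K_3(G)$ is the set of $3$-subsets of $V(G)$ spanning a triangle in the graph $G$. **Regularity of a hypergraph with respect to a triad.** A tripartite $3$-uniform hypergraph $H=(X\cup Y\cup Z,E_H)$ (each hyperedge has exactly one vertex in each of $X,Y,Z$) is $(\delta,d,r)$-regular with respect to a tripartite graph $P$ with classes $X,Y,Z$ if $$\bigg|\Big|\bigcup_{i=1}^r\big(E_H\cap\mathcal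 K_3(Q_i)\big)\Big|-d\,\Big|\bigcup_{i=1}^r\mathcal K_3(Q_i)\Big|\bigg|\le\delta|\mathcal K_3(P)|$$ for every family of (not necessarily disjoint) subgraphs $Q_1,\dots,Q_r\subseteq P$ with $\big|\bigcup_{i=1}^r\mathcal K_3(Q_i)\big|\ge\delta|\mathcal K_3(P)|>0$. **Links and joint links supported on a graph.** For a vertex $v$ of a $3$-uniform hypergraph $H=(V,E)$, the link graph $L_H(v)$ has vertex set $V\setminus\{v\}$ and edge set $\{uw: uvw\in E\}$. For a graph $G$ with vertex set $V$, the link of $v$ supported on $G$ is $L_H(v,G)=E(L_H(v))\cap E(G)$. For $U\subseteq V$, the joint link supported on $G$ is $L_H(U,G)=\bigcap_{u\in U}L_H(u,G)$.
   Formalization: The formal theorem also assumes that every hyperedge of H is a triangle of P; without this the claim fails, e.g. for H complete tripartite, d_3 = 1 and P a random-like triad with d_2 = 1/2, where every joint link supported on P is all of P[Y,Z]. -}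

module Defs where

open import Algebra.Properties.Semiring.Sum using (sum)
open import Data.Bool.Base using (Bool; true; false; T; _∧_; _∨_; if_then_else_)
open import Data.Fin.Base using (Fin)
open import Data.Fin.Subset as Subset using (Subset)
import Data.Integer.Base as ℤ
open import Data.Nat.Base as ℕ using (ℕ; zero; suc)
import Data.Nat.Properties as ℕ
open import Data.Product.Base using (∃-syntax; _×_; _,_)
open import Data.Rational.Base as ℚ using (ℚ; 0ℚ; 1ℚ; ½)
import Data.Rational.Properties as ℚ
import Data.Rational.Solver as ℚSolver
open import Data.Sum.Base using (inj₁; inj₂)
open import Data.Vec.Base using (Vec; lookup)
open import Data.Vec.Functional using (foldr)
open import Relation.Binary.PropositionalEquality
  using (_≡_; refl; sym; trans; cong; cong₂; subst)

------------------------------------------------------------------------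
-- Real numbers, as Cauchy sequences of rationals

infix  4 _≤_ _<_
infixl 6 _+_ _-_
infixl 7 _*_
infix  8 -_
infixr 8 _^_

IsCauchy : (ℕ → ℚ) → Set
IsCauchy s = ∀ ε → 0ℚ ℚ.< ε →
  ∃[ N ] (∀ m n → N ℕ.≤ m → N ℕ.≤ n → ℚ.∣ s m ℚ.- s n ∣ ℚ.≤ ε)

record ℝ : Set where
  constructor mkℝ
  field
    seq    : ℕ → ℚ
    cauchy : IsCauchy seq

open ℝ public

abstract
  private
    ½*pos : ∀ {ε} → 0ℚ ℚ.< ε → 0ℚ ℚ.< ½ ℚ.* ε
    ½*pos {ε} 0<ε = subst (ℚ._< ½ ℚ.* ε) (ℚ.*-zeroʳ ½) (ℚ.*-monoʳ-<-pos ½ 0<ε)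

    ½+½ : ∀ ε → ½ ℚ.* ε ℚ.+ ½ ℚ.* ε ≡ ε
    ½+½ ε = trans (sym (ℚ.*-distribʳ-+ ε ½ ½)) (ℚ.*-identityˡ ε)

  const-cauchy : ∀ q → IsCauchy (λ _ → q)
  const-cauchy q ε 0<ε = 0 , λ _ _ _ _ →
    ℚ.≤-trans (ℚ.≤-reflexive (cong ℚ.∣_∣ (ℚ.+-inverseʳ q))) (ℚ.<⇒≤ 0<ε)

  +-cauchy : ∀ {s t} → IsCauchy s → IsCauchy t → IsCauchy (λ n → s n ℚ.+ t n)
  +-cauchy {s} {t} cs ct ε 0<ε with cs (½ ℚ.* ε) (½*pos 0<ε) | ct (½ ℚ.* ε) (½*pos 0<ε)
  ... | M , hs | N , ht = M ℕ.⊔ N , λ m n m≥ n≥ → begin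
    ℚ.∣ (s m ℚ.+ t m) ℚ.- (s n ℚ.+ t n) ∣
      ≡⟨ cong ℚ.∣_∣ (solve 4 (λ a b c d →
           (a :+ b) :+ :- (c :+ d) := (a :+ :- c) :+ (b :+ :- d)) refl
           (s m) (t m) (s n) (t n)) ⟩
    ℚ.∣ (s m ℚ.- s n) ℚ.+ (t m ℚ.- t n) ∣
      ≤⟨ ℚ.∣p+q∣≤∣p∣+∣q∣ (s m ℚ.- s n) (t m ℚ.- t n) ⟩
    ℚ.∣ s m ℚ.- s n ∣ ℚ.+ ℚ.∣ t m ℚ.- t n ∣
      ≤⟨ ℚ.+-mono-≤
           (hs m n (ℕ.m⊔n≤o⇒m≤o M N m≥) (ℕ.m⊔n≤o⇒m≤o M N n≥))
           (ht m n (ℕ.m⊔n≤o⇒n≤o M N m≥) (ℕ.m⊔n≤o⇒n≤o M N n≥)) ⟩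
    ½ ℚ.* ε ℚ.+ ½ ℚ.* ε
      ≡⟨ ½+½ ε ⟩
    ε ∎
    where
    open ℚ.≤-Reasoning
    open ℚSolver.+-*-Solver

  neg-cauchy : ∀ {s} → IsCauchy s → IsCauchy (λ n → ℚ.- s n)
  neg-cauchy {s} cs ε 0<ε with cs ε 0<ε
  ... | N , hs = N , λ m n m≥ n≥ → ℚ.≤-trans
    (ℚ.≤-reflexive (cong ℚ.∣_∣ (solve 2 (λ a b →
      (:- a) :+ :- (:- b) := b :+ :- a) refl (s m) (s n))))
    (hs n m n≥ m≥)
    where
    open ℚSolver.+-*-Solver

  abs-cauchy : ∀ {s} → IsCauchy s → IsCauchy (λ n → ℚ.∣ s n ∣)
  abs-cauchy {s} cs ε 0<ε with cs ε 0<ε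
  ... | N , hs = N , λ m n m≥ n≥ → bound m n (hs m n m≥ n≥) (hs n m n≥ m≥)
    where
    open ℚSolver.+-*-Solver

    half : ∀ p q → ℚ.∣ p ∣ ℚ.- ℚ.∣ q ∣ ℚ.≤ ℚ.∣ p ℚ.- q ∣
    half p q = begin
      ℚ.∣ p ∣ ℚ.- ℚ.∣ q ∣
        ≡⟨ cong (λ z → ℚ.∣ z ∣ ℚ.- ℚ.∣ q ∣)
             (solve 2 (λ a b → a := (a :+ :- b) :+ b) refl p q) ⟩
      ℚ.∣ (p ℚ.- q) ℚ.+ q ∣ ℚ.- ℚ.∣ q ∣
        ≤⟨ ℚ.+-monoˡ-≤ (ℚ.- ℚ.∣ q ∣) (ℚ.∣p+q∣≤∣p∣+∣q∣ (p ℚ.- q) q) ⟩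
      (ℚ.∣ p ℚ.- q ∣ ℚ.+ ℚ.∣ q ∣) ℚ.- ℚ.∣ q ∣
        ≡⟨ solve 2 (λ a b → (a :+ b) :+ :- b := a) refl ℚ.∣ p ℚ.- q ∣ ℚ.∣ q ∣ ⟩
      ℚ.∣ p ℚ.- q ∣ ∎
      where
      open ℚ.≤-Reasoning

    ∣∣≤ : ∀ p e → p ℚ.≤ e → ℚ.- p ℚ.≤ e → ℚ.∣ p ∣ ℚ.≤ e
    ∣∣≤ p e p≤e -p≤e with ℚ.∣p∣≡p∨∣p∣≡-p p
    ... | inj₁ eq = subst (ℚ._≤ e) (sym eq) p≤e
    ... | inj₂ eq = subst (ℚ._≤ e) (sym eq) -p≤e

    bound : ∀ m n → ℚ.∣ s m ℚ.- s n ∣ ℚ.≤ ε → ℚ.∣ s n ℚ.- s m ∣ ℚ.≤ ε →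
            ℚ.∣ ℚ.∣ s m ∣ ℚ.- ℚ.∣ s n ∣ ∣ ℚ.≤ ε
    bound m n h h′ = ∣∣≤ _ ε
      (ℚ.≤-trans (half (s m) (s n)) h)
      (ℚ.≤-trans (ℚ.≤-reflexive (solve 2 (λ a b → :- (a :+ :- b) := b :+ :- a)
                                   refl ℚ.∣ s m ∣ ℚ.∣ s n ∣))
                 (ℚ.≤-trans (half (s n) (s m)) h′))

  private
    eventually-bounded : ∀ {s} → IsCauchy s →
      ∃[ B ] (0ℚ ℚ.< B) × (∃[ N ] (∀ n → N ℕ.≤ n → ℚ.∣ s n ∣ ℚ.≤ B))
    eventually-bounded {s} cs with cs 1ℚ (ℚ.positive⁻¹ 1ℚ)
    ... | N , h = 1ℚ ℚ.+ ℚ.∣ s N ∣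
                , ℚ.+-mono-<-≤ (ℚ.positive⁻¹ 1ℚ) (ℚ.0≤∣p∣ (s N))
                , N , λ n n≥ → begin
      ℚ.∣ s n ∣
        ≡⟨ cong ℚ.∣_∣ (solve 2 (λ a b → a := (a :+ :- b) :+ b) refl (s n) (s N)) ⟩
      ℚ.∣ (s n ℚ.- s N) ℚ.+ s N ∣
        ≤⟨ ℚ.∣p+q∣≤∣p∣+∣q∣ (s n ℚ.- s N) (s N) ⟩
      ℚ.∣ s n ℚ.- s N ∣ ℚ.+ ℚ.∣ s N ∣
        ≤⟨ ℚ.+-monoˡ-≤ ℚ.∣ s N ∣ (h n N n≥ ℕ.≤-refl) ⟩
      1ℚ ℚ.+ ℚ.∣ s N ∣ ∎
      where
      open ℚ.≤-Reasoning
      open ℚSolver.+-*-Solver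

    *-mono : ∀ {p q r u} → 0ℚ ℚ.≤ r → 0ℚ ℚ.≤ q → p ℚ.≤ q → r ℚ.≤ u → p ℚ.* r ℚ.≤ q ℚ.* u
    *-mono {p} {q} {r} {u} 0≤r 0≤q p≤q r≤u = ℚ.≤-trans
      (ℚ.*-monoʳ-≤-nonNeg r {{ℚ.nonNegative 0≤r}} p≤q)
      (ℚ.*-monoˡ-≤-nonNeg q {{ℚ.nonNegative 0≤q}} r≤u)

    shrink : ∀ {ε K} → 0ℚ ℚ.< ε → 0ℚ ℚ.< K → ∃[ η ] (0ℚ ℚ.< η) × (K ℚ.* η ≡ ε)
    shrink {ε} {K} 0<ε 0<K = K⁻¹ ℚ.* ε , ℚ.positive⁻¹ _ {{K⁻¹ε>0}} , KK⁻¹ε≡ε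
      where
      instance
        K≠0 : ℚ.NonZero K
        K≠0 = ℚ.pos⇒nonZero K {{ℚ.positive 0<K}}
      K⁻¹ : ℚ
      K⁻¹ = ℚ.1/ K
      K⁻¹ε>0 : ℚ.Positive (K⁻¹ ℚ.* ε)
      K⁻¹ε>0 = ℚ.pos*pos⇒pos K⁻¹ {{ℚ.1/pos⇒pos K {{ℚ.positive 0<K}}}} ε {{ℚ.positive 0<ε}}
      KK⁻¹ε≡ε : K ℚ.* (K⁻¹ ℚ.* ε) ≡ ε
      KK⁻¹ε≡ε = trans (sym (ℚ.*-assoc K K⁻¹ ε))
                (trans (cong (ℚ._* ε) (ℚ.*-inverseʳ K)) (ℚ.*-identityˡ ε))

    *-difference : ∀ p q r u → p ℚ.* q ℚ.- r ℚ.* u ≡ p ℚ.* (q ℚ.- u) ℚ.+ u ℚ.* (p ℚ.- r)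
    *-difference = solve 4 (λ a b c d →
        a :* b :+ :- (c :* d) := a :* (b :+ :- d) :+ d :* (a :+ :- c)) refl
      where
      open ℚSolver.+-*-Solver

    *-bound : ∀ {A B η} p q r u → 0ℚ ℚ.≤ A → 0ℚ ℚ.≤ B →
      ℚ.∣ p ∣ ℚ.≤ A → ℚ.∣ u ∣ ℚ.≤ B → ℚ.∣ q ℚ.- u ∣ ℚ.≤ η → ℚ.∣ p ℚ.- r ∣ ℚ.≤ η →
      ℚ.∣ p ℚ.* q ℚ.- r ℚ.* u ∣ ℚ.≤ (A ℚ.+ B) ℚ.* η
    *-bound {A} {B} {η} p q r u 0≤A 0≤B hp hu hqu hpr = begin
      ℚ.∣ p ℚ.* q ℚ.- r ℚ.* u ∣
        ≡⟨ cong ℚ.∣_∣ (*-difference p q r u) ⟩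
      ℚ.∣ p ℚ.* (q ℚ.- u) ℚ.+ u ℚ.* (p ℚ.- r) ∣
        ≤⟨ ℚ.∣p+q∣≤∣p∣+∣q∣ (p ℚ.* (q ℚ.- u)) (u ℚ.* (p ℚ.- r)) ⟩
      ℚ.∣ p ℚ.* (q ℚ.- u) ∣ ℚ.+ ℚ.∣ u ℚ.* (p ℚ.- r) ∣
        ≡⟨ cong₂ ℚ._+_ (ℚ.∣p*q∣≡∣p∣*∣q∣ p (q ℚ.- u)) (ℚ.∣p*q∣≡∣p∣*∣q∣ u (p ℚ.- r)) ⟩
      ℚ.∣ p ∣ ℚ.* ℚ.∣ q ℚ.- u ∣ ℚ.+ ℚ.∣ u ∣ ℚ.* ℚ.∣ p ℚ.- r ∣
        ≤⟨ ℚ.+-mono-≤ (*-mono (ℚ.0≤∣p∣ (q ℚ.- u)) 0≤A hp hqu)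
                      (*-mono (ℚ.0≤∣p∣ (p ℚ.- r)) 0≤B hu hpr) ⟩
      A ℚ.* η ℚ.+ B ℚ.* η
        ≡⟨ sym (ℚ.*-distribʳ-+ η A B) ⟩
      (A ℚ.+ B) ℚ.* η ∎
      where
      open ℚ.≤-Reasoning

  *-cauchy : ∀ {s t} → IsCauchy s → IsCauchy t → IsCauchy (λ n → s n ℚ.* t n)
  *-cauchy {s} {t} cs ct ε 0<ε =
    let A , 0<A , M₁ , hA = eventually-bounded {s} cs
        B , 0<B , N₁ , hB = eventually-bounded {t} ct
        η , 0<η , eq = shrink 0<ε (ℚ.+-mono-< 0<A 0<B)
        M₂ , hs = cs η 0<η
        N₂ , ht = ct η 0<η
    in (M₁ ℕ.⊔ N₁) ℕ.⊔ (M₂ ℕ.⊔ N₂) , λ m n m≥ n≥ →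
    let m≥₁ = ℕ.m⊔n≤o⇒m≤o (M₁ ℕ.⊔ N₁) (M₂ ℕ.⊔ N₂) m≥
        n≥₁ = ℕ.m⊔n≤o⇒m≤o (M₁ ℕ.⊔ N₁) (M₂ ℕ.⊔ N₂) n≥
        m≥₂ = ℕ.m⊔n≤o⇒n≤o (M₁ ℕ.⊔ N₁) (M₂ ℕ.⊔ N₂) m≥
        n≥₂ = ℕ.m⊔n≤o⇒n≤o (M₁ ℕ.⊔ N₁) (M₂ ℕ.⊔ N₂) n≥
    in subst (ℚ.∣ s m ℚ.* t m ℚ.- s n ℚ.* t n ∣ ℚ.≤_) eq
      (*-bound (s m) (t m) (s n) (t n) (ℚ.<⇒≤ 0<A) (ℚ.<⇒≤ 0<B)
        (hA m (ℕ.m⊔n≤o⇒m≤o M₁ N₁ m≥₁))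
        (hB n (ℕ.m⊔n≤o⇒n≤o M₁ N₁ n≥₁))
        (ht m n (ℕ.m⊔n≤o⇒n≤o M₂ N₂ m≥₂) (ℕ.m⊔n≤o⇒n≤o M₂ N₂ n≥₂))
        (hs m n (ℕ.m⊔n≤o⇒m≤o M₂ N₂ m≥₂) (ℕ.m⊔n≤o⇒m≤o M₂ N₂ n≥₂)))

fromℚ : ℚ → ℝ
fromℚ q = mkℝ (λ _ → q) (const-cauchy q)

fromℕ : ℕ → ℝ
fromℕ n = fromℚ (ℤ.+ n ℚ./ 1)

0ℝ 1ℝ : ℝ
0ℝ = fromℚ 0ℚ
1ℝ = fromℚ 1ℚ

_+_ : ℝ → ℝ → ℝ
x + y = mkℝ (λ n → seq x n ℚ.+ seq y n) (+-cauchy {seq x} {seq y} (cauchy x) (cauchy y))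

-_ : ℝ → ℝ
- x = mkℝ (λ n → ℚ.- seq x n) (neg-cauchy {seq x} (cauchy x))

_-_ : ℝ → ℝ → ℝ
x - y = x + (- y)

_*_ : ℝ → ℝ → ℝ
x * y = mkℝ (λ n → seq x n ℚ.* seq y n) (*-cauchy {seq x} {seq y} (cauchy x) (cauchy y))

∣_∣ : ℝ → ℝ
∣ x ∣ = mkℝ (λ n → ℚ.∣ seq x n ∣) (abs-cauchy {seq x} (cauchy x))

_^_ : ℝ → ℕ → ℝ
x ^ zero  = 1ℝ
x ^ suc n = x * x ^ n

-- Both orders compare limits, not terms, so they respect equality of reals;
-- x ≤ y is constructively the negation of y < x.
_<_ _≤_ : ℝ → ℝ → Set
x < y = ∃[ ε ] (0ℚ ℚ.< ε) × (∃[ N ] (∀ n → N ℕ.≤ n → seq x n ℚ.+ ε ℚ.≤ seq y n))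
x ≤ y = ∀ ε → 0ℚ ℚ.< ε → ∃[ N ] (∀ n → N ℕ.≤ n → seq x n ℚ.≤ seq y n ℚ.+ ε)

------------------------------------------------------------------------
-- Graphs and hypergraphs on the vertex classes Fin a, Fin b, Fin c.
-- The classes are distinct types, hence disjoint.

-- Sets of pairs (triples) with one entry in each class.
Pairs : ℕ → ℕ → Set
Pairs a b = Fin a → Fin b → Bool

Triples : ℕ → ℕ → ℕ → Set
Triples a b c = Fin a → Fin b → Fin c → Bool

∑ : ∀ {n} → (Fin n → ℕ) → ℕ
∑ = sum ℕ.+-*-semiring

#₂ : ∀ {a b} → Pairs a b → ℕ
#₂ S = ∑ λ x → ∑ λ y → if S x y then 1 else 0

#₃ : ∀ {a b c} → Triples a b c → ℕ
#₃ S = ∑ λ x → ∑ λ y → ∑ λ z → if S x y z then 1 else 0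

_⊆₂_ : ∀ {a b} → Pairs a b → Pairs a b → Set
S ⊆₂ S′ = ∀ x y → T (S x y) → T (S′ x y)

_⊆₃_ : ∀ {a b c} → Triples a b c → Triples a b c → Set
S ⊆₃ S′ = ∀ x y z → T (S x y z) → T (S′ x y z)

_∩₂_ : ∀ {a b} → Pairs a b → Pairs a b → Pairs a b
(S ∩₂ S′) x y = S x y ∧ S′ x y

_∩₃_ : ∀ {a b c} → Triples a b c → Triples a b c → Triples a b c
(S ∩₃ S′) x y z = S x y z ∧ S′ x y z

⋂₂ : ∀ {n a b} → (Fin n → Pairs a b) → Pairs a b
⋂₂ S x y = foldr _∧_ true (λ i → S i x y)

⋃₃ : ∀ {n a b c} → (Fin n → Triples a b c) → Triples a b c
⋃₃ S x y z = foldr _∨_ false (λ i → S i x y z)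

edgesBetween : ∀ {a b} → Pairs a b → Subset a → Subset b → ℕ
edgesBetween G A′ B′ = #₂ λ x y → lookup A′ x ∧ lookup B′ y ∧ G x y

BipartiteRegular : ∀ {a b} → ℝ → ℝ → Pairs a b → Set
BipartiteRegular {a} {b} δ d G = ∀ (A′ : Subset a) (B′ : Subset b) →
  ∣ fromℕ (edgesBetween G A′ B′) - d * fromℕ (Subset.∣ A′ ∣ ℕ.* Subset.∣ B′ ∣) ∣
    ≤ δ * fromℕ (a ℕ.* b)

record TripartiteGraph (a b c : ℕ) : Set where
  field
    XY : Pairs a b
    YZ : Pairs b c
    XZ : Pairs a c

open TripartiteGraph public

record _⊆ᴳ_ {a b c} (Q P : TripartiteGraph a b c) : Set where
  field
    XY⊆ : XY Q ⊆₂ XY P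
    YZ⊆ : YZ Q ⊆₂ YZ P
    XZ⊆ : XZ Q ⊆₂ XZ P

record Triad {a b c} (δ d : ℝ) (P : TripartiteGraph a b c) : Set where
  field
    XY-regular : BipartiteRegular δ d (XY P)
    YZ-regular : BipartiteRegular δ d (YZ P)
    XZ-regular : BipartiteRegular δ d (XZ P)

-- A triangle of a tripartite graph has exactly one vertex in each class.
K₃ : ∀ {a b c} → TripartiteGraph a b c → Triples a b c
K₃ P x y z = XY P x y ∧ YZ P y z ∧ XZ P x z

-- A tripartite 3-uniform hypergraph is given by its set of hyperedges.
HypergraphRegular : ∀ {a b c} → ℝ → ℝ → ℕ → Triples a b c → TripartiteGraph a b c → Set
HypergraphRegular {a} {b} {c} δ d r E P =
  ∀ (Q : Fin r → TripartiteGraph a b c) → (∀ i → Q i ⊆ᴳ P) →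
  δ * fromℕ (#₃ (K₃ P)) ≤ fromℕ (#₃ (⋃₃ λ i → K₃ (Q i))) →
  0ℝ < δ * fromℕ (#₃ (K₃ P)) →
  ∣ fromℕ (#₃ (⋃₃ λ i → E ∩₃ K₃ (Q i))) - d * fromℕ (#₃ (⋃₃ λ i → K₃ (Q i))) ∣
    ≤ δ * fromℕ (#₃ (K₃ P))

-- The link of x in the first class; its edges join the other two classes.
link : ∀ {a b c} → Triples a b c → Fin a → Pairs b c
link E x y z = E x y z

linkOn : ∀ {a b c} → Triples a b c → Fin a → TripartiteGraph a b c → Pairs b c
linkOn E x P = link E x ∩₂ YZ P

-- The joint link of the set of entries of a tuple.
jointLinkOn : ∀ {a b c t} → Triples a b c → Vec (Fin a) t → TripartiteGraph a b c → Pairs b c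
jointLinkOn E xs P = ⋂₂ λ i → linkOn E (lookup xs i) P

-- Regularity of E with respect to P constrains only the hyperedges lying on
-- triangles of P, whereas a link supported on P also sees hyperedges x y z with
-- y z an edge of P but x y or x z not.  The usual convention that the hyperedges
-- of a hypergraph regular with respect to P are triangles of P is therefore
-- needed: if E is complete, it is (δ , 1 , r)-regular with respect to any P, but
-- every joint link supported on P is all of P[Y,Z].
OnTriangles : ∀ {a b c} → Triples a b c → TripartiteGraph a b c → Set
OnTriangles E P = E ⊆₃ K₃ P

{-# OPTIONS --safe #-}

-- Induction on s ≤ t shows that the average over X' in Xˢ of
-- | |L(X')| - d₃ˢ d₂²ˢ⁺¹ |Y||Z| | is a small multiple of d₂²ˢ⁺¹ |Y||Z|; Markov's
-- inequality for s = t then bounds the number of exceptional t-tuples.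
--
-- For a set S of pairs and a further vertex x,
--   |S ∩ L(x)| = Σ_{yz ∈ S} (H - d₃ K)(x,y,z) + d₃ |S ∩ P(x)|,
-- where K is the set of triangles of P and P(x) the set of yz with xyz in K.
-- Bipartite regularity controls |S ∩ P(x)| for most x, for any S.  The first
-- summand is where the parameter r is needed: with S = L(X'), the triangles xyz
-- with yz in S and x in a set depending on X' have density only about d₂²ˢ in K,
-- too sparse for the regularity of H.  A union of about θ d₂⁻²ˢ such sets,
-- picked greedily so that overlaps stay negligible, has a density bounded below in
-- terms of θ alone, and on this union H - d₃ K has a small sum.
--
-- All counts are written as averages, and the reals ε, d₃, d₂ are replaced by terms
-- of their Cauchy sequences so far out that nothing changes any more up to the
-- required precision.  Order comparisons are then decidable.

module Submission where

open import Algebra.Bundles using (CommutativeRing)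
open import Data.Bool.Base using (Bool; true; false; T; not; _∧_; _∨_; if_then_else_)
open import Data.Bool.ListAction using (any)
open import Data.Bool.Properties using (∧-zeroʳ; ∧-identityʳ; ∧-distribˡ-∨)
open import Data.Empty using (⊥-elim)
open import Data.Fin.Base using (Fin; zero; suc)
import Data.Fin.Subset as Subset
import Data.Fin.Subset.Properties as Subset
import Data.Integer.Base as ℤ
import Data.Integer.Properties as ℤ
open import Data.List.Base as List using (List; []; _∷_; length; concat)
open import Data.List.Membership.Propositional using (_∈_; _∉_)
open import Data.List.Membership.Propositional.Properties using (∈-map⁺; ∈-concat⁺′; ∈-tabulate⁺)
open import Data.List.Properties using (length-++; length-map)
open import Data.List.Relation.Unary.Any using (here)
open import Data.Nat.Base as ℕ using (ℕ; zero; suc)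
import Data.Nat.Properties as ℕ
open import Data.Product.Base using (∃-syntax; _×_; _,_; proj₁; proj₂)
open import Data.Rational.Base as ℚ using (ℚ; 0ℚ; 1ℚ; ½)
import Data.Rational.Properties as ℚ
import Data.Rational.Unnormalised.Base as ℚᵘ
import Data.Rational.Unnormalised.Properties as ℚᵘ
open import Data.Sum.Base using (inj₁; inj₂)
open import Data.Vec.Base using (Vec; []; _∷_; tabulate; lookup)
import Data.Vec.Functional as Vector
open import Data.Vec.Properties using (lookup∘tabulate)
open import Relation.Binary.PropositionalEquality
open import Relation.Nullary using (Reflects; ofʸ; ofⁿ; does; proof)
open import Relation.Nullary.Decidable.Core using (dec⇒maybe)
open import Tactic.RingSolver using (solve-∀)
open import Tactic.RingSolver.Core.AlmostCommutativeRing
  using (AlmostCommutativeRing; fromCommutativeRing)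

-- The scale of the union comes from a balance. A random joint link of s vertices contains a pair of
-- typical codegree with probability at most `κ₀ = (2 d₂²)^s`, so about `R = θ / κ₀` sets cover a
-- triangle over such a pair with expected multiplicity of about θ at most. Pairwise overlaps then
-- cost a proportion of order θ² of the triangles, and regularity of H with parameter θ² costs the
-- same; divided by R, both become of order θ κ₀, a fraction θ of the main term. Hence θ, and with
-- it δ₃, can be fixed before d₂ is known: d₂ influences only δ₂ and, through R, the number r. The
-- obstacle is that bipartite regularity does not bound the codegree of every pair. Pairs of large
-- codegree get the trivial bound 1 and are rare. Their weight is multiplied by R, a multiple of a
-- negative power of d₂, but δ₂ is chosen after d₂ and absorbs this. As d₃ may exceed 1, an upper
-- bound M for it enters the estimates, and the relative error is allowed to grow by a factor 1 + M
-- per step.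

module _ where

  open import Data.Rational.Base hiding (ceiling)
  open import Data.Rational.Properties
  open import Algebra.Properties.Semiring.Sum (CommutativeRing.semiring +-*-commutativeRing)
    using (sum; ∑-distrib-+; *-distribˡ-sum; sum-cong-≗)
  open import Algebra.Properties.CommutativeSemiring.Exp
    (CommutativeRing.commutativeSemiring +-*-commutativeRing)
    using (_^_; ^-homo-*; ^-assocʳ; ^-distrib-*)
  open import Defs using (Pairs; Triples; TripartiteGraph; XY; YZ; XZ; ∑; #₂; #₃; K₃; ⋃₃; _∩₃_;
    edgesBetween; OnTriangles; jointLinkOn; _⊆ᴳ_)

  -- Arithmetic and order of the rationals

  ring : AlmostCommutativeRing _ _
  ring = fromCommutativeRing +-*-commutativeRing (λ x → dec⇒maybe (0ℚ ≟ x))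

  ≤-by : ∀ {p q} r → 0ℚ ≤ r → q ≡ p + r → p ≤ q
  ≤-by {p} r 0≤r refl = subst (_≤ p + r) (+-identityʳ p) (+-monoʳ-≤ p 0≤r)

  p≤q⇒0≤q-p : ∀ {p q} → p ≤ q → 0ℚ ≤ q - p
  p≤q⇒0≤q-p {p} {q} p≤q = subst (_≤ q - p) (+-inverseʳ p) (+-monoˡ-≤ (- p) p≤q)

  0≤+ : ∀ {p q} → 0ℚ ≤ p → 0ℚ ≤ q → 0ℚ ≤ p + q
  0≤+ = +-mono-≤

  0≤* : ∀ {p q} → 0ℚ ≤ p → 0ℚ ≤ q → 0ℚ ≤ p * q
  0≤* {p} {q} 0≤p 0≤q = nonNegative⁻¹ (p * q)
    {{nonNeg*nonNeg⇒nonNeg p {{nonNegative 0≤p}} q {{nonNegative 0≤q}}}}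

  *-monoˡ : ∀ {r p q} → 0ℚ ≤ r → p ≤ q → r * p ≤ r * q
  *-monoˡ {r} 0≤r = *-monoˡ-≤-nonNeg r {{nonNegative 0≤r}}

  *-monoʳ : ∀ {r p q} → 0ℚ ≤ r → p ≤ q → p * r ≤ q * r
  *-monoʳ {r} 0≤r = *-monoʳ-≤-nonNeg r {{nonNegative 0≤r}}

  *-mono : ∀ {p q r s} → 0ℚ ≤ r → 0ℚ ≤ q → p ≤ q → r ≤ s → p * r ≤ q * s
  *-mono 0≤r 0≤q p≤q r≤s = ≤-trans (*-monoʳ 0≤r p≤q) (*-monoˡ 0≤q r≤s)

  *-cancelˡ : ∀ {r p q} → 0ℚ < r → r * p ≤ r * q → p ≤ q
  *-cancelˡ {r} 0<r = *-cancelˡ-≤-pos r {{positive 0<r}}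

  0<* : ∀ {p q} → 0ℚ < p → 0ℚ < q → 0ℚ < p * q
  0<* {p} {q} 0<p 0<q = positive⁻¹ (p * q) {{pos*pos⇒pos p {{positive 0<p}} q {{positive 0<q}}}}

  ∣∣≤ : ∀ {p e} → p ≤ e → - p ≤ e → ∣ p ∣ ≤ e
  ∣∣≤ {p} {e} p≤e -p≤e with ∣p∣≡p∨∣p∣≡-p p
  ... | inj₁ eq = subst (_≤ e) (sym eq) p≤e
  ... | inj₂ eq = subst (_≤ e) (sym eq) -p≤e

  p≤∣p∣ : ∀ p → p ≤ ∣ p ∣
  p≤∣p∣ p with ≤-total 0ℚ p
  ... | inj₁ 0≤p = ≤-reflexive (sym (0≤p⇒∣p∣≡p 0≤p))
  ... | inj₂ p≤0 = ≤-trans p≤0 (0≤∣p∣ p)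

  -p≤∣p∣ : ∀ p → - p ≤ ∣ p ∣
  -p≤∣p∣ p = subst (- p ≤_) (∣-p∣≡∣p∣ p) (p≤∣p∣ (- p))

  ∣*∣ : ∀ {c} y → 0ℚ ≤ c → ∣ c * y ∣ ≡ c * ∣ y ∣
  ∣*∣ {c} y 0≤c = trans (∣p*q∣≡∣p∣*∣q∣ c y) (cong (_* ∣ y ∣) (0≤p⇒∣p∣≡p 0≤c))

  ∣∣-cancel : ∀ {c y δ} → 0ℚ < c → ∣ c * y ∣ ≤ δ * c → ∣ y ∣ ≤ δ
  ∣∣-cancel {c} {y} {δ} 0<c h = *-cancelˡ 0<c (≤-trans (≤-reflexive (sym (∣*∣ y (<⇒≤ 0<c))))
    (≤-trans h (≤-reflexive (*-comm δ c))))

  1/-pos : ∀ {p} → 0ℚ < p → ∃[ q ] (0ℚ < q) × (q * p ≡ 1ℚ)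
  1/-pos {p} 0<p = 1/ p , positive⁻¹ (1/ p) {{1/pos⇒pos p}} , *-inverseˡ p
    where
    instance
      p>0 : Positive p
      p>0 = positive 0<p
      p≠0 : NonZero p
      p≠0 = pos⇒nonZero p

  0≤1 : 0ℚ ≤ 1ℚ
  0≤1 = nonNegative⁻¹ 1ℚ

  ι : ℕ → ℚ
  ι n = ℤ.+ n / 1

  private
    ι≃ : ∀ n → toℚᵘ (ι n) ℚᵘ.≃ ℚᵘ.mkℚᵘ (ℤ.+ n) 0
    ι≃ n = toℚᵘ-fromℚᵘ (ℚᵘ.mkℚᵘ (ℤ.+ n) 0)

  ι-+ : ∀ m n → ι (m ℕ.+ n) ≡ ι m + ι n
  ι-+ m n = toℚᵘ-injective (begin
    toℚᵘ (ι (m ℕ.+ n))                             ≈⟨ ι≃ (m ℕ.+ n) ⟩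
    ℚᵘ.mkℚᵘ (ℤ.+ (m ℕ.+ n)) 0                       ≈⟨ ℚᵘ.*≡* (cong (ℤ._* ℤ.+ 1) (trans (ℤ.pos-+ m n)
                                                       (sym (cong₂ ℤ._+_ (ℤ.*-identityʳ (ℤ.+ m)) (ℤ.*-identityʳ (ℤ.+ n)))))) ⟩
    ℚᵘ.mkℚᵘ (ℤ.+ m) 0 ℚᵘ.+ ℚᵘ.mkℚᵘ (ℤ.+ n) 0         ≈⟨ ℚᵘ.+-cong (ℚᵘ.≃-sym (ι≃ m)) (ℚᵘ.≃-sym (ι≃ n)) ⟩
    toℚᵘ (ι m) ℚᵘ.+ toℚᵘ (ι n)                       ≈⟨ ℚᵘ.≃-sym (toℚᵘ-homo-+ (ι m) (ι n)) ⟩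
    toℚᵘ (ι m + ι n)                               ∎)
    where open ℚᵘ.≃-Reasoning

  ι-* : ∀ m n → ι (m ℕ.* n) ≡ ι m * ι n
  ι-* zero    n = sym (*-zeroˡ (ι n))
  ι-* (suc m) n = begin
    ι (n ℕ.+ m ℕ.* n)   ≡⟨ ι-+ n (m ℕ.* n) ⟩
    ι n + ι (m ℕ.* n)   ≡⟨ cong (ι n +_) (ι-* m n) ⟩
    ι n + ι m * ι n     ≡⟨ cong (_+ ι m * ι n) (*-identityˡ (ι n)) ⟨
    1ℚ * ι n + ι m * ι n ≡⟨ *-distribʳ-+ (ι n) 1ℚ (ι m) ⟨
    (1ℚ + ι m) * ι n    ≡⟨ cong (_* ι n) (ι-+ 1 m) ⟨
    ι (suc m) * ι n     ∎
    where open ≡-Reasoning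

  0≤ι : ∀ n → 0ℚ ≤ ι n
  0≤ι zero    = ≤-refl
  0≤ι (suc n) = subst (0ℚ ≤_) (sym (ι-+ 1 n)) (0≤+ 0≤1 (0≤ι n))

  ι-mono : ∀ {m n} → m ℕ.≤ n → ι m ≤ ι n
  ι-mono {m} {n} m≤n = ≤-by (ι (n ℕ.∸ m)) (0≤ι (n ℕ.∸ m))
    (trans (cong ι (sym (ℕ.m+[n∸m]≡n m≤n))) (ι-+ m (n ℕ.∸ m)))

  0<ι : ∀ n → 0ℚ < ι (suc n)
  0<ι n = <-≤-trans (positive⁻¹ 1ℚ) (ι-mono {1} {suc n} (ℕ.s≤s ℕ.z≤n))

  archimedean : ∀ p → ∃[ n ] p ≤ ι n
  archimedean p@(mkℚ (ℤ.-[1+ k ]) d c) = 0 , ≤-trans (<⇒≤ (negative⁻¹ p)) ≤-refl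
  archimedean p@(mkℚ (ℤ.+ k) d c) = k , toℚᵘ-cancel-≤ (ℚᵘ.≤-trans
    (ℚᵘ.*≤* (subst₂ ℤ._≤_ (sym (ℤ.*-identityʳ (ℤ.+ k))) (ℤ.pos-* k (suc d))
      (ℤ.+≤+ (ℕ.m≤m*n k (suc d)))))
    (ℚᵘ.≤-reflexive (ℚᵘ.≃-sym (ι≃ k))))

  -- Averages

  Linear : ∀ {J : Set} → ((J → ℚ) → ℚ) → Set
  Linear {J} L = (∀ {f g : J → ℚ} → (∀ j → f j ≡ g j) → L f ≡ L g)
               × (∀ f g → L (λ j → f j + g j) ≡ L f + L g)
               × (∀ q f → L (λ j → q * f j) ≡ q * L f)

  -- An expectation is given by its laws, so that random vertices, pairs and tuples are handled
  -- alike and class sizes appear only when counts are compared. `E-attained` is what turns a random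
  -- choice into an actual one.
  record Mean (I : Set) : Set₁ where
    field
      E          : (I → ℚ) → ℚ
      E-mono     : ∀ {f g} → (∀ i → f i ≤ g i) → E f ≤ E g
      E-+        : ∀ f g → E (λ i → f i + g i) ≡ E f + E g
      E-*        : ∀ q f → E (λ i → q * f i) ≡ q * E f
      E-const    : ∀ q → E (λ _ → q) ≡ q
      E-attained : ∀ f → ∃[ i ] E f ≤ f i
      -- Fubini's theorem, with a linear functional in place of a second mean so that
      -- the record is not recursive.
      E-linear   : ∀ {J : Set} (L : (J → ℚ) → ℚ) → Linear L → ∀ (f : I → J → ℚ) →
                   E (λ i → L (f i)) ≡ L (λ j → E (λ i → f i j))

    E-cong : ∀ {f g} → (∀ i → f i ≡ g i) → E f ≡ E g
    E-cong f≡g = ≤-antisym (E-mono (λ i → ≤-reflexive (f≡g i)))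
                           (E-mono (λ i → ≤-reflexive (sym (f≡g i))))

    linear : Linear E
    linear = E-cong , E-+ , E-*

    E-*ʳ : ∀ q f → E (λ i → f i * q) ≡ E f * q
    E-*ʳ q f = trans (E-cong (λ i → *-comm (f i) q)) (trans (E-* q f) (*-comm q (E f)))

    E-neg : ∀ f → E (λ i → - f i) ≡ - E f
    E-neg f = trans (E-cong (λ i → neg≡ (f i))) (trans (E-* (- 1ℚ) f) (sym (neg≡ (E f))))
      where
      neg≡ : ∀ p → - p ≡ - 1ℚ * p
      neg≡ = solve-∀ ring

    E-- : ∀ f g → E (λ i → f i - g i) ≡ E f - E g
    E-- f g = trans (E-+ f (λ i → - g i)) (cong (E f +_) (E-neg g))

    E-≤-const : ∀ {f c} → (∀ i → f i ≤ c) → E f ≤ c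
    E-≤-const {c = c} f≤c = ≤-trans (E-mono f≤c) (≤-reflexive (E-const c))

    E-≥-const : ∀ {f c} → (∀ i → c ≤ f i) → c ≤ E f
    E-≥-const {c = c} c≤f = ≤-trans (≤-reflexive (sym (E-const c))) (E-mono c≤f)

    ∣E∣≤E∣∣ : ∀ f → ∣ E f ∣ ≤ E (λ i → ∣ f i ∣)
    ∣E∣≤E∣∣ f = ∣∣≤ (E-mono (λ i → p≤∣p∣ (f i)))
      (≤-trans (≤-reflexive (sym (E-neg f))) (E-mono (λ i → -p≤∣p∣ (f i))))


  open Mean

  E-swap : ∀ {I J} (m : Mean I) (m′ : Mean J) (f : I → J → ℚ) →
           E m (λ i → E m′ (f i)) ≡ E m′ (λ j → E m (λ i → f i j))
  E-swap m m′ = E-linear m (E m′) (linear m′)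

  infixr 5 _⊗_

  _⊗_ : ∀ {I J} → Mean I → Mean J → Mean (I × J)
  m ⊗ m′ = record
    { E          = λ f → E m λ i → E m′ λ j → f (i , j)
    ; E-mono     = λ f≤g → E-mono m λ i → E-mono m′ λ j → f≤g (i , j)
    ; E-+        = λ f g → trans (E-cong m λ i → E-+ m′ _ _) (E-+ m _ _)
    ; E-*        = λ q f → trans (E-cong m λ i → E-* m′ q _) (E-* m q _)
    ; E-const    = λ q → trans (E-cong m λ i → E-const m′ q) (E-const m q)
    ; E-attained = λ f → let i , i-max = E-attained m (λ i → E m′ λ j → f (i , j))
                             j , j-max = E-attained m′ (λ j → f (i , j))
                         in (i , j) , ≤-trans i-max j-max
    ; E-linear   = λ L lin f → trans (E-cong m λ i → E-linear m′ L lin _) (E-linear m L lin _)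
    }

  point : ∀ {I} → I → Mean I
  point i = record
    { E          = λ f → f i
    ; E-mono     = λ f≤g → f≤g i
    ; E-+        = λ _ _ → refl
    ; E-*        = λ _ _ → refl
    ; E-const    = λ _ → refl
    ; E-attained = λ _ → i , ≤-refl
    ; E-linear   = λ _ _ _ → refl
    }

  transport : ∀ {I J} → (I → J) → Mean I → Mean J
  transport φ m = record
    { E          = λ f → E m λ i → f (φ i)
    ; E-mono     = λ f≤g → E-mono m λ i → f≤g (φ i)
    ; E-+        = λ f g → E-+ m _ _
    ; E-*        = λ q f → E-* m q _
    ; E-const    = E-const m
    ; E-attained = λ f → let i , i-max = E-attained m (λ i → f (φ i)) in φ i , i-max
    ; E-linear   = λ L lin f → E-linear m L lin _
    }

  power : ∀ {I} → Mean I → ∀ s → Mean (Vec I s)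
  power m zero    = point []
  power m (suc s) = transport (λ (i , is) → i ∷ is) (m ⊗ power m s)


  -- The uniform mean on a finite set

  sum-mono : ∀ {n} {f g : Fin n → ℚ} → (∀ i → f i ≤ g i) → sum f ≤ sum g
  sum-mono {zero}  f≤g = ≤-refl
  sum-mono {suc n} f≤g = +-mono-≤ (f≤g zero) (sum-mono (λ i → f≤g (suc i)))

  sum-const : ∀ n q → sum {n} (λ _ → q) ≡ ι n * q
  sum-const zero    q = sym (*-zeroˡ q)
  sum-const (suc n) q = begin
    q + sum {n} (λ _ → q)  ≡⟨ cong (q +_) (sum-const n q) ⟩
    q + ι n * q            ≡⟨ collect q (ι n) ⟩
    (1ℚ + ι n) * q         ≡⟨ cong (_* q) (ι-+ 1 n) ⟨
    ι (suc n) * q          ∎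
    where
    open ≡-Reasoning
    collect : ∀ q m → q + m * q ≡ (1ℚ + m) * q
    collect = solve-∀ ring

  sum-linear : ∀ {n} {J : Set} (L : (J → ℚ) → ℚ) → Linear L → ∀ (f : Fin n → J → ℚ) →
               sum (λ i → L (f i)) ≡ L (λ j → sum (λ i → f i j))
  sum-linear {zero} L (L-cong , _ , L-*) f = sym (begin
    L (λ j → 0ℚ)        ≡⟨ L-cong (λ j → sym (*-zeroˡ 0ℚ)) ⟩
    L (λ j → 0ℚ * 0ℚ)   ≡⟨ L-* 0ℚ (λ _ → 0ℚ) ⟩
    0ℚ * L (λ _ → 0ℚ)   ≡⟨ *-zeroˡ (L (λ _ → 0ℚ)) ⟩
    0ℚ                  ∎)
    where open ≡-Reasoning
  sum-linear {suc n} L lin@(_ , L-+ , _) f =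
    trans (cong (L (f zero) +_) (sum-linear L lin (λ i → f (suc i))))
          (sym (L-+ (f zero) (λ j → sum (λ i → f (suc i) j))))

  argmax : ∀ {n} (f : Fin (suc n) → ℚ) → ∃[ i ] ∀ j → f j ≤ f i
  argmax {zero}  f = zero , λ { zero → ≤-refl }
  argmax {suc n} f with argmax (λ i → f (suc i))
  ... | i , max with ≤-total (f zero) (f (suc i))
  ...   | inj₁ f₀≤ = suc i , λ { zero → f₀≤ ; (suc j) → max j }
  ...   | inj₂ ≤f₀ = zero , λ { zero → ≤-refl ; (suc j) → ≤-trans (max j) ≤f₀ }

  abstract
    -- Abstract: outside this block only the laws of a mean and `uniform-sum` are available.
    uniform : ∀ n → Mean (Fin (suc n))
    uniform n = record
      { E          = avg
      ; E-mono     = avg-mono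
      ; E-+        = λ f g → trans (cong (w *_) (∑-distrib-+ f g)) (*-distribˡ-+ w (sum f) (sum g))
      ; E-*        = λ q f → trans (cong (w *_) (sym (*-distribˡ-sum q f))) (exchange w q (sum f))
      ; E-const    = avg-const
      ; E-attained = λ f → let i , max = argmax f in i , ≤-trans (avg-mono max) (≤-reflexive (avg-const (f i)))
      ; E-linear   = λ { L lin@(_ , _ , L-*) f → trans (cong (w *_) (sum-linear L lin f)) (sym (L-* w _)) }
      }
      where
      w : ℚ
      w = proj₁ (1/-pos (0<ι n))
      0≤w : 0ℚ ≤ w
      0≤w = <⇒≤ (proj₁ (proj₂ (1/-pos (0<ι n))))
      avg : (Fin (suc n) → ℚ) → ℚ
      avg f = w * sum f
      avg-mono : ∀ {f g} → (∀ i → f i ≤ g i) → avg f ≤ avg g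
      avg-mono f≤g = *-monoˡ 0≤w (sum-mono f≤g)
      avg-const : ∀ q → avg (λ _ → q) ≡ q
      avg-const q = begin
        w * sum {suc n} (λ _ → q)  ≡⟨ cong (w *_) (sum-const (suc n) q) ⟩
        w * (ι (suc n) * q)        ≡⟨ *-assoc w (ι (suc n)) q ⟨
        w * ι (suc n) * q          ≡⟨ cong (_* q) (proj₂ (proj₂ (1/-pos (0<ι n)))) ⟩
        1ℚ * q                     ≡⟨ *-identityˡ q ⟩
        q                          ∎
        where open ≡-Reasoning
      exchange : ∀ w q s → w * (q * s) ≡ q * (w * s)
      exchange = solve-∀ ring

    uniform-sum : ∀ n f → ι (suc n) * E (uniform n) f ≡ sum f
    uniform-sum n f = begin
      ι (suc n) * (w * sum f)  ≡⟨ regroup (ι (suc n)) w (sum f) ⟩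
      w * ι (suc n) * sum f    ≡⟨ cong (_* sum f) (proj₂ (proj₂ (1/-pos (0<ι n)))) ⟩
      1ℚ * sum f               ≡⟨ *-identityˡ (sum f) ⟩
      sum f                    ∎
      where
      open ≡-Reasoning
      w : ℚ
      w = proj₁ (1/-pos (0<ι n))
      regroup : ∀ k w s → k * (w * s) ≡ w * k * s
      regroup = solve-∀ ring

  -- Indicator functions

  ∧-elimʳ : ∀ {a b} → T (a ∧ b) → T b
  ∧-elimʳ {true} h = h

  ∨-elim : ∀ {a b} {A : Set} → (T a → A) → (T b → A) → T (a ∨ b) → A
  ∨-elim {true}  f g = f
  ∨-elim {false} f g = g

  ⟦_⟧ : Bool → ℚ
  ⟦ b ⟧ = if b then 1ℚ else 0ℚ

  0≤⟦⟧ : ∀ b → 0ℚ ≤ ⟦ b ⟧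
  0≤⟦⟧ false = ≤-refl
  0≤⟦⟧ true  = 0≤1

  ⟦⟧≤1 : ∀ b → ⟦ b ⟧ ≤ 1ℚ
  ⟦⟧≤1 false = 0≤1
  ⟦⟧≤1 true  = ≤-refl

  ⟦∧⟧ : ∀ a b → ⟦ a ∧ b ⟧ ≡ ⟦ a ⟧ * ⟦ b ⟧
  ⟦∧⟧ false b = sym (*-zeroˡ ⟦ b ⟧)
  ⟦∧⟧ true  b = sym (*-identityˡ ⟦ b ⟧)

  ⟦∨⟧ : ∀ a b → ⟦ a ∨ b ⟧ ≡ ⟦ a ⟧ + ⟦ b ⟧ - ⟦ a ⟧ * ⟦ b ⟧
  ⟦∨⟧ false b = lemma ⟦ b ⟧
    where
    lemma : ∀ q → q ≡ 0ℚ + q - 0ℚ * q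
    lemma = solve-∀ ring
  ⟦∨⟧ true  b = lemma ⟦ b ⟧
    where
    lemma : ∀ q → 1ℚ ≡ 1ℚ + q - 1ℚ * q
    lemma = solve-∀ ring

  -- Greedy choice of almost disjoint sets

  -- If Φ is the average gain of a random set Q i, and κ bounds the probability that a
  -- given point is covered by it, then some n of the sets have a union of gain at
  -- least about n Φ, up to the pairwise overlaps of order n² M M₂.
  module Greedy {I Ω : Set} (mI : Mean I) (mΩ : Mean Ω) (Q : I → Ω → Bool) (g κ : Ω → ℚ)
    {M : ℚ} (0≤M : 0ℚ ≤ M) (g≤M : ∀ w → g w ≤ M) (0≤κ : ∀ w → 0ℚ ≤ κ w)
    (Q≤κ : ∀ w → E mI (λ i → ⟦ Q i w ⟧) ≤ κ w) where

    covered : List I → Ω → Bool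
    covered l w = any (λ i → Q i w) l

    gain : List I → ℚ
    gain l = E mΩ λ w → ⟦ covered l w ⟧ * g w

    Φ M₂ : ℚ
    Φ  = E mI λ i → E mΩ λ w → ⟦ Q i w ⟧ * g w
    M₂ = E mΩ λ w → κ w * κ w

    0≤M₂ : 0ℚ ≤ M₂
    0≤M₂ = E-≥-const mΩ λ w → 0≤* (0≤κ w) (0≤κ w)

    -- The gain of the sets chosen so far, minus a bound for the expected overlap
    -- with n further sets chosen at random.
    potential : ℕ → List I → ℚ
    potential n l = E mΩ λ w → ⟦ covered l w ⟧ * (g w - ι n * M * κ w)

    -- After the two averages are exchanged, the inner one is `κ w` minus the probability that a
    -- random set contains w. This is the slack lost in `E-potential` when that probability is
    -- replaced by `κ`.
    0≤EE : ∀ (h : Ω → ℚ) → (∀ w → 0ℚ ≤ h w) →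
           0ℚ ≤ E mI λ i → E mΩ λ w → (κ w - ⟦ Q i w ⟧) * h w
    0≤EE h 0≤h = subst (0ℚ ≤_) (sym (E-swap mI mΩ _)) (E-≥-const mΩ λ w →
      subst (0ℚ ≤_)
        (sym (trans (E-*ʳ mI (h w) _) (cong (_* h w)
          (trans (E-- mI (λ _ → κ w) _) (cong (_- E mI (λ i → ⟦ Q i w ⟧)) (E-const mI (κ w)))))))
        (0≤* (p≤q⇒0≤q-p (Q≤κ w)) (0≤h w)))

    -- A random new set gains `Φ`. Its expected overlap with the covered points costs at most
    -- `M * κ` on them, which the drop from `suc n` to `n` in the potential has already paid for. On
    -- the newly covered points the penalty `ι n * M * κ` has expectation at most `ι n * M * M₂`.
    E-potential : ∀ n l → potential (suc n) l + (Φ - ι n * M * M₂) ≤ E mI λ i → potential n (i ∷ l)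
    E-potential n l = begin
      potential (suc n) l + (Φ - ι n * M * M₂)
        ≤⟨ ≤-by _ (0≤EE h 0≤h) (regroup (potential (suc n) l) Φ (ι n * M) M₂ slack) ⟩
      potential (suc n) l + (Φ + (E mI (λ i → E mΩ λ w → (κ w - ⟦ Q i w ⟧) * h w) + - (ι n * M) * M₂))
        ≡⟨ cong₂ _+_ (E-const mI (potential (suc n) l)) (trans (E-+ mI (λ i → E mΩ λ w → ⟦ Q i w ⟧ * g w) _) (cong (Φ +_)
             (trans (E-+ mI (λ i → E mΩ λ w → (κ w - ⟦ Q i w ⟧) * h w) _) (cong (slack +_) (E-const mI (- (ι n * M) * M₂)))))) ⟨
      E mI (λ _ → potential (suc n) l) +
      E mI (λ i → E mΩ (λ w → ⟦ Q i w ⟧ * g w) +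
                 (E mΩ (λ w → (κ w - ⟦ Q i w ⟧) * h w) + - (ι n * M) * M₂))
        ≡⟨ E-+ mI _ _ ⟨
      E mI (λ i → potential (suc n) l +
                 (E mΩ (λ w → ⟦ Q i w ⟧ * g w) +
                 (E mΩ (λ w → (κ w - ⟦ Q i w ⟧) * h w) + - (ι n * M) * M₂)))
        ≡⟨ E-cong mI (λ i → trans (E-+ mΩ _ _) (cong (potential (suc n) l +_)
             (trans (E-+ mΩ (λ w → ⟦ Q i w ⟧ * g w) _) (cong ((E mΩ λ w → ⟦ Q i w ⟧ * g w) +_)
             (trans (E-+ mΩ (λ w → (κ w - ⟦ Q i w ⟧) * h w) _)
                    (cong ((E mΩ λ w → (κ w - ⟦ Q i w ⟧) * h w) +_) (E-* mΩ (- (ι n * M)) _))))))) ⟨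
      E mI (λ i → E mΩ λ w → ⟦ covered l w ⟧ * (g w - ι (suc n) * M * κ w) +
                 (⟦ Q i w ⟧ * g w + ((κ w - ⟦ Q i w ⟧) * h w + - (ι n * M) * (κ w * κ w))))
        ≤⟨ E-mono mI (λ i → E-mono mΩ λ w → pointwise i w) ⟩
      E mI (λ i → potential n (i ∷ l))
        ∎
      where
      open ≤-Reasoning
      -- The factor of `⟦ Q i w ⟧` in the losses: the penalty for the sets still to come, and the
      -- overlap with the sets chosen before.
      h : Ω → ℚ
      h w = ι n * M * κ w + M * ⟦ covered l w ⟧
      0≤h : ∀ w → 0ℚ ≤ h w
      0≤h w = 0≤+ (0≤* (0≤* (0≤ι n) 0≤M) (0≤κ w)) (0≤* 0≤M (0≤⟦⟧ (covered l w)))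
      regroup : ∀ p φ m m₂ e → p + (φ + (e + - m * m₂)) ≡ p + (φ - m * m₂) + e
      regroup = solve-∀ ring
      slack : ℚ
      slack = E mI λ i → E mΩ λ w → (κ w - ⟦ Q i w ⟧) * h w
      expand : ∀ c u g n M k → (u + c - u * c) * (g - n * M * k) ≡
        c * (g - (1ℚ + n) * M * k) + (u * g + ((k - u) * (n * M * k + M * c) + - (n * M) * (k * k)))
        + (c * u * (M - g) + n * M * (c * u * k))
      expand = solve-∀ ring
      expand′ : ∀ c u g n M k {n′} → n′ ≡ 1ℚ + n → (u + c - u * c) * (g - n * M * k) ≡
        c * (g - n′ * M * k) + (u * g + ((k - u) * (n * M * k + M * c) + - (n * M) * (k * k)))
        + (c * u * (M - g) + n * M * (c * u * k))
      expand′ c u g n M k refl = expand c u g n M k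
      pointwise : ∀ i w → ⟦ covered l w ⟧ * (g w - ι (suc n) * M * κ w) +
        (⟦ Q i w ⟧ * g w + ((κ w - ⟦ Q i w ⟧) * h w + - (ι n * M) * (κ w * κ w)))
        ≤ ⟦ covered (i ∷ l) w ⟧ * (g w - ι n * M * κ w)
      pointwise i w = ≤-by _
        (0≤+ (0≤* cu (p≤q⇒0≤q-p (g≤M w))) (0≤* (0≤* (0≤ι n) 0≤M) (0≤* cu (0≤κ w))))
        (trans (cong (_* (g w - ι n * M * κ w)) (⟦∨⟧ (Q i w) (covered l w)))
          (expand′ ⟦ covered l w ⟧ ⟦ Q i w ⟧ (g w) (ι n) M (κ w) (ι-+ 1 n)))
        where
        cu : 0ℚ ≤ ⟦ covered l w ⟧ * ⟦ Q i w ⟧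
        cu = 0≤* (0≤⟦⟧ (covered l w)) (0≤⟦⟧ (Q i w))

    -- The method of conditional expectations: each new set is at least as good as the average one.
    -- With n sets still to come a step loses `ι n * M * M₂`, and `ι n ≤ R` holds at every step.
    greedy : ∀ {R} n → ι n ≤ R + 1ℚ → ∀ l → ∃[ l′ ] (length l′ ≡ n ℕ.+ length l) ×
             (potential n l + ι n * (Φ - R * M * M₂) ≤ gain l′)
    greedy {R} zero _ l = l , refl , ≤-reflexive (trans
      (cong₂ _+_ (E-cong mΩ λ w → simplify ⟦ covered l w ⟧ (g w) M (κ w)) (*-zeroˡ (Φ - R * M * M₂)))
      (+-identityʳ (gain l)))
      where
      simplify : ∀ c g M k → c * (g - 0ℚ * M * k) ≡ c * g
      simplify = solve-∀ ring
    greedy {R} (suc n) n+1≤R+1 l =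
      let i  , i-good          = E-attained mI (λ i → potential n (i ∷ l))
          l′ , length-l′ , big = greedy {R} n (≤-trans n≤R (≤-by 1ℚ 0≤1 refl)) (i ∷ l)
      in l′ , trans length-l′ (ℕ.+-suc n (length l)) , (begin
      potential (suc n) l + ι (suc n) * (Φ - R * M * M₂)
        ≤⟨ ≤-by _ (0≤* (p≤q⇒0≤q-p n≤R) (0≤* 0≤M 0≤M₂))
             (regroup′ (potential (suc n) l) Φ (ι n) R M M₂ (ι-+ 1 n)) ⟩
      potential (suc n) l + (Φ - ι n * M * M₂) + ι n * (Φ - R * M * M₂)
        ≤⟨ +-monoˡ-≤ _ (≤-trans (E-potential n l) i-good) ⟩
      potential n (i ∷ l) + ι n * (Φ - R * M * M₂)
        ≤⟨ big ⟩
      gain l′ ∎)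
      where
      open ≤-Reasoning
      n≤R : ι n ≤ R
      n≤R = ≤-by _ (p≤q⇒0≤q-p n+1≤R+1)
        (trans (shift R (ι n)) (cong (λ m → ι n + (R + 1ℚ - m)) (sym (ι-+ 1 n))))
        where
        shift : ∀ R n → R ≡ n + (R + 1ℚ - (1ℚ + n))
        shift = solve-∀ ring
      regroup : ∀ p φ n R M m → p + (φ - n * M * m) + n * (φ - R * M * m) ≡
                p + (1ℚ + n) * (φ - R * M * m) + (R - n) * (M * m)
      regroup = solve-∀ ring
      regroup′ : ∀ p φ n R M m {n′} → n′ ≡ 1ℚ + n → p + (φ - n * M * m) + n * (φ - R * M * m) ≡
                 p + n′ * (φ - R * M * m) + (R - n) * (M * m)
      regroup′ p φ n R M m refl = regroup p φ n R M m

    -- Rounding R up to an integer does no harm: `ι n ≤ R + 1ℚ` controls the losses, and `R ≤ ι n`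
    -- is used only if the bracket is nonnegative. Otherwise `0ℚ ≤ B` suffices.
    Φ-bound : ∀ {R B} n → 0ℚ ≤ R → 0ℚ ≤ B → R ≤ ι n → ι n ≤ R + 1ℚ →
              (∀ l → length l ≡ n → gain l ≤ B) → R * (Φ - R * M * M₂) ≤ B
    Φ-bound {R} {B} n 0≤R 0≤B R≤n n≤R+1 gain≤B with ≤-total 0ℚ (Φ - R * M * M₂) | greedy {R} n n≤R+1 []
    ... | inj₁ 0≤x | l , length-l , big = begin
      R * (Φ - R * M * M₂)                    ≤⟨ *-monoʳ 0≤x R≤n ⟩
      ι n * (Φ - R * M * M₂)                  ≡⟨ +-identityˡ _ ⟨
      0ℚ + ι n * (Φ - R * M * M₂)             ≡⟨ cong (_+ ι n * (Φ - R * M * M₂)) (trans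
                                                   (E-cong mΩ λ w → *-zeroˡ (g w - ι n * M * κ w)) (E-const mΩ 0ℚ)) ⟨
      potential n [] + ι n * (Φ - R * M * M₂) ≤⟨ big ⟩
      gain l                                  ≤⟨ gain≤B l (trans length-l (ℕ.+-identityʳ n)) ⟩
      B                                       ∎
      where open ≤-Reasoning
    ... | inj₂ x≤0 | _ = ≤-trans (*-monoˡ 0≤R x≤0) (subst (_≤ B) (sym (*-zeroʳ R)) 0≤B)

  -- Powers, signs and rounding

  2ℚ 3ℚ 7ℚ : ℚ
  2ℚ = 1ℚ + 1ℚ
  3ℚ = 2ℚ + 1ℚ
  7ℚ = 3ℚ + 3ℚ + 1ℚ

  0≤2 : 0ℚ ≤ 2ℚ
  0≤2 = 0≤+ 0≤1 0≤1

  0≤3 : 0ℚ ≤ 3ℚ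
  0≤3 = 0≤+ 0≤2 0≤1

  0≤7 : 0ℚ ≤ 7ℚ
  0≤7 = 0≤+ (0≤+ 0≤3 0≤3) 0≤1

  0<^ : ∀ {p} n → 0ℚ < p → 0ℚ < p ^ n
  0<^ zero    0<p = positive⁻¹ 1ℚ
  0<^ (suc n) 0<p = 0<* 0<p (0<^ n 0<p)

  0≤^ : ∀ {p} n → 0ℚ ≤ p → 0ℚ ≤ p ^ n
  0≤^ zero    0≤p = 0≤1
  0≤^ (suc n) 0≤p = 0≤* 0≤p (0≤^ n 0≤p)

  ^-monoˡ : ∀ {p q} n → 0ℚ ≤ p → p ≤ q → p ^ n ≤ q ^ n
  ^-monoˡ zero    0≤p p≤q = ≤-refl
  ^-monoˡ (suc n) 0≤p p≤q = *-mono (0≤^ n 0≤p) (≤-trans 0≤p p≤q) p≤q (^-monoˡ n 0≤p p≤q)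

  1^ : ∀ n → 1ℚ ^ n ≡ 1ℚ
  1^ zero    = refl
  1^ (suc n) = trans (*-identityˡ (1ℚ ^ n)) (1^ n)

  ⟦⟧-mono : ∀ {a b} → (T a → T b) → ⟦ a ⟧ ≤ ⟦ b ⟧
  ⟦⟧-mono {false} {b}     _   = 0≤⟦⟧ b
  ⟦⟧-mono {true}  {true}  _   = ≤-refl
  ⟦⟧-mono {true}  {false} a⇒b with () ← a⇒b _

  ⟦⟧*⟦⟧ : ∀ b → ⟦ b ⟧ * ⟦ b ⟧ ≡ ⟦ b ⟧
  ⟦⟧*⟦⟧ false = refl
  ⟦⟧*⟦⟧ true  = refl

  ⟦⟧-absorb : ∀ {a b} → (T a → T b) → ⟦ b ⟧ * ⟦ a ⟧ ≡ ⟦ a ⟧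
  ⟦⟧-absorb {false} {b}     _   = *-zeroʳ ⟦ b ⟧
  ⟦⟧-absorb {true}  {true}  _   = refl
  ⟦⟧-absorb {true}  {false} a⇒b with () ← a⇒b _

  -- Abstract, so that case distinctions do not unfold rational arithmetic.
  abstract
    leq : ℚ → ℚ → Bool
    leq p q = does (p ≤? q)

    leq-reflects : ∀ p q → Reflects (p ≤ q) (leq p q)
    leq-reflects p q = proof (p ≤? q)

  nonneg : ℚ → Bool
  nonneg = leq 0ℚ

  -- This turns the average of an absolute value into averages over two sets, to which regularity
  -- applies.
  ∣∣-split : ∀ p → ∣ p ∣ ≤ ⟦ nonneg p ⟧ * p + ⟦ nonneg (- p) ⟧ * - p
  ∣∣-split p = ∣∣≤
    (≤-trans (p≤pos p) (≤-by _ (0≤pos (- p)) refl))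
    (≤-trans (p≤pos (- p)) (≤-by _ (0≤pos p) (+-comm (⟦ nonneg p ⟧ * p) _)))
    where
    0≤pos : ∀ p → 0ℚ ≤ ⟦ nonneg p ⟧ * p
    0≤pos p with leq 0ℚ p | leq-reflects 0ℚ p
    ... | true  | ofʸ 0≤p = subst (0ℚ ≤_) (sym (*-identityˡ p)) 0≤p
    ... | false | ofⁿ _   = ≤-reflexive (sym (*-zeroˡ p))
    p≤pos : ∀ p → p ≤ ⟦ nonneg p ⟧ * p
    p≤pos p with leq 0ℚ p | leq-reflects 0ℚ p
    ... | true  | ofʸ _   = ≤-reflexive (sym (*-identityˡ p))
    ... | false | ofⁿ 0≰p = ≤-trans (<⇒≤ (≰⇒> 0≰p)) (≤-reflexive (sym (*-zeroˡ p)))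

  -- Recursion on an upper bound r also yields `n ≤ r`, so that a family of n sets is admissible for
  -- regularity with parameter r.
  ceiling : ∀ r {R} → 0ℚ ≤ R → R ≤ ι r → ∃[ n ] (n ℕ.≤ r) × (R ≤ ι n) × (ι n ≤ R + 1ℚ)
  ceiling zero    0≤R R≤0 = 0 , ℕ.z≤n , R≤0 , 0≤+ 0≤R 0≤1
  ceiling (suc r) {R} 0≤R R≤1+r with ≤-total R (ι r)
  ... | inj₁ R≤r = let n , n≤r , bounds = ceiling r 0≤R R≤r in n , ℕ.m≤n⇒m≤1+n n≤r , bounds
  ... | inj₂ r≤R = suc r , ℕ.≤-refl , R≤1+r ,
    ≤-trans (≤-reflexive (trans (ι-+ 1 r) (+-comm 1ℚ (ι r)))) (+-monoˡ-≤ 1ℚ r≤R)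

  -- When K consists of the triangles of a graph, boxes are the triangle sets of certain subgraphs,
  -- which is why hypergraph regularity applies to unions of them.
  box : ∀ {X P : Set} → (X → P → Bool) → (X → Bool) → (P → Bool) → X × P → Bool
  box K U V (x , p) = (U x ∧ V p) ∧ K x p

  jointLink : ∀ {X P : Set} {s} → (X → P → Bool) → Vec X s → P → Bool
  jointLink H []       p = true
  jointLink H (x ∷ xs) p = H x p ∧ jointLink H xs p

  -- The induction on the size of the tuple

  -- P stands for the set of pairs Y × Z, C for the edges of P[Y,Z], K for the triangles,
  -- and q, d for the densities d₃, d₂.
  module JointLinks {X P : Set} (mX : Mean X) (mP : Mean P)
    (C : P → Bool) (K H : X → P → Bool)
    (H⊆K : ∀ x p → T (H x p) → T (K x p)) (K⊆C : ∀ x p → T (K x p) → T (C p))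
    {d q M θ Δ : ℚ} (0<d : 0ℚ < d) (0≤q : 0ℚ ≤ q) (q≤M : q ≤ M) (1≤M : 1ℚ ≤ M)
    (0≤θ : 0ℚ ≤ θ) (0≤Δ : 0ℚ ≤ Δ) where

    e k : ℚ
    e = d * d
    k = E mX λ x → E mP λ p → ⟦ K x p ⟧

    f : X → P → ℚ
    f x p = ⟦ H x p ⟧ - q * ⟦ K x p ⟧

    deg : P → ℚ
    deg p = E mX λ x → ⟦ K x p ⟧

    joint : ∀ {s} → Vec X s → P → Bool
    joint = jointLink H

    -- The joint link of the empty tuple is C.
    size : ∀ {s} → Vec X s → ℚ
    size xs = E mP λ p → ⟦ C p ⟧ * ⟦ joint xs p ⟧

    τ : ℕ → ℚ
    τ s = d * e ^ s

    deviation : ∀ {s} → Vec X s → ℚ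
    deviation {s} xs = ∣ size xs - q ^ s * τ s ∣

    Err : ℕ → ℚ
    Err s = E (power mX s) deviation

    0<e : 0ℚ < e
    0<e = 0<* 0<d 0<d

    0≤e : 0ℚ ≤ e
    0≤e = <⇒≤ 0<e

    0≤M : 0ℚ ≤ M
    0≤M = ≤-trans 0≤1 1≤M

    0≤k : 0ℚ ≤ k
    0≤k = E-≥-const mX λ x → E-≥-const mP λ p → 0≤⟦⟧ (K x p)

    0≤deg : ∀ p → 0ℚ ≤ deg p
    0≤deg p = E-≥-const mX λ x → 0≤⟦⟧ (K x p)

    deg≤1 : ∀ p → deg p ≤ 1ℚ
    deg≤1 p = E-≤-const mX λ x → ⟦⟧≤1 (K x p)

    -- The s vertices are independent, and each has p in its link with probability at most `deg p`
    -- because H lies in K.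
    E-joint : ∀ s p → E (power mX s) (λ xs → ⟦ joint xs p ⟧) ≤ deg p ^ s
    E-joint zero    p = ≤-refl
    E-joint (suc s) p = begin
      E mX (λ x → E (power mX s) λ xs → ⟦ H x p ∧ joint xs p ⟧)
        ≡⟨ E-cong mX (λ x → trans (E-cong (power mX s) λ xs → ⟦∧⟧ (H x p) (joint xs p))
                                  (E-* (power mX s) ⟦ H x p ⟧ _)) ⟩
      E mX (λ x → ⟦ H x p ⟧ * E (power mX s) (λ xs → ⟦ joint xs p ⟧))
        ≤⟨ E-mono mX (λ x → *-mono (E-≥-const (power mX s) λ xs → 0≤⟦⟧ (joint xs p))
             (0≤⟦⟧ (K x p)) (⟦⟧-mono (H⊆K x p)) (E-joint s p)) ⟩
      E mX (λ x → ⟦ K x p ⟧ * deg p ^ s)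
        ≡⟨ E-*ʳ mX (deg p ^ s) _ ⟩
      deg p * deg p ^ s ∎
      where open ≤-Reasoning

    module _
      (cut : ∀ (U : X → Bool) (V : P → Bool) →
        ∣ E mX (λ x → ⟦ U x ⟧ * E mP λ p → ⟦ V p ⟧ * (⟦ K x p ⟧ - e * ⟦ C p ⟧)) ∣ ≤ Δ)
      where

      -- The pairs whose codegree exceeds its typical value e by a factor of two.
      heavy : P → Bool
      heavy p = not (leq (deg p) (2ℚ * e))

      v : ℚ
      v = E mP λ p → ⟦ C p ⟧ * ⟦ heavy p ⟧

      0≤v : 0ℚ ≤ v
      0≤v = E-≥-const mP λ p → 0≤* (0≤⟦⟧ (C p)) (0≤⟦⟧ (heavy p))

      -- On a heavy pair `deg p - e` exceeds e, so the discrepancy of K over all x and all heavy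
      -- pairs is at least `e * v`.
      e*v≤Δ : e * v ≤ Δ
      e*v≤Δ = begin
        e * v
          ≡⟨ E-* mP e _ ⟨
        E mP (λ p → e * (⟦ C p ⟧ * ⟦ heavy p ⟧))
          ≤⟨ E-mono mP pointwise ⟩
        E mP (λ p → ⟦ heavy p ⟧ * (deg p - e * ⟦ C p ⟧))
          ≡⟨ E-cong mP (λ p → trans (E-* mX ⟦ heavy p ⟧ _) (cong (⟦ heavy p ⟧ *_)
               (trans (E-- mX _ (λ _ → e * ⟦ C p ⟧)) (cong (λ c → deg p - c) (E-const mX _))))) ⟨
        E mP (λ p → E mX λ x → ⟦ heavy p ⟧ * (⟦ K x p ⟧ - e * ⟦ C p ⟧))
          ≡⟨ E-swap mP mX _ ⟩
        E mX (λ x → E mP λ p → ⟦ heavy p ⟧ * (⟦ K x p ⟧ - e * ⟦ C p ⟧))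
          ≡⟨ E-cong mX (λ x → *-identityˡ (E mP λ p → ⟦ heavy p ⟧ * (⟦ K x p ⟧ - e * ⟦ C p ⟧))) ⟨
        E mX (λ x → 1ℚ * E mP λ p → ⟦ heavy p ⟧ * (⟦ K x p ⟧ - e * ⟦ C p ⟧))
          ≤⟨ p≤∣p∣ _ ⟩
        _ ≤⟨ cut (λ _ → true) heavy ⟩
        Δ ∎
        where
        open ≤-Reasoning
        expand : ∀ D e c → 1ℚ * (D - e * c) ≡ e * (c * 1ℚ) + ((D - 2ℚ * e) + 2ℚ * (e * (1ℚ - c)))
        expand = solve-∀ ring
        pointwise : ∀ p → e * (⟦ C p ⟧ * ⟦ heavy p ⟧) ≤ ⟦ heavy p ⟧ * (deg p - e * ⟦ C p ⟧)
        pointwise p with leq (deg p) (2ℚ * e) | leq-reflects (deg p) (2ℚ * e)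
        ... | true  | ofʸ _ = ≤-reflexive (trans (cong (e *_) (*-zeroʳ ⟦ C p ⟧))
                        (trans (*-zeroʳ e) (sym (*-zeroˡ (deg p - e * ⟦ C p ⟧)))))
        ... | false | ofⁿ ≰ = ≤-by _
          (0≤+ (p≤q⇒0≤q-p (<⇒≤ (≰⇒> ≰))) (0≤* 0≤2 (0≤* 0≤e (p≤q⇒0≤q-p (⟦⟧≤1 (C p))))))
          (expand (deg p) e ⟦ C p ⟧)

      -- `cut` is applied twice, to the x with nonnegative inner average and to those with
      -- nonpositive one.
      E∣·∣≤2Δ : ∀ (V : P → Bool) →
        E mX (λ x → ∣ E mP (λ p → ⟦ V p ⟧ * (⟦ K x p ⟧ - e * ⟦ C p ⟧)) ∣) ≤ Δ + Δ
      E∣·∣≤2Δ V = begin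
        E mX (λ x → ∣ G x ∣)
          ≤⟨ E-mono mX (λ x → ∣∣-split (G x)) ⟩
        E mX (λ x → ⟦ nonneg (G x) ⟧ * G x + ⟦ nonneg (- G x) ⟧ * - G x)
          ≡⟨ trans (E-+ mX _ _) (cong (E mX (λ x → ⟦ nonneg (G x) ⟧ * G x) +_)
               (trans (E-cong mX λ x → sym (neg-distribʳ-* ⟦ nonneg (- G x) ⟧ (G x))) (E-neg mX _))) ⟩
        E mX (λ x → ⟦ nonneg (G x) ⟧ * G x) - E mX (λ x → ⟦ nonneg (- G x) ⟧ * G x)
          ≤⟨ +-mono-≤ (≤-trans (p≤∣p∣ _) (cut (λ x → nonneg (G x)) V))
                      (≤-trans (-p≤∣p∣ _) (cut (λ x → nonneg (- G x)) V)) ⟩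
        Δ + Δ ∎
        where
        open ≤-Reasoning
        G : X → ℚ
        G x = E mP λ p → ⟦ V p ⟧ * (⟦ K x p ⟧ - e * ⟦ C p ⟧)

      module _ (s : ℕ) where

        -- Bounds the probability that a light pair lies in a random joint link.
        κ₀ : ℚ
        κ₀ = (2ℚ * e) ^ s

        κ̄ : P → ℚ
        κ̄ p = if heavy p then 1ℚ else κ₀

        κ : X × P → ℚ
        κ (x , p) = ⟦ K x p ⟧ * κ̄ p

        0<κ₀ : 0ℚ < κ₀
        0<κ₀ = 0<^ s (0<* (positive⁻¹ 2ℚ) 0<e)

        0≤κ̄ : ∀ p → 0ℚ ≤ κ̄ p
        0≤κ̄ p with leq (deg p) (2ℚ * e) | leq-reflects (deg p) (2ℚ * e)
        ... | true  | ofʸ _ = <⇒≤ 0<κ₀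
        ... | false | ofⁿ _ = 0≤1

        0≤κ : ∀ w → 0ℚ ≤ κ w
        0≤κ (x , p) = 0≤* (0≤⟦⟧ (K x p)) (0≤κ̄ p)

        deg^s≤κ̄ : ∀ p → deg p ^ s ≤ κ̄ p
        deg^s≤κ̄ p with leq (deg p) (2ℚ * e) | leq-reflects (deg p) (2ℚ * e)
        ... | true  | ofʸ deg≤ = ^-monoˡ s (0≤deg p) deg≤
        ... | false | ofⁿ _    = ≤-trans (^-monoˡ s (0≤deg p) (deg≤1 p)) (≤-reflexive (1^ s))

        -- Triangles over light pairs contribute `κ₀ * κ₀` each. Over heavy pairs the bound 1 is
        -- used, together with K inside C, which produces `v`.
        E-κ² : E (mX ⊗ mP) (λ w → κ w * κ w) ≤ κ₀ * κ₀ * k + v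
        E-κ² = begin
          E mX (λ x → E mP λ p → κ (x , p) * κ (x , p))
            ≤⟨ E-mono mX (λ x → E-mono mP (pointwise x)) ⟩
          E mX (λ x → E mP λ p → κ₀ * κ₀ * ⟦ K x p ⟧ + ⟦ C p ⟧ * ⟦ heavy p ⟧)
            ≡⟨ E-cong mX (λ x → trans (E-+ mP _ _) (cong (_+ v) (E-* mP (κ₀ * κ₀) _))) ⟩
          E mX (λ x → κ₀ * κ₀ * E mP (λ p → ⟦ K x p ⟧) + v)
            ≡⟨ trans (E-+ mX _ _) (cong₂ _+_ (E-* mX (κ₀ * κ₀) (λ x → E mP λ p → ⟦ K x p ⟧)) (E-const mX v)) ⟩
          κ₀ * κ₀ * k + v ∎
          where
          open ≤-Reasoning
          light : ∀ K c κ → κ * κ * K + c * 0ℚ ≡ (K * κ) * κ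
          light = solve-∀ ring
          reorder : ∀ K κ → K * κ * (K * κ) ≡ (K * K) * κ * κ
          reorder = solve-∀ ring
          pointwise : ∀ x p → κ (x , p) * κ (x , p) ≤ κ₀ * κ₀ * ⟦ K x p ⟧ + ⟦ C p ⟧ * ⟦ heavy p ⟧
          pointwise x p = ≤-trans (≤-reflexive (trans (reorder ⟦ K x p ⟧ (κ̄ p))
            (cong (λ b → b * κ̄ p * κ̄ p) (⟦⟧*⟦⟧ (K x p))))) (bound p)
            where
            heavy-bound : ∀ K c κ → κ * κ * K + c * 1ℚ ≡ K * 1ℚ * 1ℚ + (c - K + κ * κ * K)
            heavy-bound = solve-∀ ring
            bound : ∀ p → ⟦ K x p ⟧ * κ̄ p * κ̄ p ≤ κ₀ * κ₀ * ⟦ K x p ⟧ + ⟦ C p ⟧ * ⟦ heavy p ⟧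
            bound p with leq (deg p) (2ℚ * e) | leq-reflects (deg p) (2ℚ * e)
            ... | true  | ofʸ _ = ≤-reflexive (sym (light ⟦ K x p ⟧ ⟦ C p ⟧ κ₀))
            ... | false | ofⁿ _ = ≤-by _
              (0≤+ (p≤q⇒0≤q-p (⟦⟧-mono (K⊆C x p)))
                   (0≤* (0≤* (<⇒≤ 0<κ₀) (<⇒≤ 0<κ₀)) (0≤⟦⟧ (K x p))))
              (heavy-bound ⟦ K x p ⟧ ⟦ C p ⟧ κ₀)

        module _ {r : ℕ} {R : ℚ} (0<R : 0ℚ < R) (R*κ₀≡θ : R * κ₀ ≡ θ) (R≤r : R ≤ ι r) where

          -- One copy of `M * θ * κ₀ * k` comes from overlaps over light pairs, the other from the
          -- regularity of H; the last summand comes from overlaps over heavy pairs.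
          error : ℚ
          error = 2ℚ * (M * θ * κ₀ * k) + M * (R * v)

          -- The greedy choice runs over the boxes formed by a joint link and by those x whose inner
          -- average over it is nonnegative. The average gain `Φ` of such a box is exactly the
          -- left-hand side. The bound on unions becomes `M * κ₀ * θ * k` after division by R, since
          -- `R * κ₀` is θ.
          E-positive-part : ∀ (g : X → P → ℚ) → (∀ x p → g x p ≤ M) →
            (∀ x p → ⟦ K x p ⟧ * g x p ≡ g x p) →
            (∀ {I : Set} (U : I → X → Bool) (V : I → P → Bool) (l : List I) → length l ℕ.≤ r →
               E (mX ⊗ mP) (λ w → ⟦ any (λ i → box K (U i) (V i) w) l ⟧ * g (proj₁ w) (proj₂ w))
                 ≤ M * (θ * θ) * k) →
            E (power mX s) (λ xs → E mX λ x →
              ⟦ nonneg (E mP λ p → ⟦ joint xs p ⟧ * g x p) ⟧ * E mP λ p → ⟦ joint xs p ⟧ * g x p)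
              ≤ error
          E-positive-part g g≤M K*g≡g gain≤ = begin
            E (power mX s) (λ xs → E mX λ x → ⟦ U xs x ⟧ * E mP λ p → ⟦ joint xs p ⟧ * g x p)
              ≡⟨ E-cong (power mX s) (λ xs → E-cong mX λ x → trans (sym (E-* mP ⟦ U xs x ⟧ _))
                   (E-cong mP λ p → sym (pointwise xs x p))) ⟩
            Φ
              ≤⟨ ≤-by _ (p≤q⇒0≤q-p (*-cancelˡ 0<R (≤-trans ΦR (≤-reflexive
                   (trans (cong (λ θ′ → M * (θ′ * θ) * k) (sym R*κ₀≡θ)) (factor M R κ₀ θ k))))))
                   (cancel Φ _ (R * M * M₂)) ⟩
            R * M * M₂ + M * κ₀ * θ * k
              ≤⟨ +-monoˡ-≤ _ (*-monoˡ (0≤* (<⇒≤ 0<R) 0≤M) E-κ²) ⟩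
            R * M * (κ₀ * κ₀ * k + v) + M * κ₀ * θ * k
              ≡⟨ collect R M κ₀ θ k v R*κ₀≡θ ⟩
            error ∎
            where
            open ≤-Reasoning
            U : Vec X s → X → Bool
            U xs x = nonneg (E mP λ p → ⟦ joint xs p ⟧ * g x p)
            Q : Vec X s → X × P → Bool
            Q xs w = box K (U xs) (joint xs) w
            Q≤κ : ∀ w → E (power mX s) (λ xs → ⟦ Q xs w ⟧) ≤ κ w
            Q≤κ (x , p) = begin
              E (power mX s) (λ xs → ⟦ (U xs x ∧ joint xs p) ∧ K x p ⟧)
                ≤⟨ E-mono (power mX s) (λ xs → ≤-trans (≤-reflexive (⟦∧⟧ (U xs x ∧ joint xs p) (K x p)))
                     (*-monoʳ (0≤⟦⟧ (K x p)) (⟦⟧-mono {U xs x ∧ joint xs p} {joint xs p} (∧-elimʳ {U xs x})))) ⟩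
              E (power mX s) (λ xs → ⟦ joint xs p ⟧ * ⟦ K x p ⟧)
                ≡⟨ trans (E-*ʳ (power mX s) ⟦ K x p ⟧ _) (*-comm _ ⟦ K x p ⟧) ⟩
              ⟦ K x p ⟧ * E (power mX s) (λ xs → ⟦ joint xs p ⟧)
                ≤⟨ *-monoˡ (0≤⟦⟧ (K x p)) (≤-trans (E-joint s p) (deg^s≤κ̄ p)) ⟩
              κ (x , p) ∎
            open Greedy (power mX s) (mX ⊗ mP) Q (λ w → g (proj₁ w) (proj₂ w)) κ
              0≤M (λ w → g≤M (proj₁ w) (proj₂ w)) 0≤κ Q≤κ
            ΦR : R * (Φ - R * M * M₂) ≤ M * (θ * θ) * k
            ΦR = let n , n≤r , R≤n , n≤R+1 = ceiling r (<⇒≤ 0<R) R≤r in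
              Φ-bound n (<⇒≤ 0<R) (0≤* (0≤* 0≤M (0≤* 0≤θ 0≤θ)) 0≤k) R≤n n≤R+1
                (λ l length-l → gain≤ U joint l (subst (ℕ._≤ r) (sym length-l) n≤r))
            pointwise : ∀ xs x p → ⟦ (U xs x ∧ joint xs p) ∧ K x p ⟧ * g x p ≡
                                   ⟦ U xs x ⟧ * (⟦ joint xs p ⟧ * g x p)
            pointwise xs x p = trans
              (cong (_* g x p) (trans (⟦∧⟧ (U xs x ∧ joint xs p) (K x p))
                                      (cong (_* ⟦ K x p ⟧) (⟦∧⟧ (U xs x) (joint xs p)))))
              (trans (reassoc ⟦ U xs x ⟧ ⟦ joint xs p ⟧ ⟦ K x p ⟧ (g x p))
                     (cong (λ y → ⟦ U xs x ⟧ * (⟦ joint xs p ⟧ * y)) (K*g≡g x p)))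
              where
              reassoc : ∀ u j K g → u * j * K * g ≡ u * (j * (K * g))
              reassoc = solve-∀ ring
            factor : ∀ M R κ θ k → M * (R * κ * θ) * k ≡ R * (M * κ * θ * k)
            factor = solve-∀ ring
            cancel : ∀ φ a m → m + a ≡ φ + (a - (φ - m))
            cancel = solve-∀ ring
            collect : ∀ R M κ θ k v → R * κ ≡ θ →
              R * M * (κ * κ * k + v) + M * κ * θ * k ≡ 2ℚ * (M * θ * κ * k) + M * (R * v)
            collect R M κ _ k v refl = expand R M κ k v
              where
              expand : ∀ R M κ k v →
                R * M * (κ * κ * k + v) + M * κ * (R * κ) * k ≡ 2ℚ * (M * (R * κ) * κ * k) + M * (R * v)
              expand = solve-∀ ring

          module _ (regular : ∀ {I : Set} (U : I → X → Bool) (V : I → P → Bool) (l : List I) →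
            length l ℕ.≤ r →
            ∣ E (mX ⊗ mP) (λ w → ⟦ any (λ i → box K (U i) (V i) w) l ⟧ * f (proj₁ w) (proj₂ w)) ∣
              ≤ M * (θ * θ) * k) where

            D : Vec X s → X → ℚ
            D xs x = E mP λ p → ⟦ joint xs p ⟧ * f x p

            -- The previous estimate is used for f and for its negative. Both are at most M, not 1,
            -- because q may exceed 1; multiplication by K fixes them because H lies in K.
            E∣D∣ : E (power mX s) (λ xs → E mX λ x → ∣ D xs x ∣) ≤ error + error
            E∣D∣ = begin
              E (power mX s) (λ xs → E mX λ x → ∣ D xs x ∣)
                ≤⟨ E-mono (power mX s) (λ xs → E-mono mX λ x → ∣∣-split (D xs x)) ⟩
              E (power mX s) (λ xs → E mX λ x →
                ⟦ nonneg (D xs x) ⟧ * D xs x + ⟦ nonneg (- D xs x) ⟧ * - D xs x)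
                ≡⟨ trans (E-cong (power mX s) λ xs → E-+ mX _ _) (E-+ (power mX s) _ _) ⟩
              E (power mX s) (λ xs → E mX λ x → ⟦ nonneg (D xs x) ⟧ * D xs x) +
              E (power mX s) (λ xs → E mX λ x → ⟦ nonneg (- D xs x) ⟧ * - D xs x)
                ≡⟨ cong (E (power mX s) (λ xs → E mX λ x → ⟦ nonneg (D xs x) ⟧ * D xs x) +_)
                     (E-cong (power mX s) λ xs → E-cong mX λ x →
                       cong (λ y → ⟦ nonneg y ⟧ * y) (-D xs x)) ⟩
              E (power mX s) (λ xs → E mX λ x → ⟦ nonneg (D xs x) ⟧ * D xs x) +
              E (power mX s) (λ xs → E mX λ x →
                ⟦ nonneg (E mP λ p → ⟦ joint xs p ⟧ * - f x p) ⟧ * E mP λ p → ⟦ joint xs p ⟧ * - f x p)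
                ≤⟨ +-mono-≤
                     (E-positive-part f (λ x p → f≤M (0≤⟦⟧ (K x p)) (⟦⟧≤1 (H x p))) K*f
                       (λ U V l len → ≤-trans (p≤∣p∣ _) (regular U V l len)))
                     (E-positive-part (λ x p → - f x p)
                       (λ x p → -f≤M (0≤⟦⟧ (H x p)) (⟦⟧≤1 (K x p)))
                       (λ x p → trans (sym (neg-distribʳ-* ⟦ K x p ⟧ (f x p))) (cong -_ (K*f x p)))
                       (λ U V l len → ≤-trans (≤-reflexive (trans
                         (E-cong (mX ⊗ mP) λ w → sym (neg-distribʳ-*
                           ⟦ any (λ i → box K (U i) (V i) w) l ⟧ (f (proj₁ w) (proj₂ w))))
                         (E-neg (mX ⊗ mP) _)))
                         (≤-trans (-p≤∣p∣ _) (regular U V l len)))) ⟩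
              error + error ∎
              where
              open ≤-Reasoning
              -D : ∀ xs x → - D xs x ≡ E mP λ p → ⟦ joint xs p ⟧ * - f x p
              -D xs x = sym (trans (E-cong mP λ p → sym (neg-distribʳ-* ⟦ joint xs p ⟧ (f x p)))
                                   (E-neg mP _))
              f≤M : ∀ {h k} → 0ℚ ≤ k → h ≤ 1ℚ → h - q * k ≤ M
              f≤M {h} {k} 0≤k h≤1 = ≤-trans
                (≤-by _ (0≤+ (p≤q⇒0≤q-p h≤1) (0≤* 0≤q 0≤k)) (rearrange h q k)) 1≤M
                where
                rearrange : ∀ h q k → 1ℚ ≡ h - q * k + (1ℚ - h + q * k)
                rearrange = solve-∀ ring
              -f≤M : ∀ {h k} → 0ℚ ≤ h → k ≤ 1ℚ → - (h - q * k) ≤ M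
              -f≤M {h} {k} 0≤h k≤1 = ≤-trans
                (≤-by _ (0≤+ 0≤h (0≤* 0≤q (p≤q⇒0≤q-p k≤1))) (rearrange h q k)) q≤M
                where
                rearrange : ∀ h q k → q ≡ - (h - q * k) + (h + q * (1ℚ - k))
                rearrange = solve-∀ ring
              K*f : ∀ x p → ⟦ K x p ⟧ * f x p ≡ f x p
              K*f x p = trans (distribute ⟦ K x p ⟧ ⟦ H x p ⟧ q)
                (cong₂ (λ h k → h - q * k) (⟦⟧-absorb (H⊆K x p)) (⟦⟧*⟦⟧ (K x p)))
                where
                distribute : ∀ k h q → k * (h - q * k) ≡ k * h - q * (k * k)
                distribute = solve-∀ ring

            -- Writing H as f + q (K - e C) + q e C splits the new joint link into the fluctuation
            -- `D` of H over K, the fluctuation `G` of K over C, and `q * e` times the old joint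
            -- link.
            Err-suc : Err (suc s) ≤ error + error + q * (Δ + Δ) + q * e * Err s
            Err-suc = begin
              E mX (λ x → E (power mX s) λ xs → deviation (x ∷ xs))
                ≡⟨ E-swap mX (power mX s) _ ⟩
              E (power mX s) (λ xs → E mX λ x → deviation (x ∷ xs))
                ≤⟨ E-mono (power mX s) (λ xs → E-mono mX λ x → triangle xs x) ⟩
              E (power mX s) (λ xs → E mX λ x → ∣ D xs x ∣ + q * ∣ G xs x ∣ + q * e * deviation xs)
                ≡⟨ E-cong (power mX s) (λ xs → trans (E-+ mX _ _)
                     (cong₂ _+_ (trans (E-+ mX _ _) (cong (E mX (λ x → ∣ D xs x ∣) +_) (E-* mX q _)))
                                (E-const mX (q * e * deviation xs)))) ⟩
              E (power mX s) (λ xs →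
                E mX (λ x → ∣ D xs x ∣) + q * E mX (λ x → ∣ G xs x ∣) + q * e * deviation xs)
                ≤⟨ E-mono (power mX s) (λ xs → +-monoˡ-≤ (q * e * deviation xs)
                     (+-monoʳ-≤ (E mX (λ x → ∣ D xs x ∣)) (*-monoˡ 0≤q (E∣·∣≤2Δ (joint xs))))) ⟩
              E (power mX s) (λ xs → E mX (λ x → ∣ D xs x ∣) + q * (Δ + Δ) + q * e * deviation xs)
                ≡⟨ trans (E-+ (power mX s) _ _) (cong₂ _+_
                     (trans (E-+ (power mX s) _ _) (cong (E (power mX s) (λ xs → E mX λ x → ∣ D xs x ∣) +_)
                       (E-const (power mX s) (q * (Δ + Δ)))))
                     (E-* (power mX s) (q * e) deviation)) ⟩
              E (power mX s) (λ xs → E mX λ x → ∣ D xs x ∣) + q * (Δ + Δ) + q * e * Err s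
                ≤⟨ +-monoˡ-≤ (q * e * Err s) (+-monoˡ-≤ (q * (Δ + Δ)) E∣D∣) ⟩
              error + error + q * (Δ + Δ) + q * e * Err s ∎
              where
              open ≤-Reasoning
              G : Vec X s → X → ℚ
              G xs x = E mP λ p → ⟦ joint xs p ⟧ * (⟦ K x p ⟧ - e * ⟦ C p ⟧)
              split : ∀ h j k c → c * h ≡ h →
                c * (h * j) ≡ j * (h - q * k) + q * (j * (k - e * c)) + q * e * (c * j)
              split h j k c c*h≡h = trans (trans (sym (*-assoc c h j)) (cong (_* j) c*h≡h))
                (expand h j k c q e)
                where
                expand : ∀ h j k c q e →
                  h * j ≡ j * (h - q * k) + q * (j * (k - e * c)) + q * e * (c * j)
                expand = solve-∀ ring
              size-∷ : ∀ xs x → size (x ∷ xs) ≡ D xs x + q * G xs x + q * e * size xs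
              size-∷ xs x = trans
                (E-cong mP λ p → trans (cong (⟦ C p ⟧ *_) (⟦∧⟧ (H x p) (joint xs p)))
                  (split ⟦ H x p ⟧ ⟦ joint xs p ⟧ ⟦ K x p ⟧ ⟦ C p ⟧
                    (⟦⟧-absorb (λ h → K⊆C x p (H⊆K x p h)))))
                (trans (E-+ mP _ _) (cong₂ _+_
                  (trans (E-+ mP _ _) (cong (D xs x +_) (E-* mP q _)))
                  (E-* mP (q * e) _)))
              triangle : ∀ xs x →
                deviation (x ∷ xs) ≤ ∣ D xs x ∣ + q * ∣ G xs x ∣ + q * e * deviation xs
              triangle xs x = begin
                ∣ size (x ∷ xs) - q ^ suc s * τ (suc s) ∣
                  ≡⟨ cong ∣_∣ (trans (cong (_- q ^ suc s * τ (suc s)) (size-∷ xs x))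
                       (regroup (D xs x) (G xs x) q e (size xs) (q ^ s) d (e ^ s))) ⟩
                ∣ D xs x + q * G xs x + q * e * (size xs - q ^ s * τ s) ∣
                  ≤⟨ ≤-trans (∣p+q∣≤∣p∣+∣q∣ (D xs x + q * G xs x) _)
                       (+-monoˡ-≤ ∣ q * e * (size xs - q ^ s * τ s) ∣ (∣p+q∣≤∣p∣+∣q∣ (D xs x) (q * G xs x))) ⟩
                ∣ D xs x ∣ + ∣ q * G xs x ∣ + ∣ q * e * (size xs - q ^ s * τ s) ∣
                  ≡⟨ cong₂ (λ a b → ∣ D xs x ∣ + a + b) (∣*∣ (G xs x) 0≤q)
                       (∣*∣ (size xs - q ^ s * τ s) (0≤* 0≤q 0≤e)) ⟩
                ∣ D xs x ∣ + q * ∣ G xs x ∣ + q * e * deviation xs ∎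
                where
                regroup : ∀ D G q e n a d b → D + q * G + q * e * n - q * a * (d * (e * b)) ≡
                  D + q * G + q * e * (n - a * (d * b))
                regroup = solve-∀ ring

      module _ {r t : ℕ} {β μ : ℚ} (0≤μ : 0ℚ ≤ μ) (θ≤1 : θ ≤ 1ℚ)
        (R : ℕ → ℚ) (0<R : ∀ s → 0ℚ < R s) (R*κ₀≡θ : ∀ s → R s * κ₀ s ≡ θ)
        (R≤r : ∀ s → s ℕ.< t → R s ≤ ι r)
        (regular : ∀ {I : Set} (U : I → X → Bool) (V : I → P → Bool) (l : List I) →
          length l ℕ.≤ r →
          ∣ E (mX ⊗ mP) (λ w → ⟦ any (λ i → box K (U i) (V i) w) l ⟧ * f (proj₁ w) (proj₂ w)) ∣
            ≤ M * (θ * θ) * k)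
        (density : ∣ E mP (λ p → ⟦ C p ⟧) - d ∣ ≤ μ * d)
        (k≤ : k ≤ 2ℚ * (e * d))
        (small : ∀ s → s ℕ.< t → 2ℚ * M * Δ ≤ μ * τ (suc s))
        (smaller : ∀ s → s ℕ.< t → 2ℚ * M * Δ ≤ μ * τ (suc s) * e ^ suc s)
        (β≥ : 2ℚ ^ (3 ℕ.+ t) * (M * θ) + 2ℚ * μ ≤ β)
        where

        private
          0≤τ : ∀ s → 0ℚ ≤ τ s
          0≤τ s = 0≤* (<⇒≤ 0<d) (0≤^ s 0≤e)

          0≤2^Mθ : ∀ n → 0ℚ ≤ 2ℚ ^ n * (M * θ)
          0≤2^Mθ n = 0≤* (0≤^ n 0≤2) (0≤* 0≤M 0≤θ)

          μ≤β : μ ≤ β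
          μ≤β = ≤-trans (≤-by _ (0≤+ (0≤2^Mθ (3 ℕ.+ t)) 0≤μ) (double (2ℚ ^ (3 ℕ.+ t) * (M * θ)) μ)) β≥
            where
            double : ∀ a μ → a + 2ℚ * μ ≡ μ + (a + μ)
            double = solve-∀ ring

          1≤[1+M]^ : ∀ s → 1ℚ ≤ (1ℚ + M) ^ s
          1≤[1+M]^ s = ≤-trans (≤-reflexive (sym (1^ s)))
            (^-monoˡ s 0≤1 (≤-by M 0≤M refl))

          2^-mono : ∀ {m n} → m ℕ.≤ n → 2ℚ ^ m ≤ 2ℚ ^ n
          2^-mono {n = n} ℕ.z≤n = ≤-trans (≤-reflexive (sym (1^ n))) (^-monoˡ n 0≤1 (≤-by 1ℚ 0≤1 refl))
          2^-mono (ℕ.s≤s m≤n) = *-monoˡ 0≤2 (2^-mono m≤n)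

          -- After multiplication by `e ^ suc s`, one factor is `R s * e ^ s`, at most
          -- `R s * κ₀ s = θ`, and the other is `e * v`, at most Δ. The extra power of e in
          -- `smaller` pays for this multiplication.
          overlap≤ : ∀ s → s ℕ.< t → 2ℚ * M * (R s * v) ≤ μ * τ (suc s)
          overlap≤ s s<t = *-cancelˡ (0<^ (suc s) 0<e) (begin
            e ^ suc s * (2ℚ * M * (R s * v))
              ≡⟨ regroup e (e ^ s) (R s) v M ⟩
            2ℚ * M * ((R s * e ^ s) * (e * v))
              ≤⟨ *-monoˡ (0≤* 0≤2 0≤M) (*-mono (0≤* 0≤e 0≤v) 0≤1 Re^s≤1 e*v≤Δ) ⟩
            2ℚ * M * (1ℚ * Δ)
              ≡⟨ cong (2ℚ * M *_) (*-identityˡ Δ) ⟩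
            2ℚ * M * Δ
              ≤⟨ smaller s s<t ⟩
            μ * τ (suc s) * e ^ suc s
              ≡⟨ *-comm (μ * τ (suc s)) (e ^ suc s) ⟩
            e ^ suc s * (μ * τ (suc s)) ∎)
            where
            open ≤-Reasoning
            regroup : ∀ e a R v M → e * a * (2ℚ * M * (R * v)) ≡ 2ℚ * M * ((R * a) * (e * v))
            regroup = solve-∀ ring
            Re^s≤1 : R s * e ^ s ≤ 1ℚ
            Re^s≤1 = ≤-trans
              (*-monoˡ (<⇒≤ (0<R s)) (^-monoˡ s 0≤e (≤-by e 0≤e (double e))))
              (≤-trans (≤-reflexive (R*κ₀≡θ s)) θ≤1)
              where
              double : ∀ e → 2ℚ * e ≡ e + e
              double = solve-∀ ring

        -- Relative to `τ`, a step adds a new error of at most β and multiplies the old one by at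
        -- most M. As `(1ℚ + M) ^ s` is at least 1, the factor `1ℚ + M` covers both.
        Err-bound : ∀ s → s ℕ.≤ t → Err s ≤ β * (1ℚ + M) ^ s * τ s
        Err-bound zero _ = begin
          ∣ E mP (λ p → ⟦ C p ⟧ * 1ℚ) - 1ℚ * (d * 1ℚ) ∣
            ≡⟨ cong₂ (λ a b → ∣ a - b ∣) (E-cong mP λ p → *-identityʳ ⟦ C p ⟧)
                 (trans (*-identityˡ (d * 1ℚ)) (*-identityʳ d)) ⟩
          ∣ E mP (λ p → ⟦ C p ⟧) - d ∣
            ≤⟨ density ⟩
          μ * d
            ≤⟨ *-monoʳ (<⇒≤ 0<d) μ≤β ⟩
          β * d
            ≡⟨ cong₂ _*_ (*-identityʳ β) (*-identityʳ d) ⟨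
          β * 1ℚ * (d * 1ℚ) ∎
          where open ≤-Reasoning
        Err-bound (suc s) s<t = begin
          Err (suc s)
            ≤⟨ Err-suc s {r} (0<R s) (R*κ₀≡θ s) (R≤r s s<t) regular ⟩
          err + err + q * (Δ + Δ) + q * e * Err s
            ≤⟨ +-mono-≤ fresh (*-mono 0≤Err 0≤Me (*-monoʳ 0≤e q≤M) (Err-bound s (ℕ.<⇒≤ s<t))) ⟩
          β * τ′ + M * e * (β * (1ℚ + M) ^ s * τ s)
            ≤⟨ ≤-by _ (0≤* (0≤* (≤-trans 0≤μ μ≤β) (0≤τ (suc s))) (p≤q⇒0≤q-p (1≤[1+M]^ s)))
                 (collect M e β ((1ℚ + M) ^ s) d (e ^ s)) ⟩
          β * (1ℚ + M) ^ suc s * τ′ ∎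
          where
          open ≤-Reasoning
          τ′ err : ℚ
          τ′ = τ (suc s)
          err = error s {r} (0<R s) (R*κ₀≡θ s) (R≤r s s<t)
          0≤Err : 0ℚ ≤ Err s
          0≤Err = E-≥-const (power mX s) λ xs → 0≤∣p∣ (size xs - q ^ s * τ s)
          0≤Me : 0ℚ ≤ M * e
          0≤Me = 0≤* 0≤M 0≤e
          collect : ∀ M e β a d b → β * ((1ℚ + M) * a) * (d * (e * b)) ≡
            β * (d * (e * b)) + M * e * (β * a * (d * b)) + β * (d * (e * b)) * (a - 1ℚ)
          collect = solve-∀ ring
          -- The exponent `3 ℕ.+ s` collects the two outer factors, the one in `k≤`, and the s
          -- factors in `κ₀ s`.
          main : 2ℚ * (2ℚ * (M * θ * κ₀ s * k)) ≤ 2ℚ ^ (3 ℕ.+ t) * (M * θ) * τ′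
          main = begin
            2ℚ * (2ℚ * (M * θ * κ₀ s * k))
              ≤⟨ *-monoˡ 0≤2 (*-monoˡ 0≤2 (*-monoˡ (0≤* (0≤* 0≤M 0≤θ) (<⇒≤ (0<κ₀ s))) k≤)) ⟩
            2ℚ * (2ℚ * (M * θ * κ₀ s * (2ℚ * (e * d))))
              ≡⟨ cong (λ κ → 2ℚ * (2ℚ * (M * θ * κ * (2ℚ * (e * d))))) (^-distrib-* 2ℚ e s) ⟩
            2ℚ * (2ℚ * (M * θ * (2ℚ ^ s * e ^ s) * (2ℚ * (e * d))))
              ≡⟨ regroup M θ (2ℚ ^ s) (e ^ s) e d ⟩
            2ℚ ^ (3 ℕ.+ s) * (M * θ) * τ′
              ≤⟨ *-monoʳ (0≤τ (suc s)) (*-monoʳ (0≤* 0≤M 0≤θ) (2^-mono (ℕ.+-monoʳ-≤ 3 (ℕ.<⇒≤ s<t)))) ⟩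
            2ℚ ^ (3 ℕ.+ t) * (M * θ) * τ′ ∎
            where
            regroup : ∀ M θ a b e d → 2ℚ * (2ℚ * (M * θ * (a * b) * (2ℚ * (e * d)))) ≡
              2ℚ * (2ℚ * (2ℚ * a)) * (M * θ) * (d * (e * b))
            regroup = solve-∀ ring
          fresh : err + err + q * (Δ + Δ) ≤ β * τ′
          fresh = begin
            err + err + q * (Δ + Δ)
              ≡⟨ regroup (M * θ * κ₀ s * k) M (R s * v) q Δ ⟩
            2ℚ * (2ℚ * (M * θ * κ₀ s * k)) + 2ℚ * M * (R s * v) + 2ℚ * q * Δ
              ≤⟨ +-mono-≤ (+-mono-≤ main (overlap≤ s s<t))
                   (≤-trans (*-monoʳ 0≤Δ (*-monoˡ 0≤2 q≤M)) (small s s<t)) ⟩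
            2ℚ ^ (3 ℕ.+ t) * (M * θ) * τ′ + μ * τ′ + μ * τ′
              ≡⟨ factor (2ℚ ^ (3 ℕ.+ t) * (M * θ)) μ τ′ ⟩
            (2ℚ ^ (3 ℕ.+ t) * (M * θ) + 2ℚ * μ) * τ′
              ≤⟨ *-monoʳ (0≤τ (suc s)) β≥ ⟩
            β * τ′ ∎
            where
            regroup : ∀ a M b q Δ → 2ℚ * a + M * b + (2ℚ * a + M * b) + q * (Δ + Δ) ≡
              2ℚ * (2ℚ * a) + 2ℚ * M * b + 2ℚ * q * Δ
            regroup = solve-∀ ring
            factor : ∀ a μ τ → a * τ + μ * τ + μ * τ ≡ (a + 2ℚ * μ) * τ
            factor = solve-∀ ring

  ^-antitone : ∀ {p m n} → 0ℚ ≤ p → p ≤ 1ℚ → m ℕ.≤ n → p ^ n ≤ p ^ m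
  ^-antitone {n = n} 0≤p p≤1 ℕ.z≤n = ≤-trans (^-monoˡ n 0≤p p≤1) (≤-reflexive (1^ n))
  ^-antitone 0≤p p≤1 (ℕ.s≤s m≤n) = *-monoˡ 0≤p (^-antitone 0≤p p≤1 m≤n)

  -- Consequences of bipartite regularity

  Regular : ∀ {I J : Set} → Mean I → Mean J → ℚ → ℚ → (I → J → Bool) → Set
  Regular {I} {J} mI mJ δ d G = ∀ (U : I → Bool) (V : J → Bool) →
    ∣ E mI (λ i → E mJ λ j → ⟦ U i ∧ V j ∧ G i j ⟧)
      - d * (E mI (λ i → ⟦ U i ⟧) * E mJ (λ j → ⟦ V j ⟧)) ∣ ≤ δ

  module _ {I J : Set} (mI : Mean I) (mJ : Mean J) {δ d : ℚ} {G : I → J → Bool}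
    (regular : Regular mI mJ δ d G) where

    discrepancy : ∀ (U : I → Bool) (V : J → Bool) →
      ∣ E mI (λ i → E mJ λ j → ⟦ U i ⟧ * (⟦ V j ⟧ * (⟦ G i j ⟧ - d))) ∣ ≤ δ
    discrepancy U V = ≤-trans (≤-reflexive (cong ∣_∣ (begin
      E mI (λ i → E mJ λ j → ⟦ U i ⟧ * (⟦ V j ⟧ * (⟦ G i j ⟧ - d)))
        ≡⟨ E-cong mI (λ i → E-cong mJ λ j → trans
             (expand ⟦ U i ⟧ ⟦ V j ⟧ ⟦ G i j ⟧ d)
             (cong (_- d * (⟦ U i ⟧ * ⟦ V j ⟧)) (sym (trans (⟦∧⟧ (U i) (V j ∧ G i j))
               (cong (⟦ U i ⟧ *_) (⟦∧⟧ (V j) (G i j))))))) ⟩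
      E mI (λ i → E mJ λ j → ⟦ U i ∧ V j ∧ G i j ⟧ - d * (⟦ U i ⟧ * ⟦ V j ⟧))
        ≡⟨ E-cong mI (λ i → trans (E-- mJ _ _) (cong (λ c → E mJ (λ j → ⟦ U i ∧ V j ∧ G i j ⟧) - c)
             (trans (E-* mJ d _) (cong (d *_) (E-* mJ ⟦ U i ⟧ _))))) ⟩
      E mI (λ i → E mJ (λ j → ⟦ U i ∧ V j ∧ G i j ⟧) - d * (⟦ U i ⟧ * E mJ (λ j → ⟦ V j ⟧)))
        ≡⟨ trans (E-- mI _ _) (cong (λ c → E mI (λ i → E mJ λ j → ⟦ U i ∧ V j ∧ G i j ⟧) - c)
             (trans (E-* mI d _) (cong (d *_) (E-*ʳ mI (E mJ (λ j → ⟦ V j ⟧)) _)))) ⟩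
      E mI (λ i → E mJ λ j → ⟦ U i ∧ V j ∧ G i j ⟧)
        - d * (E mI (λ i → ⟦ U i ⟧) * E mJ (λ j → ⟦ V j ⟧)) ∎))) (regular U V)
      where
      open ≡-Reasoning
      expand : ∀ u v g d → u * (v * (g - d)) ≡ u * (v * g) - d * (u * v)
      expand = solve-∀ ring

    density : ∣ E (mI ⊗ mJ) (λ p → ⟦ G (proj₁ p) (proj₂ p) ⟧) - d ∣ ≤ δ
    density = ≤-trans (≤-reflexive (cong (λ c → ∣ E (mI ⊗ mJ) (λ p → ⟦ G (proj₁ p) (proj₂ p) ⟧) - c ∣)
      (sym (trans (cong (d *_) (trans (cong₂ _*_ (E-const mI 1ℚ) (E-const mJ 1ℚ)) (*-identityˡ 1ℚ)))
        (*-identityʳ d))))) (regular (λ _ → true) (λ _ → true))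

    -- The actual density is at most 1. This is the source of the upper bound on d.
    d≤1+δ : d ≤ 1ℚ + δ
    d≤1+δ = ≤-by _
      (0≤+ (p≤q⇒0≤q-p (E-≤-const (mI ⊗ mJ) λ p → ⟦⟧≤1 (G (proj₁ p) (proj₂ p))))
           (p≤q⇒0≤q-p (≤-trans (-p≤∣p∣ _) density)))
      (rearrange d δ (E (mI ⊗ mJ) λ p → ⟦ G (proj₁ p) (proj₂ p) ⟧))
      where
      rearrange : ∀ d δ a → 1ℚ + δ ≡ d + (1ℚ - a + (δ - - (a - d)))
      rearrange = solve-∀ ring

  triangle : ∀ {X Y Z : Set} → (X → Y → Bool) → (X → Z → Bool) → (Y → Z → Bool) →
             X → Y × Z → Bool
  triangle A B C x (y , z) = A x y ∧ C y z ∧ B x z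

  module _ {X Y Z : Set} (mX : Mean X) (mY : Mean Y) (mZ : Mean Z)
    {A : X → Y → Bool} {B : X → Z → Bool} {C : Y → Z → Bool} {δ d : ℚ} (0≤d : 0ℚ ≤ d)
    (A-regular : Regular mX mY δ d A) (B-regular : Regular mX mZ δ d B) where

    -- With AB - d² = (A - d)B + d(B - d), the first summand is controlled by the
    -- regularity of A for each fixed z, the second by that of B for each fixed y.
    cut : ∀ (U : X → Bool) (V : Y × Z → Bool) →
      ∣ E mX (λ x → ⟦ U x ⟧ * E (mY ⊗ mZ) λ p → ⟦ V p ⟧ *
          (⟦ triangle A B C x p ⟧ - d * d * ⟦ C (proj₁ p) (proj₂ p) ⟧)) ∣ ≤ δ + d * δ
    cut U V = begin
      ∣ E mX (λ x → ⟦ U x ⟧ * E (mY ⊗ mZ) λ p → ⟦ V p ⟧ *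
          (⟦ triangle A B C x p ⟧ - d * d * ⟦ C (proj₁ p) (proj₂ p) ⟧)) ∣
        ≡⟨ cong ∣_∣ (trans (E-cong mX split) (trans (E-+ mX _ _) (cong₂ _+_ first second))) ⟩
      ∣ E mZ fixed-z + d * E mY fixed-y ∣
        ≤⟨ ∣p+q∣≤∣p∣+∣q∣ (E mZ fixed-z) (d * E mY fixed-y) ⟩
      ∣ E mZ fixed-z ∣ + ∣ d * E mY fixed-y ∣
        ≡⟨ cong (∣ E mZ fixed-z ∣ +_) (∣*∣ (E mY fixed-y) 0≤d) ⟩
      ∣ E mZ fixed-z ∣ + d * ∣ E mY fixed-y ∣
        ≤⟨ +-mono-≤
             (≤-trans (∣E∣≤E∣∣ mZ fixed-z) (E-≤-const mZ λ z →
               discrepancy mX mY A-regular (λ x → U x ∧ B x z) (λ y → V (y , z) ∧ C y z)))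
             (*-monoˡ 0≤d (≤-trans (∣E∣≤E∣∣ mY fixed-y) (E-≤-const mY λ y →
               discrepancy mX mZ B-regular U (λ z → V (y , z) ∧ C y z)))) ⟩
      δ + d * δ ∎
      where
      open ≤-Reasoning
      a : X → Y → Z → ℚ
      a x y z = ⟦ U x ∧ B x z ⟧ * (⟦ V (y , z) ∧ C y z ⟧ * (⟦ A x y ⟧ - d))
      b : X → Y → Z → ℚ
      b x y z = ⟦ U x ⟧ * (⟦ V (y , z) ∧ C y z ⟧ * (⟦ B x z ⟧ - d))
      fixed-z : Z → ℚ
      fixed-z z = E mX λ x → E mY λ y → a x y z
      fixed-y : Y → ℚ
      fixed-y y = E mX λ x → E mZ λ z → b x y z
      expand : ∀ u v a b c d → u * (v * (a * (c * b) - d * d * c)) ≡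
        u * b * (v * c * (a - d)) + d * (u * (v * c * (b - d)))
      expand = solve-∀ ring
      pointwise : ∀ x y z → ⟦ U x ⟧ * (⟦ V (y , z) ⟧ *
        (⟦ triangle A B C x (y , z) ⟧ - d * d * ⟦ C y z ⟧)) ≡ a x y z + d * b x y z
      pointwise x y z = trans
        (cong (λ k → ⟦ U x ⟧ * (⟦ V (y , z) ⟧ * (k - d * d * ⟦ C y z ⟧)))
          (trans (⟦∧⟧ (A x y) (C y z ∧ B x z)) (cong (⟦ A x y ⟧ *_) (⟦∧⟧ (C y z) (B x z)))))
        (trans (expand ⟦ U x ⟧ ⟦ V (y , z) ⟧ ⟦ A x y ⟧ ⟦ B x z ⟧ ⟦ C y z ⟧ d)
          (sym (cong₂ (λ ub vc → ub * (vc * (⟦ A x y ⟧ - d)) + d * (⟦ U x ⟧ * (vc * (⟦ B x z ⟧ - d))))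
            (⟦∧⟧ (U x) (B x z)) (⟦∧⟧ (V (y , z)) (C y z)))))
      split : ∀ x → ⟦ U x ⟧ * E (mY ⊗ mZ) (λ p → ⟦ V p ⟧ *
          (⟦ triangle A B C x p ⟧ - d * d * ⟦ C (proj₁ p) (proj₂ p) ⟧)) ≡
        E mY (λ y → E mZ λ z → a x y z) + d * E mY (λ y → E mZ λ z → b x y z)
      split x = trans (sym (E-* (mY ⊗ mZ) ⟦ U x ⟧ _)) (trans
        (E-cong (mY ⊗ mZ) λ p → pointwise x (proj₁ p) (proj₂ p))
        (trans (E-+ (mY ⊗ mZ) (λ p → a x (proj₁ p) (proj₂ p)) (λ p → d * b x (proj₁ p) (proj₂ p)))
          (cong (E mY (λ y → E mZ λ z → a x y z) +_)
            (E-* (mY ⊗ mZ) d (λ p → b x (proj₁ p) (proj₂ p))))))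
      first : E mX (λ x → E mY λ y → E mZ λ z → a x y z) ≡ E mZ fixed-z
      first = trans (E-cong mX λ x → E-swap mY mZ _) (E-swap mX mZ _)
      second : E mX (λ x → d * E mY λ y → E mZ λ z → b x y z) ≡ d * E mY fixed-y
      second = trans (E-* mX d (λ x → E mY λ y → E mZ λ z → b x y z)) (cong (d *_) (E-swap mX mY _))

  -- The joint link estimate for a triad

  module _ {X Y Z : Set} (mX : Mean X) (mY : Mean Y) (mZ : Mean Z)
    {A : X → Y → Bool} {B : X → Z → Bool} {C : Y → Z → Bool} {H : X → Y × Z → Bool}
    (H⊆K : ∀ x p → T (H x p) → T (triangle A B C x p))
    {d q M θ δ μ β ℓ : ℚ} {r t : ℕ}
    (0<ℓ : 0ℚ < ℓ) (ℓ≤1 : ℓ ≤ 1ℚ) (ℓ≤d : ℓ ≤ d) (0<d : 0ℚ < d)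
    (0≤q : 0ℚ ≤ q) (q≤M : q ≤ M) (1≤M : 1ℚ ≤ M) (0≤θ : 0ℚ ≤ θ) (θ≤1 : θ ≤ 1ℚ)
    (0≤δ : 0ℚ ≤ δ) (0≤μ : 0ℚ ≤ μ) (μ≤1 : μ ≤ 1ℚ) (1≤t : 1 ℕ.≤ t)
    (δ≤ : 7ℚ * (M * δ) ≤ μ * (ℓ * ((ℓ * ℓ) ^ t * (ℓ * ℓ) ^ t)))
    (β≥ : 2ℚ ^ (3 ℕ.+ t) * (M * θ) + 2ℚ * μ ≤ β)
    (A-regular : Regular mX mY δ d A) (B-regular : Regular mX mZ δ d B)
    (C-regular : Regular mY mZ δ d C)
    (R : ℕ → ℚ) (0<R : ∀ s → 0ℚ < R s) (R*κ₀≡θ : ∀ s → R s * (2ℚ * (d * d)) ^ s ≡ θ)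
    (R≤r : ∀ s → s ℕ.< t → R s ≤ ι r)
    where

    private
      K : X → Y × Z → Bool
      K = triangle A B C

      C₂ : Y × Z → Bool
      C₂ (y , z) = C y z

      K⊆C : ∀ x p → T (K x p) → T (C₂ p)
      K⊆C x (y , z) with A x y | C y z
      ... | true  | true  = λ _ → _
      ... | true  | false = λ ()
      ... | false | _     = λ ()

      -- The bound `δ + d * δ` of `cut`, with `d ≤ 2ℚ`.
      Δ : ℚ
      Δ = 2ℚ * δ + δ

      0≤Δ : 0ℚ ≤ Δ
      0≤Δ = 0≤+ (0≤* 0≤2 0≤δ) 0≤δ

      open JointLinks mX (mY ⊗ mZ) C₂ K H H⊆K K⊆C 0<d 0≤q q≤M 1≤M 0≤θ 0≤Δ

      -- `Λ` is a common lower bound for d, `e * d`, `τ s` and `τ s * e ^ s` with s up to t. It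
      -- depends only on a lower bound ℓ for d, so δ can be fixed before d is approximated.
      Λ L : ℚ
      L = ℓ * ℓ
      Λ = ℓ * (L ^ t * L ^ t)

      0≤ℓ : 0ℚ ≤ ℓ
      0≤ℓ = <⇒≤ 0<ℓ

      0≤L : 0ℚ ≤ L
      0≤L = 0≤* 0≤ℓ 0≤ℓ

      L≤1 : L ≤ 1ℚ
      L≤1 = *-mono 0≤ℓ 0≤1 ℓ≤1 ℓ≤1

      L^≤1 : ∀ n → L ^ n ≤ 1ℚ
      L^≤1 n = ^-antitone {m = 0} {n} 0≤L L≤1 ℕ.z≤n

      L^≤e^ : ∀ s → s ℕ.≤ t → L ^ t ≤ e ^ s
      L^≤e^ s s≤t = ≤-trans (^-antitone 0≤L L≤1 s≤t)
        (^-monoˡ s 0≤L (*-mono 0≤ℓ (<⇒≤ 0<d) ℓ≤d ℓ≤d))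

      Λ≤ : ∀ {a b} → L ^ t ≤ a → L ^ t ≤ b → 0ℚ ≤ a → Λ ≤ d * (a * b)
      Λ≤ L≤a L≤b 0≤a = *-mono (0≤* (0≤^ t 0≤L) (0≤^ t 0≤L)) (<⇒≤ 0<d) ℓ≤d
        (*-mono (0≤^ t 0≤L) 0≤a L≤a L≤b)

      Λ≤τ : ∀ s → s ℕ.≤ t → Λ ≤ τ s
      Λ≤τ s s≤t = ≤-trans (Λ≤ (L^≤e^ s s≤t) (L^≤1 t) (0≤^ s 0≤e))
        (≤-reflexive (cong (d *_) (*-identityʳ (e ^ s))))

      Λ≤τe : ∀ s → s ℕ.≤ t → Λ ≤ τ s * e ^ s
      Λ≤τe s s≤t = ≤-trans (Λ≤ (L^≤e^ s s≤t) (L^≤e^ s s≤t) (0≤^ s 0≤e))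
        (≤-reflexive (sym (*-assoc d (e ^ s) (e ^ s))))

      0≤Mδ : 0ℚ ≤ M * δ
      0≤Mδ = 0≤* 0≤M 0≤δ

      7δ≤Λ : 7ℚ * δ ≤ μ * Λ
      7δ≤Λ = ≤-trans (*-monoˡ 0≤7
        (≤-trans (≤-reflexive (sym (*-identityˡ δ))) (*-monoʳ 0≤δ 1≤M))) δ≤

      6Mδ≤Λ : 2ℚ * M * Δ ≤ μ * Λ
      6Mδ≤Λ = ≤-trans (≤-by _ 0≤Mδ (seven M δ)) δ≤
        where
        seven : ∀ M δ → 7ℚ * (M * δ) ≡ 2ℚ * M * (2ℚ * δ + δ) + M * δ
        seven = solve-∀ ring

      Λ≤d : Λ ≤ d
      Λ≤d = ≤-trans (Λ≤τ 0 ℕ.z≤n) (≤-reflexive (*-identityʳ d))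

      Λ≤ed : Λ ≤ e * d
      Λ≤ed = ≤-trans (Λ≤τ 1 1≤t) (≤-reflexive (trans (cong (d *_) (*-identityʳ e)) (*-comm d e)))

      0≤Λ : 0ℚ ≤ Λ
      0≤Λ = 0≤* 0≤ℓ (0≤* (0≤^ t 0≤L) (0≤^ t 0≤L))

      μΛ≤Λ : μ * Λ ≤ Λ
      μΛ≤Λ = ≤-trans (*-monoʳ 0≤Λ μ≤1) (≤-reflexive (*-identityˡ Λ))

      δ≤7δ : δ ≤ 7ℚ * δ
      δ≤7δ = ≤-by _ (0≤* (0≤+ 0≤3 0≤3) 0≤δ) (six δ)
        where
        six : ∀ δ → 7ℚ * δ ≡ δ + (3ℚ + 3ℚ) * δ
        six = solve-∀ ring

      δ≤1 : δ ≤ 1ℚ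
      δ≤1 = ≤-trans δ≤7δ (≤-trans 7δ≤Λ (≤-trans μΛ≤Λ
        (*-mono (0≤* (0≤^ t 0≤L) (0≤^ t 0≤L)) 0≤1 ℓ≤1
          (*-mono (0≤^ t 0≤L) 0≤1 (L^≤1 t) (L^≤1 t)))))

      d≤2 : d ≤ 2ℚ
      d≤2 = ≤-trans (d≤1+δ mX mY A-regular) (+-monoʳ-≤ 1ℚ δ≤1)

      cut≤Δ : ∀ (U : X → Bool) (V : Y × Z → Bool) →
        ∣ E mX (λ x → ⟦ U x ⟧ * E (mY ⊗ mZ) λ p → ⟦ V p ⟧ * (⟦ K x p ⟧ - e * ⟦ C₂ p ⟧)) ∣ ≤ Δ
      cut≤Δ U V = ≤-trans (cut mX mY mZ {C = C} (<⇒≤ 0<d) A-regular B-regular U V)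
        (≤-trans (+-monoʳ-≤ δ (*-monoʳ 0≤δ d≤2)) (≤-reflexive (+-comm δ (2ℚ * δ))))

      -- With c the density of C, k is at most e c + 3δ, hence at most e d + e δ + 3δ. Since
      -- `d ≤ 2ℚ` gives e at most 4, the error is at most 7δ, which explains the constant `7ℚ`.
      k≤ : k ≤ 2ℚ * (e * d)
      k≤ = ≤-by _
        (0≤+ (p≤q⇒0≤q-p (≤-trans (p≤∣p∣ _) (cut≤Δ (λ _ → true) (λ _ → true))))
        (0≤+ (0≤* 0≤e (p≤q⇒0≤q-p (≤-trans (p≤∣p∣ _) (density mY mZ C-regular))))
        (0≤+ (0≤* (p≤q⇒0≤q-p (*-mono (<⇒≤ 0<d) 0≤2 d≤2 d≤2)) 0≤δ)
             (p≤q⇒0≤q-p (≤-trans 7δ≤Λ (≤-trans μΛ≤Λ Λ≤ed))))))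
        (trans (expand k (E (mY ⊗ mZ) (λ p → ⟦ C₂ p ⟧)) e d δ)
          (cong (λ y → k + (Δ - y + rest)) (sym E-K)))
        where
        rest : ℚ
        rest = e * (δ - (E (mY ⊗ mZ) (λ p → ⟦ C₂ p ⟧) - d)) + ((2ℚ * 2ℚ - e) * δ + (e * d - 7ℚ * δ))
        expand : ∀ k c e d δ → 2ℚ * (e * d) ≡
          k + (2ℚ * δ + δ - (k - e * c) + (e * (δ - (c - d)) + ((2ℚ * 2ℚ - e) * δ + (e * d - 7ℚ * δ))))
        expand = solve-∀ ring
        E-K : E mX (λ x → 1ℚ * E (mY ⊗ mZ) λ p → 1ℚ * (⟦ K x p ⟧ - e * ⟦ C₂ p ⟧)) ≡
              k - e * E (mY ⊗ mZ) (λ p → ⟦ C₂ p ⟧)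
        E-K = trans
          (E-cong mX λ x → trans (*-identityˡ (E (mY ⊗ mZ) λ p → 1ℚ * (⟦ K x p ⟧ - e * ⟦ C₂ p ⟧)))
            (trans (E-cong (mY ⊗ mZ) λ p → *-identityˡ (⟦ K x p ⟧ - e * ⟦ C₂ p ⟧))
              (trans (E-- (mY ⊗ mZ) _ _) (cong (λ y → E (mY ⊗ mZ) (λ p → ⟦ K x p ⟧) - y)
                (E-* (mY ⊗ mZ) e _)))))
          (trans (E-- mX _ _) (cong (λ y → k - y) (E-const mX _)))

    jointLink-error :
      (∀ {I : Set} (U : I → X → Bool) (V : I → Y × Z → Bool) (l : List I) → length l ℕ.≤ r →
        ∣ E (mX ⊗ mY ⊗ mZ) (λ w → ⟦ any (λ i → box K (U i) (V i) w) l ⟧ *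
            (⟦ H (proj₁ w) (proj₂ w) ⟧ - q * ⟦ K (proj₁ w) (proj₂ w) ⟧)) ∣
          ≤ M * (θ * θ) * E (mX ⊗ mY ⊗ mZ) (λ w → ⟦ K (proj₁ w) (proj₂ w) ⟧)) →
      E (power mX t) (λ xs →
        ∣ E (mY ⊗ mZ) (λ p → ⟦ C (proj₁ p) (proj₂ p) ⟧ * ⟦ jointLink H xs p ⟧) - q ^ t * (d * (d * d) ^ t) ∣)
        ≤ β * (1ℚ + M) ^ t * (d * (d * d) ^ t)
    jointLink-error hypergraph-regular = Err-bound cut≤Δ {r} 0≤μ θ≤1 R 0<R R*κ₀≡θ R≤r hypergraph-regular
      (≤-trans (density mY mZ C-regular)
        (≤-trans δ≤7δ (≤-trans 7δ≤Λ (*-monoˡ 0≤μ Λ≤d))))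
      k≤
      (λ s s<t → ≤-trans 6Mδ≤Λ (*-monoˡ 0≤μ (Λ≤τ (suc s) s<t)))
      (λ s s<t → ≤-trans 6Mδ≤Λ (≤-trans (*-monoˡ 0≤μ (Λ≤τe (suc s) s<t))
        (≤-reflexive (sym (*-assoc μ (τ (suc s)) (e ^ suc s))))))
      β≥ t ℕ.≤-refl

  -- Counts as averages

  ι-∑ : ∀ {n} (f : Fin n → ℕ) → ι (∑ f) ≡ sum (λ i → ι (f i))
  ι-∑ {zero}  f = refl
  ι-∑ {suc n} f = trans (ι-+ (f zero) (∑ λ i → f (suc i))) (cong (ι (f zero) +_) (ι-∑ (λ i → f (suc i))))

  ι-∑-mean : ∀ {n} (f : Fin (suc n) → ℕ) → ι (∑ f) ≡ ι (suc n) * E (uniform n) (λ i → ι (f i))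
  ι-∑-mean {n} f = trans (ι-∑ f) (sym (uniform-sum n (λ i → ι (f i))))

  ι-if : ∀ b → ι (if b then 1 else 0) ≡ ⟦ b ⟧
  ι-if false = refl
  ι-if true  = refl

  ι-#₂ : ∀ {a b} (S : Pairs (suc a) (suc b)) →
    ι (#₂ S) ≡ ι (suc a ℕ.* suc b) * E (uniform a) (λ x → E (uniform b) λ y → ⟦ S x y ⟧)
  ι-#₂ {a} {b} S = begin
    ι (∑ λ x → ∑ λ y → if S x y then 1 else 0)
      ≡⟨ ι-∑-mean (λ x → ∑ λ y → if S x y then 1 else 0) ⟩
    ι (suc a) * E (uniform a) (λ x → ι (∑ λ y → if S x y then 1 else 0))
      ≡⟨ cong (ι (suc a) *_) (E-cong (uniform a) λ x → trans (ι-∑-mean (λ y → if S x y then 1 else 0))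
           (cong (ι (suc b) *_) (E-cong (uniform b) λ y → ι-if (S x y)))) ⟩
    ι (suc a) * E (uniform a) (λ x → ι (suc b) * E (uniform b) λ y → ⟦ S x y ⟧)
      ≡⟨ cong (ι (suc a) *_) (E-* (uniform a) (ι (suc b)) _) ⟩
    ι (suc a) * (ι (suc b) * E (uniform a) λ x → E (uniform b) λ y → ⟦ S x y ⟧)
      ≡⟨ *-assoc (ι (suc a)) (ι (suc b)) _ ⟨
    ι (suc a) * ι (suc b) * E (uniform a) (λ x → E (uniform b) λ y → ⟦ S x y ⟧)
      ≡⟨ cong (_* E (uniform a) (λ x → E (uniform b) λ y → ⟦ S x y ⟧)) (ι-* (suc a) (suc b)) ⟨
    ι (suc a ℕ.* suc b) * E (uniform a) (λ x → E (uniform b) λ y → ⟦ S x y ⟧) ∎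
    where open ≡-Reasoning

  ι-#₃ : ∀ {a b c} (S : Triples (suc a) (suc b) (suc c)) →
    ι (#₃ S) ≡ ι (suc a) * ι (suc b ℕ.* suc c) *
      E (uniform a ⊗ uniform b ⊗ uniform c) (λ w → ⟦ S (proj₁ w) (proj₁ (proj₂ w)) (proj₂ (proj₂ w)) ⟧)
  ι-#₃ {a} {b} {c} S = begin
    ι (#₃ S)
      ≡⟨ ι-∑-mean (λ x → #₂ (S x)) ⟩
    ι (suc a) * E (uniform a) (λ x → ι (#₂ (S x)))
      ≡⟨ cong (ι (suc a) *_) (trans (E-cong (uniform a) λ x → ι-#₂ (S x))
           (E-* (uniform a) (ι (suc b ℕ.* suc c)) _)) ⟩
    ι (suc a) * (ι (suc b ℕ.* suc c) *
      E (uniform a) (λ x → E (uniform b) λ y → E (uniform c) λ z → ⟦ S x y z ⟧))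
      ≡⟨ *-assoc (ι (suc a)) (ι (suc b ℕ.* suc c)) _ ⟨
    ι (suc a) * ι (suc b ℕ.* suc c) *
      E (uniform a) (λ x → E (uniform b) λ y → E (uniform c) λ z → ⟦ S x y z ⟧) ∎
    where open ≡-Reasoning

  ∣tabulate∣ : ∀ {n} (U : Fin n → Bool) → Subset.∣ tabulate U ∣ ≡ ∑ λ i → if U i then 1 else 0
  ∣tabulate∣ {zero}  U = refl
  ∣tabulate∣ {suc n} U with U zero
  ... | true  = cong suc (∣tabulate∣ (λ i → U (suc i)))
  ... | false = ∣tabulate∣ (λ i → U (suc i))

  ι-∣tabulate∣ : ∀ {n} (U : Fin (suc n) → Bool) →
    ι Subset.∣ tabulate U ∣ ≡ ι (suc n) * E (uniform n) (λ i → ⟦ U i ⟧)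
  ι-∣tabulate∣ {n} U = trans (cong ι (∣tabulate∣ U)) (trans (ι-∑-mean (λ i → if U i then 1 else 0))
    (cong (ι (suc n) *_) (E-cong (uniform n) λ i → ι-if (U i))))

  uniform-regular : ∀ {a b} {δ d : ℚ} {G : Pairs (suc a) (suc b)} →
    (∀ A′ B′ → ∣ ι (edgesBetween G A′ B′) - d * ι (Subset.∣ A′ ∣ ℕ.* Subset.∣ B′ ∣) ∣
      ≤ δ * ι (suc a ℕ.* suc b)) →
    Regular (uniform a) (uniform b) δ d G
  uniform-regular {a} {b} {δ} {d} {G} regular U V = ∣∣-cancel (0<ι (b ℕ.+ a ℕ.* suc b)) (≤-trans
    (≤-reflexive (cong ∣_∣ (begin
      n * (e - d * (u * v))
        ≡⟨ distribute n e d (u * v) ⟩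
      n * e - d * (n * (u * v))
        ≡⟨ cong₂ (λ p q → p - d * q) edges sizes ⟨
      ι (edgesBetween G (tabulate U) (tabulate V))
        - d * ι (Subset.∣ tabulate U ∣ ℕ.* Subset.∣ tabulate V ∣) ∎)))
    (regular (tabulate U) (tabulate V)))
    where
    open ≡-Reasoning
    n e u v : ℚ
    n = ι (suc a ℕ.* suc b)
    e = E (uniform a) λ x → E (uniform b) λ y → ⟦ U x ∧ V y ∧ G x y ⟧
    u = E (uniform a) λ x → ⟦ U x ⟧
    v = E (uniform b) λ y → ⟦ V y ⟧
    distribute : ∀ n e d w → n * (e - d * w) ≡ n * e - d * (n * w)
    distribute = solve-∀ ring
    exchange : ∀ m n u v → m * u * (n * v) ≡ m * n * (u * v)
    exchange = solve-∀ ring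
    edges : ι (edgesBetween G (tabulate U) (tabulate V)) ≡ n * e
    edges = trans (ι-#₂ (λ x y → lookup (tabulate U) x ∧ lookup (tabulate V) y ∧ G x y))
      (cong (n *_) (E-cong (uniform a) λ x → E-cong (uniform b) λ y →
        cong₂ (λ s t → ⟦ s ∧ t ∧ G x y ⟧) (lookup∘tabulate U x) (lookup∘tabulate V y)))
    sizes : ι (Subset.∣ tabulate U ∣ ℕ.* Subset.∣ tabulate V ∣) ≡ n * (u * v)
    sizes = trans (ι-* Subset.∣ tabulate U ∣ Subset.∣ tabulate V ∣)
      (trans (cong₂ _*_ (ι-∣tabulate∣ U) (ι-∣tabulate∣ V))
        (trans (exchange (ι (suc a)) (ι (suc b)) u v) (cong (_* (u * v)) (sym (ι-* (suc a) (suc b))))))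

  -- Unions of boxes as families of subgraphs

  module _ {a b c : ℕ} (P : TripartiteGraph a b c) where

    -- Every triangle has one edge in each bipartite part. Thinning `XY` by its first endpoint and
    -- `YZ` by the whole edge therefore leaves exactly the triangles of a box.
    restrict : (Fin a → Bool) → (Fin b × Fin c → Bool) → TripartiteGraph a b c
    restrict U V = record
      { XY = λ x y → U x ∧ XY P x y
      ; YZ = λ y z → V (y , z) ∧ YZ P y z
      ; XZ = XZ P
      }

    restrict⊆ : ∀ U V → restrict U V ⊆ᴳ P
    restrict⊆ U V = record
      { XY⊆ = λ x y → ∧-elimʳ {U x}
      ; YZ⊆ = λ y z → ∧-elimʳ {V (y , z)}
      ; XZ⊆ = λ x z h → h
      }

    module _ {I : Set} (U : I → Fin a → Bool) (V : I → Fin b × Fin c → Bool) where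

      -- The family is padded with empty graphs up to the required length r.
      family : ∀ {r} → List I → Fin r → TripartiteGraph a b c
      family []      _       = restrict (λ _ → false) (λ _ → false)
      family (i ∷ l) zero    = restrict (U i) (V i)
      family (i ∷ l) (suc j) = family l j

      family⊆ : ∀ {r} l (j : Fin r) → family l j ⊆ᴳ P
      family⊆ []      _       = restrict⊆ _ _
      family⊆ (i ∷ l) zero    = restrict⊆ (U i) (V i)
      family⊆ (i ∷ l) (suc j) = family⊆ l j

      boxes : List I → Triples a b c
      boxes l x y z = any (λ i → box (triangle (XY P) (XZ P) (YZ P)) (U i) (V i) (x , y , z)) l

      -- Here E is arbitrary, so that the set of all triples gives the union of the triangle sets
      -- itself.
      ⋃-family : ∀ {r} l → length l ℕ.≤ r → ∀ (E : Triples a b c) x y z →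
        ⋃₃ {r} (λ j → E ∩₃ K₃ (family l j)) x y z ≡ E x y z ∧ boxes l x y z
      ⋃-family {zero}  []      _ E x y z = sym (∧-zeroʳ (E x y z))
      ⋃-family {suc r} []      _ E x y z =
        cong₂ _∨_ (∧-zeroʳ (E x y z)) (⋃-family {r} [] ℕ.z≤n E x y z)
      ⋃-family {suc r} (i ∷ l) (ℕ.s≤s len) E x y z = trans
        (cong₂ _∨_ (cong (E x y z ∧_) (swap (U i x) (V i (y , z)) (XY P x y) (YZ P y z)))
                   (⋃-family l len E x y z))
        (sym (∧-distribˡ-∨ (E x y z) (box (triangle (XY P) (XZ P) (YZ P)) (U i) (V i) (x , y , z))
                (boxes l x y z)))
        where
        swap : ∀ u v s t {w} → (u ∧ s) ∧ (v ∧ t) ∧ w ≡ (u ∧ v) ∧ (s ∧ t ∧ w)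
        swap false v     s     t = refl
        swap true  false false t = refl
        swap true  false true  t = refl
        swap true  true  s     t = refl

      boxes⊆ : ∀ l x y z → T (boxes l x y z) → T (K₃ P x y z)
      boxes⊆ (i ∷ l) x y z = ∨-elim (∧-elimʳ {U i x ∧ V i (y , z)}) (boxes⊆ l x y z)

  sections : ∀ {a b c} → Triples a b c → Fin a → Fin b × Fin c → Bool
  sections E x (y , z) = E x y z

  rescale : ∀ {n h w k H W K q ρ} → 0ℚ < n → H ≡ n * h → W ≡ n * w → K ≡ n * k →
    ρ * k < w → (ρ * K < W → ∣ H - q * W ∣ ≤ ρ * K) → ∣ h - q * w ∣ ≤ ρ * k
  rescale {n} {h} {w} {k} {q = q} {ρ} 0<n refl refl refl ρk<w hyp = ∣∣-cancel 0<n
    (subst₂ _≤_ (cong ∣_∣ (regroup n h q w)) (commute ρ n k)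
      (hyp (subst (_< n * w) (commute′ ρ n k) (*-monoʳ-<-pos n {{positive 0<n}} ρk<w))))
    where
    regroup : ∀ n h q w → n * h - q * (n * w) ≡ n * (h - q * w)
    regroup = solve-∀ ring
    commute : ∀ ρ n k → ρ * (n * k) ≡ ρ * k * n
    commute = solve-∀ ring
    commute′ : ∀ ρ n k → n * (ρ * k) ≡ ρ * (n * k)
    commute′ = solve-∀ ring

  ∣h-qw∣≤Mw : ∀ {h w q M} → 0ℚ ≤ q → q ≤ M → 1ℚ ≤ M → 0ℚ ≤ h → 0ℚ ≤ w → h ≤ w → ∣ h - q * w ∣ ≤ M * w
  ∣h-qw∣≤Mw {h} {w} {q} {M} 0≤q q≤M 1≤M 0≤h 0≤w h≤w = ∣∣≤
    (≤-by _ (0≤+ (p≤q⇒0≤q-p h≤w) (0≤+ (0≤* (p≤q⇒0≤q-p 1≤M) 0≤w) (0≤* 0≤q 0≤w)))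
      (upper h w q M))
    (≤-by _ (0≤+ 0≤h (0≤* (p≤q⇒0≤q-p q≤M) 0≤w)) (lower h w q M))
    where
    upper : ∀ h w q M → M * w ≡ h - q * w + (w - h + ((M - 1ℚ) * w + q * w))
    upper = solve-∀ ring
    lower : ∀ h w q M → M * w ≡ - (h - q * w) + (h + (M - q) * w)
    lower = solve-∀ ring

  -- A union of density below ρ in K satisfies the estimate for trivial reasons.
  dichotomy : ∀ {n h w k H W K q M ρ} → 0ℚ < n → 0ℚ ≤ q → q ≤ M → 1ℚ ≤ M → 0ℚ ≤ ρ →
    0ℚ ≤ h → 0ℚ ≤ w → 0ℚ ≤ k → h ≤ w → H ≡ n * h → W ≡ n * w → K ≡ n * k →
    (ρ * K < W → ∣ H - q * W ∣ ≤ ρ * K) → ∣ h - q * w ∣ ≤ M * ρ * k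
  dichotomy {n} {h} {w} {k} {q = q} {M} {ρ} 0<n 0≤q q≤M 1≤M 0≤ρ 0≤h 0≤w 0≤k h≤w #H #W #K hyp
    with leq w (ρ * k) | leq-reflects w (ρ * k)
  ... | true  | ofʸ w≤ρk = ≤-trans (∣h-qw∣≤Mw 0≤q q≤M 1≤M 0≤h 0≤w h≤w)
    (≤-trans (*-monoˡ (≤-trans 0≤1 1≤M) w≤ρk) (≤-reflexive (sym (*-assoc M ρ k))))
  ... | false | ofⁿ w≰ρk = ≤-trans
    (rescale {n} {h} {w} {k} {q = q} {ρ} 0<n #H #W #K (≰⇒> w≰ρk) hyp)
    (*-monoʳ 0≤k (≤-trans (≤-reflexive (sym (*-identityˡ ρ))) (*-monoʳ 0≤ρ 1≤M)))

  module _ {a b c : ℕ} {P : TripartiteGraph (suc a) (suc b) (suc c)}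
    {E : Triples (suc a) (suc b) (suc c)} {q M ρ : ℚ} {r : ℕ}
    (0≤q : 0ℚ ≤ q) (q≤M : q ≤ M) (1≤M : 1ℚ ≤ M) (0≤ρ : 0ℚ ≤ ρ)
    (regular : ∀ (Q : Fin r → TripartiteGraph (suc a) (suc b) (suc c)) → (∀ j → Q j ⊆ᴳ P) →
      ρ * ι (#₃ (K₃ P)) < ι (#₃ (⋃₃ λ j → K₃ (Q j))) →
      ∣ ι (#₃ (⋃₃ λ j → E ∩₃ K₃ (Q j))) - q * ι (#₃ (⋃₃ λ j → K₃ (Q j))) ∣ ≤ ρ * ι (#₃ (K₃ P)))
    where

    private
      mean : (Fin (suc a) × Fin (suc b) × Fin (suc c) → ℚ) → ℚ
      mean = Mean.E (uniform a ⊗ uniform b ⊗ uniform c)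

      n : ℚ
      n = ι (suc a) * ι (suc b ℕ.* suc c)

      0<n : 0ℚ < n
      0<n = 0<* (0<ι a) (0<ι (c ℕ.+ b ℕ.* suc c))

      K : Fin (suc a) → Fin (suc b) × Fin (suc c) → Bool
      K = triangle (XY P) (XZ P) (YZ P)

      0≤M : 0ℚ ≤ M
      0≤M = ≤-trans 0≤1 1≤M

    -- The union of boxes lies in K, so weighting `E - q K` by it leaves the deviation that
    -- hypergraph regularity controls. The factor M comes from sparse unions.
    uniform-hypergraph-regular : ∀ {I : Set} (U : I → Fin (suc a) → Bool)
      (V : I → Fin (suc b) × Fin (suc c) → Bool) (l : List I) → length l ℕ.≤ r →
      ∣ mean (λ w → ⟦ any (λ i → box K (U i) (V i) w) l ⟧ *
          (⟦ sections E (proj₁ w) (proj₂ w) ⟧ - q * ⟦ K (proj₁ w) (proj₂ w) ⟧)) ∣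
        ≤ M * ρ * mean (λ w → ⟦ K (proj₁ w) (proj₂ w) ⟧)
    uniform-hypergraph-regular U V l len = subst (λ y → ∣ y ∣ ≤ M * ρ * k) (sym split) bound
      where
      Q : Fin r → TripartiteGraph (suc a) (suc b) (suc c)
      Q = family P U V l
      W : Triples (suc a) (suc b) (suc c)
      W = boxes P U V l
      k w h : ℚ
      k = mean λ p → ⟦ K (proj₁ p) (proj₂ p) ⟧
      w = mean λ p → ⟦ W (proj₁ p) (proj₁ (proj₂ p)) (proj₂ (proj₂ p)) ⟧
      h = mean λ p → ⟦ (E ∩₃ W) (proj₁ p) (proj₁ (proj₂ p)) (proj₂ (proj₂ p)) ⟧
      expand : ∀ w e k q → w * (e - q * k) ≡ e * w - q * (k * w)
      expand = solve-∀ ring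
      split : mean (λ p → ⟦ any (λ i → box K (U i) (V i) p) l ⟧ *
        (⟦ sections E (proj₁ p) (proj₂ p) ⟧ - q * ⟦ K (proj₁ p) (proj₂ p) ⟧)) ≡ h - q * w
      split = trans
        (E-cong (uniform a ⊗ uniform b ⊗ uniform c) λ (x , y , z) →
          trans (expand ⟦ W x y z ⟧ ⟦ E x y z ⟧ ⟦ K x (y , z) ⟧ q)
            (cong₂ (λ s t → s - q * t) (sym (⟦∧⟧ (E x y z) (W x y z)))
              (⟦⟧-absorb (boxes⊆ P U V l x y z))))
        (trans (E-- (uniform a ⊗ uniform b ⊗ uniform c)
                 (λ p → ⟦ (E ∩₃ W) (proj₁ p) (proj₁ (proj₂ p)) (proj₂ (proj₂ p)) ⟧)
                 (λ p → q * ⟦ W (proj₁ p) (proj₁ (proj₂ p)) (proj₂ (proj₂ p)) ⟧))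
          (cong (λ y → h - y) (E-* (uniform a ⊗ uniform b ⊗ uniform c) q
                 (λ p → ⟦ W (proj₁ p) (proj₁ (proj₂ p)) (proj₂ (proj₂ p)) ⟧))))
      #K : ι (#₃ (K₃ P)) ≡ n * k
      #K = ι-#₃ (K₃ P)
      #W : ι (#₃ (⋃₃ λ j → K₃ (Q j))) ≡ n * w
      #W = trans (ι-#₃ (⋃₃ λ j → K₃ (Q j))) (cong (n *_)
        (E-cong (uniform a ⊗ uniform b ⊗ uniform c) λ (x , y , z) →
          cong ⟦_⟧ (⋃-family P U V l len (λ _ _ _ → true) x y z)))
      #H : ι (#₃ (⋃₃ λ j → E ∩₃ K₃ (Q j))) ≡ n * h
      #H = trans (ι-#₃ (⋃₃ λ j → E ∩₃ K₃ (Q j))) (cong (n *_)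
        (E-cong (uniform a ⊗ uniform b ⊗ uniform c) λ (x , y , z) →
          cong ⟦_⟧ (⋃-family P U V l len E x y z)))
      0≤k : 0ℚ ≤ k
      0≤k = E-≥-const (uniform a ⊗ uniform b ⊗ uniform c) λ p → 0≤⟦⟧ (K (proj₁ p) (proj₂ p))
      0≤w : 0ℚ ≤ w
      0≤w = E-≥-const (uniform a ⊗ uniform b ⊗ uniform c) λ (x , y , z) → 0≤⟦⟧ (W x y z)
      0≤h : 0ℚ ≤ h
      0≤h = E-≥-const (uniform a ⊗ uniform b ⊗ uniform c) λ (x , y , z) → 0≤⟦⟧ ((E ∩₃ W) x y z)
      h≤w : h ≤ w
      h≤w = E-mono (uniform a ⊗ uniform b ⊗ uniform c) λ (x , y , z) →
        ⟦⟧-mono {(E ∩₃ W) x y z} {W x y z} (∧-elimʳ {E x y z})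
      bound : ∣ h - q * w ∣ ≤ M * ρ * k
      bound = dichotomy {n} {h} {w} {k} {q = q} {M} {ρ} 0<n 0≤q q≤M 1≤M 0≤ρ 0≤h 0≤w 0≤k h≤w
        #H #W #K (regular Q (family⊆ P U V l))

  -- On the right every link carries its own factor `YZ P`. For a nonempty tuple these amount to the
  -- single factor on the left; for the empty tuple the right-hand side would be everything.
  jointLink≡jointLinkOn : ∀ {a b c t} (P : TripartiteGraph a b c) (E : Triples a b c) → 1 ℕ.≤ t →
    ∀ (xs : Vec (Fin a) t) y z →
    YZ P y z ∧ jointLink (sections E) xs (y , z) ≡ jointLinkOn E xs P y z
  jointLink≡jointLinkOn P E _ xs y z with YZ P y z
  ... | true = conv xs
    where
    conv : ∀ {t} (xs : Vec (Fin _) t) → jointLink (sections E) xs (y , z) ≡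
           Vector.foldr _∧_ true (λ i → E (lookup xs i) y z ∧ true)
    conv []       = refl
    conv (x ∷ xs) = cong₂ _∧_ (sym (∧-identityʳ (E x y z))) (conv xs)
  jointLink≡jointLinkOn P E _ (x ∷ xs) y z | false = sym (cong (_∧ Vector.foldr _∧_ true (λ i → E (lookup xs i) y z ∧ false)) (∧-zeroʳ (E x y z)))

  -- Markov's inequality and the list of exceptional tuples

  length-concat-tabulate : ∀ {A : Set} {n} (f : Fin n → List A) →
    ι (length (concat (List.tabulate f))) ≡ sum (λ i → ι (length (f i)))
  length-concat-tabulate {n = zero}  f = refl
  length-concat-tabulate {n = suc n} f = trans
    (cong ι (length-++ (f zero)))
    (trans (ι-+ (length (f zero)) _)
      (cong (ι (length (f zero)) +_) (length-concat-tabulate (λ i → f (suc i)))))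

  select : ∀ {n} t → (Vec (Fin n) t → Bool) → List (Vec (Fin n) t)
  select zero    B = if B [] then [] ∷ [] else []
  select (suc t) B = concat (List.tabulate λ x → List.map (x ∷_) (select t λ xs → B (x ∷ xs)))

  ∈-select : ∀ {n} t (B : Vec (Fin n) t → Bool) xs → B xs ≡ true → xs ∈ select t B
  ∈-select zero    B []       Bxs rewrite Bxs = here refl
  ∈-select (suc t) B (x ∷ xs) Bxs = ∈-concat⁺′
    (∈-map⁺ (x ∷_) (∈-select t (λ xs → B (x ∷ xs)) xs Bxs))
    (∈-tabulate⁺ x)

  length-select : ∀ {n} t (B : Vec (Fin (suc n)) t → Bool) →
    ι (length (select t B)) ≡ ι (suc n ℕ.^ t) * E (power (uniform n) t) (λ xs → ⟦ B xs ⟧)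
  length-select zero B with B []
  ... | true  = refl
  ... | false = refl
  length-select {n} (suc t) B = begin
    ι (length (select (suc t) B))
      ≡⟨ length-concat-tabulate (λ x → List.map (x ∷_) (select t λ xs → B (x ∷ xs))) ⟩
    sum (λ x → ι (length (List.map (x ∷_) (select t λ xs → B (x ∷ xs)))))
      ≡⟨ sum-cong-≗ (λ x → trans (cong ι (length-map (x ∷_) (select t λ xs → B (x ∷ xs))))
           (length-select t (λ xs → B (x ∷ xs)))) ⟩
    sum (λ x → ι (suc n ℕ.^ t) * E (power (uniform n) t) λ xs → ⟦ B (x ∷ xs) ⟧)
      ≡⟨ uniform-sum n (λ x → ι (suc n ℕ.^ t) * E (power (uniform n) t) λ xs → ⟦ B (x ∷ xs) ⟧) ⟨
    ι (suc n) * E (uniform n) (λ x → ι (suc n ℕ.^ t) * E (power (uniform n) t) λ xs → ⟦ B (x ∷ xs) ⟧)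
      ≡⟨ cong (ι (suc n) *_) (E-* (uniform n) (ι (suc n ℕ.^ t)) _) ⟩
    ι (suc n) * (ι (suc n ℕ.^ t) * E (power (uniform n) (suc t)) λ xs → ⟦ B xs ⟧)
      ≡⟨ *-assoc (ι (suc n)) (ι (suc n ℕ.^ t)) _ ⟨
    ι (suc n) * ι (suc n ℕ.^ t) * E (power (uniform n) (suc t)) (λ xs → ⟦ B xs ⟧)
      ≡⟨ cong (_* E (power (uniform n) (suc t)) (λ xs → ⟦ B xs ⟧)) (ι-* (suc n) (suc n ℕ.^ t)) ⟨
    ι (suc n ℕ.^ suc t) * E (power (uniform n) (suc t)) (λ xs → ⟦ B xs ⟧) ∎
    where open ≡-Reasoning

  markov : ∀ {I : Set} (m : Mean I) (f : I → ℚ) γ → (∀ i → 0ℚ ≤ f i) →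
           γ * E m (λ i → ⟦ not (leq (f i) γ) ⟧) ≤ E m f
  markov m f γ 0≤f = ≤-trans (≤-reflexive (sym (E-* m γ _))) (E-mono m pointwise)
    where
    pointwise : ∀ i → γ * ⟦ not (leq (f i) γ) ⟧ ≤ f i
    pointwise i with leq (f i) γ | leq-reflects (f i) γ
    ... | true  | _        = ≤-trans (≤-reflexive (*-zeroʳ γ)) (0≤f i)
    ... | false | ofⁿ f≰γ = ≤-trans (≤-reflexive (*-identityʳ γ)) (<⇒≤ (≰⇒> f≰γ))

  few-exceptions : ∀ {n t} (f : Vec (Fin (suc n)) t → ℚ) {γ ε} → 0ℚ < γ → (∀ xs → 0ℚ ≤ f xs) →
    E (power (uniform n) t) f ≤ ε * γ →
    ∃[ exceptions ] (ι (length {A = Vec (Fin (suc n)) t} exceptions) ≤ ε * ι (suc n ℕ.^ t)) ×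
      (∀ xs → xs ∉ exceptions → f xs ≤ γ)
  few-exceptions {n} {t} f {γ} {ε} 0<γ 0≤f Ef≤ = select t bad , few , good
    where
    bad : Vec (Fin (suc n)) t → Bool
    bad xs = not (leq (f xs) γ)
    few : ι (length (select t bad)) ≤ ε * ι (suc n ℕ.^ t)
    few = ≤-trans (≤-reflexive (trans (length-select t bad) (*-comm (ι (suc n ℕ.^ t)) _)))
      (*-monoʳ (0≤ι (suc n ℕ.^ t)) (*-cancelˡ 0<γ
        (≤-trans (markov (power (uniform n) t) f γ 0≤f) (≤-trans Ef≤ (≤-reflexive (*-comm ε γ))))))
    good : ∀ xs → xs ∉ select t bad → f xs ≤ γ
    good xs xs∉ with leq (f xs) γ in eq | leq-reflects (f xs) γ
    ... | true  | ofʸ f≤γ = f≤γ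
    ... | false | _       = ⊥-elim (xs∉ (∈-select t bad xs (cong not eq)))

  ^-odd : ∀ d t → d * (d * d) ^ t ≡ d ^ (2 ℕ.* t ℕ.+ 1)
  ^-odd d t = begin
    d * (d * d) ^ t          ≡⟨ *-comm d ((d * d) ^ t) ⟩
    (d * d) ^ t * d          ≡⟨ cong₂ (λ e f → e ^ t * f) (cong (d *_) (*-identityʳ d)) (*-identityʳ d) ⟨
    (d ^ 2) ^ t * d ^ 1      ≡⟨ cong (_* d ^ 1) (^-assocʳ d 2 t) ⟩
    d ^ (2 ℕ.* t) * d ^ 1    ≡⟨ ^-homo-* d (2 ℕ.* t) 1 ⟨
    d ^ (2 ℕ.* t ℕ.+ 1)      ∎
    where open ≡-Reasoning

  -- The estimate for rational densities

  RationalRegular : ∀ {a b} → ℚ → ℚ → Pairs a b → Set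
  RationalRegular {a} {b} δ d G = ∀ A′ B′ →
    ∣ ι (edgesBetween G A′ B′) - d * ι (Subset.∣ A′ ∣ ℕ.* Subset.∣ B′ ∣) ∣ ≤ δ * ι (a ℕ.* b)

  -- The strict lower bound on the union forces P to have a triangle, from which the positivity
  -- condition of `HypergraphRegular` follows.
  RationalHypergraphRegular : ∀ {a b c} → ℚ → ℚ → ℕ → Triples a b c → TripartiteGraph a b c → Set
  RationalHypergraphRegular {a} {b} {c} ρ q r E P =
    ∀ (Q : Fin r → TripartiteGraph a b c) → (∀ j → Q j ⊆ᴳ P) →
    ρ * ι (#₃ (K₃ P)) < ι (#₃ (⋃₃ λ j → K₃ (Q j))) →
    ∣ ι (#₃ (⋃₃ λ j → E ∩₃ K₃ (Q j))) - q * ι (#₃ (⋃₃ λ j → K₃ (Q j))) ∣ ≤ ρ * ι (#₃ (K₃ P))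

  scale : ∀ {N e q τ γ X} → 0ℚ ≤ N → X ≡ N * e → ∣ e - q * τ ∣ ≤ γ → ∣ X - q * τ * N ∣ ≤ γ * N
  scale {N} {e} {q} {τ} {γ} 0≤N refl h = ≤-trans
    (≤-reflexive (trans (cong ∣_∣ (factor N e q τ)) (∣*∣ (e - q * τ) 0≤N)))
    (≤-trans (*-monoˡ 0≤N h) (≤-reflexive (*-comm N γ)))
    where
    factor : ∀ N e q τ → N * e - q * τ * N ≡ N * (e - q * τ)
    factor = solve-∀ ring

  module _
    {d q M θ δ μ β ℓ ε : ℚ} {r t : ℕ}
    (0<ℓ : 0ℚ < ℓ) (ℓ≤1 : ℓ ≤ 1ℚ) (ℓ≤d : ℓ ≤ d)
    (0<q : 0ℚ < q) (q≤M : q ≤ M) (1≤M : 1ℚ ≤ M) (0≤θ : 0ℚ ≤ θ) (θ≤1 : θ ≤ 1ℚ)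
    (0≤δ : 0ℚ ≤ δ) (0≤μ : 0ℚ ≤ μ) (μ≤1 : μ ≤ 1ℚ) (1≤t : 1 ℕ.≤ t) (0<ε : 0ℚ < ε)
    (δ≤ : 7ℚ * (M * δ) ≤ μ * (ℓ * ((ℓ * ℓ) ^ t * (ℓ * ℓ) ^ t)))
    (β≥ : 2ℚ ^ (3 ℕ.+ t) * (M * θ) + 2ℚ * μ ≤ β)
    (β≤ : β * (1ℚ + M) ^ t ≤ ε * (½ * ε * q ^ t))
    (R : ℕ → ℚ) (0<R : ∀ s → 0ℚ < R s) (R*κ₀≡θ : ∀ s → R s * (2ℚ * (d * d)) ^ s ≡ θ)
    (R≤r : ∀ s → s ℕ.< t → R s ≤ ι r)
    {a b c : ℕ} {P : TripartiteGraph (suc a) (suc b) (suc c)} {E : Triples (suc a) (suc b) (suc c)}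
    (XY-regular : RationalRegular δ d (XY P)) (YZ-regular : RationalRegular δ d (YZ P))
    (XZ-regular : RationalRegular δ d (XZ P)) (on-triangles : OnTriangles E P)
    (E-regular : RationalHypergraphRegular (θ * θ) q r E P)
    where

    private
      0<d : 0ℚ < d
      0<d = <-≤-trans 0<ℓ ℓ≤d

      -- `γ` is half of the permitted deviation; the other half is kept for the return to real
      -- densities.
      τ γ : ℚ
      τ = d * (d * d) ^ t
      γ = ½ * ε * (q ^ t * τ)

      0<τ : 0ℚ < τ
      0<τ = 0<* 0<d (0<^ t (0<* 0<d 0<d))

      0<γ : 0ℚ < γ
      0<γ = 0<* (0<* (positive⁻¹ ½) 0<ε) (0<* (0<^ t 0<q) 0<τ)

      size : Vec (Fin (suc a)) t → ℚ
      size xs = Mean.E (uniform b ⊗ uniform c) λ p →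
        ⟦ YZ P (proj₁ p) (proj₂ p) ⟧ * ⟦ jointLink (sections E) xs p ⟧

      mean-deviation : Mean.E (power (uniform a) t) (λ xs → ∣ size xs - q ^ t * τ ∣) ≤ ε * γ
      mean-deviation = ≤-trans
        (jointLink-error (uniform a) (uniform b) (uniform c) {XY P} {XZ P} {YZ P} {sections E}
          (λ x p → on-triangles x (proj₁ p) (proj₂ p))
          {d} {q} {M} {θ} {δ} {μ} {β} {ℓ} {r} {t}
          0<ℓ ℓ≤1 ℓ≤d 0<d (<⇒≤ 0<q) q≤M 1≤M 0≤θ θ≤1 0≤δ 0≤μ μ≤1 1≤t δ≤ β≥
          (uniform-regular {d = d} XY-regular) (uniform-regular {d = d} XZ-regular) (uniform-regular {d = d} YZ-regular)
          R 0<R R*κ₀≡θ R≤r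
          (uniform-hypergraph-regular {P = P} {E} (<⇒≤ 0<q) q≤M 1≤M (0≤* 0≤θ 0≤θ) E-regular))
        (≤-trans (*-monoʳ (<⇒≤ 0<τ) β≤) (≤-reflexive (regroup ε (q ^ t) τ)))
        where
        regroup : ∀ ε a τ → ε * (½ * ε * a) * τ ≡ ε * (½ * ε * (a * τ))
        regroup = solve-∀ ring

      #joint : ∀ xs → ι (#₂ (jointLinkOn E xs P)) ≡ ι (suc b ℕ.* suc c) * size xs
      #joint xs = trans (ι-#₂ (jointLinkOn E xs P)) (cong (ι (suc b ℕ.* suc c) *_)
        (E-cong (uniform b) λ y → E-cong (uniform c) λ z → trans
          (cong ⟦_⟧ (sym (jointLink≡jointLinkOn P E 1≤t xs y z)))
          (⟦∧⟧ (YZ P y z) (jointLink (sections E) xs (y , z)))))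

    rational-estimate : ∃[ exceptions ]
      (ι (length {A = Vec (Fin (suc a)) t} exceptions) ≤ ε * ι (suc a ℕ.^ t)) ×
      (∀ xs → xs ∉ exceptions →
        ∣ ι (#₂ (jointLinkOn E xs P)) - q ^ t * d ^ (2 ℕ.* t ℕ.+ 1) * ι (suc b ℕ.* suc c) ∣
          ≤ ½ * ε * (q ^ t * d ^ (2 ℕ.* t ℕ.+ 1)) * ι (suc b ℕ.* suc c))
    rational-estimate =
      let exceptions , few , good = few-exceptions {t = t} (λ xs → ∣ size xs - q ^ t * τ ∣) {γ} {ε}
            0<γ (λ xs → 0≤∣p∣ (size xs - q ^ t * τ)) mean-deviation
      in exceptions , few , λ xs xs∉ → subst
        (λ τ′ → ∣ ι (#₂ (jointLinkOn E xs P)) - q ^ t * τ′ * ι (suc b ℕ.* suc c) ∣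
          ≤ ½ * ε * (q ^ t * τ′) * ι (suc b ℕ.* suc c))
        (^-odd d t)
        (scale {ι (suc b ℕ.* suc c)} {size xs} {q ^ t} {τ} {γ} (0≤ι (suc b ℕ.* suc c)) (#joint xs) (good xs xs∉))

  -- Choice of constants and change of densities

  -- The minimum of 1 and y / (1 + c), where adding 1 avoids a zero denominator.
  small : ∀ {c y} → 0ℚ ≤ c → 0ℚ < y → ∃[ x ] (0ℚ < x) × (x ≤ 1ℚ) × (c * x ≤ y)
  small {c} {y} 0≤c 0<y = x , 0<x , p⊓q≤q (y * w) 1ℚ , (begin
    c * x               ≤⟨ *-monoˡ 0≤c (p⊓q≤p (y * w) 1ℚ) ⟩
    c * (y * w)         ≤⟨ ≤-by _ (0≤* (<⇒≤ 0<y) (<⇒≤ 0<w)) (add-one c y w) ⟩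
    y * (w * (1ℚ + c))  ≡⟨ cong (y *_) w-inverse ⟩
    y * 1ℚ              ≡⟨ *-identityʳ y ⟩
    y                   ∎)
    where
    open ≤-Reasoning
    inverse : ∃[ w ] (0ℚ < w) × (w * (1ℚ + c) ≡ 1ℚ)
    inverse = 1/-pos (+-mono-<-≤ (positive⁻¹ 1ℚ) 0≤c)
    w : ℚ
    w = proj₁ inverse
    0<w : 0ℚ < w
    0<w = proj₁ (proj₂ inverse)
    w-inverse : w * (1ℚ + c) ≡ 1ℚ
    w-inverse = proj₂ (proj₂ inverse)
    x : ℚ
    x = y * w ⊓ 1ℚ
    0<x : 0ℚ < x
    0<x with ⊓-sel (y * w) 1ℚ
    ... | inj₁ eq = subst (0ℚ <_) (sym eq) (0<* 0<y 0<w)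
    ... | inj₂ eq = subst (0ℚ <_) (sym eq) (positive⁻¹ 1ℚ)
    add-one : ∀ c y w → y * (w * (1ℚ + c)) ≡ c * (y * w) + y * w
    add-one = solve-∀ ring

  common-bound : ∀ (F : ℕ → ℚ) t → ∃[ r ] (1 ℕ.≤ r) × (∀ s → s ℕ.< t → F s ≤ ι r)
  common-bound F zero    = 1 , ℕ.≤-refl , λ _ ()
  common-bound F (suc t) with common-bound F t | archimedean (F t)
  ... | r , 1≤r , F≤r | n , Ft≤n = r ℕ.+ n , ℕ.≤-trans 1≤r (ℕ.m≤m+n r n) , bound
    where
    bound : ∀ s → s ℕ.< suc t → F s ≤ ι (r ℕ.+ n)
    bound s (ℕ.s≤s s≤t) with ℕ.m≤n⇒m<n∨m≡n s≤t
    ... | inj₁ s<t  = ≤-trans (F≤r s s<t) (ι-mono (ℕ.m≤m+n r n))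
    ... | inj₂ refl = ≤-trans Ft≤n (ι-mono (ℕ.m≤n+m n r))

  quotients : ∀ {θ d} → 0ℚ < θ → 0ℚ < d →
    ∃[ R ] (∀ s → 0ℚ < R s) × (∀ s → R s * (2ℚ * (d * d)) ^ s ≡ θ)
  quotients {θ} {d} 0<θ 0<d =
    (λ s → θ * proj₁ (inverse s)) ,
    (λ s → 0<* 0<θ (proj₁ (proj₂ (inverse s)))) ,
    (λ s → trans (*-assoc θ _ _) (trans (cong (θ *_) (proj₂ (proj₂ (inverse s)))) (*-identityʳ θ)))
    where
    inverse : ∀ s → ∃[ w ] (0ℚ < w) × (w * (2ℚ * (d * d)) ^ s ≡ 1ℚ)
    inverse s = 1/-pos (0<^ s (0<* (positive⁻¹ 2ℚ) (0<* 0<d 0<d)))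

  -- The additive η is the tolerance in the order of the reals, absorbed because N is at least 1.
  -- The change of density costs another `η * N`.
  replace-density : ∀ {X d d′ m N δ η} → 0ℚ ≤ m → m ≤ N → 1ℚ ≤ N → 0ℚ ≤ η →
    ∣ X - d′ * m ∣ ≤ δ * N + η → ∣ d′ - d ∣ ≤ η → ∣ X - d * m ∣ ≤ (δ + η + η) * N
  replace-density {X} {d} {d′} {m} {N} {δ} {η} 0≤m m≤N 1≤N 0≤η h d≈d′ = begin
    ∣ X - d * m ∣                        ≡⟨ cong ∣_∣ (telescope X d d′ m) ⟩
    ∣ X - d′ * m + m * (d′ - d) ∣        ≤⟨ ∣p+q∣≤∣p∣+∣q∣ (X - d′ * m) (m * (d′ - d)) ⟩
    ∣ X - d′ * m ∣ + ∣ m * (d′ - d) ∣    ≡⟨ cong (∣ X - d′ * m ∣ +_) (∣*∣ (d′ - d) 0≤m) ⟩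
    ∣ X - d′ * m ∣ + m * ∣ d′ - d ∣      ≤⟨ +-mono-≤ h (*-mono (0≤∣p∣ (d′ - d)) (≤-trans 0≤m m≤N) m≤N d≈d′) ⟩
    δ * N + η + N * η                    ≤⟨ ≤-by _ (0≤* 0≤η (p≤q⇒0≤q-p 1≤N)) (collect δ N η) ⟩
    (δ + η + η) * N                      ∎
    where
    open ≤-Reasoning
    telescope : ∀ X d d′ m → X - d * m ≡ X - d′ * m + m * (d′ - d)
    telescope = solve-∀ ring
    collect : ∀ δ N η → (δ + η + η) * N ≡ δ * N + η + N * η + η * (N - 1ℚ)
    collect = solve-∀ ring

  -- As D is at most D′ + ξ and ε at most 1, the deviation divided by m is at most ½ ε D′ + (3/2) ξ.
  -- The last summand is at most ½ ε L, hence at most ½ ε D′.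
  replace-target : ∀ {X D D′ L m ε ε′ ξ} → 0ℚ ≤ m → 0ℚ ≤ ε → ε ≤ 1ℚ → 0ℚ ≤ ξ → 0ℚ ≤ L →
    3ℚ * ξ ≤ ε * L → L ≤ D′ → ε ≤ ε′ → ∣ D′ - D ∣ ≤ ξ →
    ∣ X - D * m ∣ ≤ ½ * ε * D * m → ∣ X - D′ * m ∣ ≤ ε′ * (D′ * m)
  replace-target {X} {D} {D′} {L} {m} {ε} {ε′} {ξ} 0≤m 0≤ε ε≤1 0≤ξ 0≤L 3ξ≤ L≤D′ ε≤ε′ D≈D′ h = begin
    ∣ X - D′ * m ∣
      ≡⟨ cong ∣_∣ (telescope X D D′ m) ⟩
    ∣ X - D * m + - (m * (D′ - D)) ∣
      ≤⟨ ∣p+q∣≤∣p∣+∣q∣ (X - D * m) (- (m * (D′ - D))) ⟩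
    ∣ X - D * m ∣ + ∣ - (m * (D′ - D)) ∣
      ≡⟨ cong (∣ X - D * m ∣ +_) (trans (∣-p∣≡∣p∣ (m * (D′ - D))) (∣*∣ (D′ - D) 0≤m)) ⟩
    ∣ X - D * m ∣ + m * ∣ D′ - D ∣
      ≤⟨ +-mono-≤ h (*-monoˡ 0≤m D≈D′) ⟩
    ½ * ε * D * m + m * ξ
      ≤⟨ ≤-by _ (0≤* 0≤½m (0≤+ (0≤* 0≤ε D≤D′+ξ)
           (0≤+ (0≤* (p≤q⇒0≤q-p ε≤1) 0≤ξ) (0≤+ (p≤q⇒0≤q-p 3ξ≤) (0≤* 0≤ε (p≤q⇒0≤q-p L≤D′))))))
           (collect ε D D′ m ξ L) ⟩
    ε * (D′ * m)
      ≤⟨ *-monoʳ (0≤* (≤-trans 0≤L L≤D′) 0≤m) ε≤ε′ ⟩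
    ε′ * (D′ * m) ∎
    where
    open ≤-Reasoning
    0≤½m : 0ℚ ≤ ½ * m
    0≤½m = 0≤* (<⇒≤ (positive⁻¹ ½)) 0≤m
    D≤D′+ξ : 0ℚ ≤ ξ - - (D′ - D)
    D≤D′+ξ = p≤q⇒0≤q-p (≤-trans (-p≤∣p∣ (D′ - D)) D≈D′)
    telescope : ∀ X D D′ m → X - D′ * m ≡ X - D * m + - (m * (D′ - D))
    telescope = solve-∀ ring
    collect : ∀ ε D D′ m ξ L → ε * (D′ * m) ≡ ½ * ε * D * m + m * ξ +
      ½ * m * (ε * (ξ - - (D′ - D)) + ((1ℚ - ε) * ξ + (ε * L - 3ℚ * ξ + ε * (D′ - L))))
    collect = solve-∀ ring

open import Defs
open import Algebra.Properties.CommutativeSemiring.Exp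
  (CommutativeRing.commutativeSemiring ℚ.+-*-commutativeRing) using () renaming (_^_ to _ℚ^_)

-- Approximation of the reals

Eventually : (ℕ → Set) → Set
Eventually F = ∃[ N ] (∀ n → N ℕ.≤ n → F n)

infixr 3 _&_

_&_ : ∀ {F G} → Eventually F → Eventually G → Eventually (λ n → F n × G n)
(M , f) & (N , g) = M ℕ.⊔ N , λ n n≥ → f n (ℕ.m⊔n≤o⇒m≤o M N n≥) , g n (ℕ.m⊔n≤o⇒n≤o M N n≥)

eventually-≥ : ∀ {x} → 0ℝ < x →
  ∃[ l ] (0ℚ ℚ.< l) × (l ℚ.≤ 1ℚ) × Eventually (λ n → l ℚ.≤ seq x n)
eventually-≥ {x} (l , 0<l , N , l≤) = l ℚ.⊓ 1ℚ , 0<l⊓1 , ℚ.p⊓q≤q l 1ℚ , N , λ n n≥ →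
  ℚ.≤-trans (ℚ.p⊓q≤p l 1ℚ) (ℚ.≤-trans (ℚ.≤-reflexive (sym (ℚ.+-identityˡ l))) (l≤ n n≥))
  where
  0<l⊓1 : 0ℚ ℚ.< l ℚ.⊓ 1ℚ
  0<l⊓1 with ℚ.⊓-sel l 1ℚ
  ... | inj₁ eq = subst (0ℚ ℚ.<_) (sym eq) 0<l
  ... | inj₂ eq = subst (0ℚ ℚ.<_) (sym eq) (ℚ.positive⁻¹ 1ℚ)

eventually-≤ : ∀ x → ∃[ M ] (1ℚ ℚ.≤ M) × Eventually (λ n → seq x n ℚ.≤ M)
eventually-≤ x with cauchy x 1ℚ (ℚ.positive⁻¹ 1ℚ)
... | N , close = 1ℚ ℚ.+ ℚ.∣ seq x N ∣ , ≤-by ℚ.∣ seq x N ∣ (ℚ.0≤∣p∣ (seq x N)) refl , N , λ n n≥ → begin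
  seq x n                                ≡⟨ ℚ.+-identityʳ (seq x n) ⟨
  seq x n ℚ.+ 0ℚ                         ≡⟨ cong (seq x n ℚ.+_) (ℚ.+-inverseˡ (seq x N)) ⟨
  seq x n ℚ.+ (ℚ.- seq x N ℚ.+ seq x N)  ≡⟨ ℚ.+-assoc (seq x n) (ℚ.- seq x N) (seq x N) ⟨
  seq x n ℚ.- seq x N ℚ.+ seq x N        ≤⟨ ℚ.+-mono-≤ (ℚ.≤-trans (p≤∣p∣ (seq x n ℚ.- seq x N))
                                              (close n N n≥ ℕ.≤-refl)) (p≤∣p∣ (seq x N)) ⟩
  1ℚ ℚ.+ ℚ.∣ seq x N ∣                   ∎
  where open ℚ.≤-Reasoning

eventually-steady : ∀ x {η} → 0ℚ ℚ.< η →
  Eventually (λ n → ∀ k → n ℕ.≤ k → ℚ.∣ seq x k ℚ.- seq x n ∣ ℚ.≤ η)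
eventually-steady x {η} 0<η with cauchy x η 0<η
... | N , close = N , λ n n≥ k k≥n → close k n (ℕ.≤-trans n≥ k≥n) n≥

seq-^ : ∀ x t n → seq (x ^ t) n ≡ seq x n ℚ^ t
seq-^ x zero    n = refl
seq-^ x (suc t) n = cong (seq x n ℚ.*_) (seq-^ x t n)

-- Turns an estimate with a real density into one with a rational approximation of it.
freeze : ∀ (d : ℝ) {η ρ X m N} n → 0ℚ ℚ.< η → 3ℚ ℚ.* η ℚ.≤ ρ → m ℕ.≤ N → 1 ℕ.≤ N →
  (∀ k → n ℕ.≤ k → ℚ.∣ seq d k ℚ.- seq d n ∣ ℚ.≤ η) →
  ∣ fromℕ X - d * fromℕ m ∣ ≤ fromℚ η * fromℕ N →
  ℚ.∣ ι X ℚ.- seq d n ℚ.* ι m ∣ ℚ.≤ ρ ℚ.* ι N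
freeze d {η} {ρ} {X} {m} {N} n 0<η 3η≤ρ m≤N 1≤N steady h with h η 0<η
... | K , bound = ℚ.≤-trans
  (replace-density {ι X} {seq d n} {seq d (n ℕ.⊔ K)} {ι m} {ι N} {η} {η}
    (0≤ι m) (ι-mono m≤N) (ι-mono {1} 1≤N) (ℚ.<⇒≤ 0<η)
    (bound (n ℕ.⊔ K) (ℕ.m≤n⊔m n K)) (steady (n ℕ.⊔ K) (ℕ.m≤m⊔n n K)))
  (*-monoʳ (0≤ι N) (ℚ.≤-trans (ℚ.≤-reflexive (thrice η)) 3η≤ρ))
  where
  thrice : ∀ η → η ℚ.+ η ℚ.+ η ≡ 3ℚ ℚ.* η
  thrice = solve-∀ ring

fromℚ-≤ : ∀ {p q} → p ℚ.≤ q → fromℚ p ≤ fromℚ q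
fromℚ-≤ {p} {q} p≤q ε 0<ε = 0 , λ _ _ → ℚ.≤-trans p≤q (≤-by ε (ℚ.<⇒≤ 0<ε) refl)

fromℚ-< : ∀ {p} → 0ℚ ℚ.< p → 0ℝ < fromℚ p
fromℚ-< {p} 0<p = p , 0<p , 0 , λ _ _ → ℚ.≤-reflexive (ℚ.+-identityˡ p)


∑-mono : ∀ {n} {f g : Fin n → ℕ} → (∀ i → f i ℕ.≤ g i) → ∑ f ℕ.≤ ∑ g
∑-mono {zero}  f≤g = ℕ.z≤n
∑-mono {suc n} f≤g = ℕ.+-mono-≤ (f≤g zero) (∑-mono λ i → f≤g (suc i))

#₃-mono : ∀ {a b c} {S S′ : Triples a b c} → S ⊆₃ S′ → #₃ S ℕ.≤ #₃ S′
#₃-mono S⊆S′ = ∑-mono λ x → ∑-mono λ y → ∑-mono λ z → indicator (S⊆S′ x y z)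
  where
  indicator : ∀ {p q} → (T p → T q) → (if p then 1 else 0) ℕ.≤ (if q then 1 else 0)
  indicator {false}        _   = ℕ.z≤n
  indicator {true} {true}  _   = ℕ.≤-refl
  indicator {true} {false} p⇒q = ⊥-elim (p⇒q _)

⋃K₃⊆ : ∀ {r a b c} {P : TripartiteGraph a b c} (Q : Fin r → TripartiteGraph a b c) →
  (∀ j → Q j ⊆ᴳ P) → (⋃₃ λ j → K₃ (Q j)) ⊆₃ K₃ P
⋃K₃⊆ {suc r} Q Q⊆P x y z = ∨-elim
  (∧-map (XY⊆ x y) (∧-map (YZ⊆ y z) (XZ⊆ x z)))
  (⋃K₃⊆ (λ j → Q (suc j)) (λ j → Q⊆P (suc j)) x y z)
  where
  open _⊆ᴳ_ (Q⊆P zero)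
  ∧-map : ∀ {a a′ b b′} → (T a → T a′) → (T b → T b′) → T (a ∧ b) → T (a′ ∧ b′)
  ∧-map {true} {true}  f g = g
  ∧-map {true} {false} f g = λ _ → ⊥-elim (f _)

nonempty-of-< : ∀ {k w ρ} → w ℕ.≤ k → ρ ℚ.* ι k ℚ.< ι w → 1 ℕ.≤ k
nonempty-of-< {suc k} _     _ = ℕ.s≤s ℕ.z≤n
nonempty-of-< {zero} {ρ = ρ} ℕ.z≤n h = ⊥-elim (ℚ.<-irrefl (ℚ.*-zeroʳ ρ) h)

-- β is the error of one induction step relative to `τ`. After t steps it has grown by
-- `(1ℚ + M) ^ t`, and Markov's inequality requires the result to be at most ε times the deviation
-- `γ`. The numbers ℓ and M stand for bounds on d₃, so nothing here depends on d₂.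
record Constants (t : ℕ) (ε ℓ M : ℚ) : Set where
  field
    {β μ θ} : ℚ
    0<μ : 0ℚ ℚ.< μ
    μ≤1 : μ ℚ.≤ 1ℚ
    0<θ : 0ℚ ℚ.< θ
    θ≤1 : θ ℚ.≤ 1ℚ
    β≥  : 2ℚ ℚ^ (3 ℕ.+ t) ℚ.* (M ℚ.* θ) ℚ.+ 2ℚ ℚ.* μ ℚ.≤ β
    β≤  : β ℚ.* (1ℚ ℚ.+ M) ℚ^ t ℚ.≤ ε ℚ.* (½ ℚ.* ε ℚ.* ℓ ℚ^ t)

constants : ∀ t {ε ℓ M} → 0ℚ ℚ.< ε → 0ℚ ℚ.< ℓ → 1ℚ ℚ.≤ M → Constants t ε ℓ M
constants t {ε} {ℓ} {M} 0<ε 0<ℓ 1≤M =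
  let 0<½ = ℚ.positive⁻¹ ½
      0≤M = ℚ.≤-trans 0≤1 1≤M
      0≤[1+M]^t = 0≤^ t (ℚ.≤-trans 0≤1 (≤-by M 0≤M refl))
      β , 0<β , _   , β≤  = small 0≤[1+M]^t (0<* 0<ε (0<* (0<* 0<½ 0<ε) (0<^ t 0<ℓ)))
      μ , 0<μ , μ≤1 , 2μ≤ = small 0≤2 (0<* 0<½ 0<β)
      θ , 0<θ , θ≤1 , θ≤  = small (0≤* (0≤^ (3 ℕ.+ t) 0≤2) 0≤M) (0<* 0<½ 0<β)
  in record
    { 0<μ = 0<μ ; μ≤1 = μ≤1 ; 0<θ = 0<θ ; θ≤1 = θ≤1
    ; β≥ = ℚ.≤-trans (ℚ.+-mono-≤
        (ℚ.≤-trans (ℚ.≤-reflexive (sym (ℚ.*-assoc (2ℚ ℚ^ (3 ℕ.+ t)) M θ))) θ≤) 2μ≤)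
        (ℚ.≤-reflexive (halves β))
    ; β≤ = ℚ.≤-trans (ℚ.≤-reflexive (ℚ.*-comm β ((1ℚ ℚ.+ M) ℚ^ t))) β≤
    }
  where
  halves : ∀ β → ½ ℚ.* β ℚ.+ ½ ℚ.* β ≡ β
  halves = solve-∀ ring

x≤3x : ∀ {x} → 0ℚ ℚ.≤ x → x ℚ.≤ 3ℚ ℚ.* x
x≤3x {x} 0≤x = ≤-by _ (0≤* 0≤2 0≤x) (split x)
  where
  split : ∀ x → 3ℚ ℚ.* x ≡ x ℚ.+ 2ℚ ℚ.* x
  split = solve-∀ ring

-- Passage from rational to real densities

module Approximation (t : ℕ) (2≤t : 2 ℕ.≤ t) (ε d₃ : ℝ) {e ℓ₃ M : ℚ}
  (0<e : 0ℚ ℚ.< e) (e≤1 : e ℚ.≤ 1ℚ) (ε≥ : Eventually (λ n → e ℚ.≤ seq ε n))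
  (0<ℓ₃ : 0ℚ ℚ.< ℓ₃) (d₃≥ : Eventually (λ n → ℓ₃ ℚ.≤ seq d₃ n))
  (1≤M : 1ℚ ℚ.≤ M) (d₃≤ : Eventually (λ n → seq d₃ n ℚ.≤ M))
  (K : Constants t e ℓ₃ M)
  {η₃ : ℚ} (0<η₃ : 0ℚ ℚ.< η₃) (3η₃≤ : 3ℚ ℚ.* η₃ ℚ.≤ Constants.θ K ℚ.* Constants.θ K)
  (d₂ : ℝ) {ℓ₂ : ℚ} (0<ℓ₂ : 0ℚ ℚ.< ℓ₂) (ℓ₂≤1 : ℓ₂ ℚ.≤ 1ℚ)
  (d₂≥ : Eventually (λ n → ℓ₂ ℚ.≤ seq d₂ n))
  {δ η₂ ξ : ℚ} (0<δ : 0ℚ ℚ.< δ)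
  (δ≤ : 7ℚ ℚ.* M ℚ.* δ ℚ.≤ Constants.μ K ℚ.* (ℓ₂ ℚ.* ((ℓ₂ ℚ.* ℓ₂) ℚ^ t ℚ.* (ℓ₂ ℚ.* ℓ₂) ℚ^ t)))
  (0<η₂ : 0ℚ ℚ.< η₂) (3η₂≤ : 3ℚ ℚ.* η₂ ℚ.≤ δ)
  (0<ξ : 0ℚ ℚ.< ξ) (3ξ≤ : 3ℚ ℚ.* ξ ℚ.≤ e ℚ.* (ℓ₃ ℚ^ t ℚ.* ℓ₂ ℚ^ (2 ℕ.* t ℕ.+ 1)))
  where

  open Constants K

  target : ℝ
  target = d₃ ^ t * d₂ ^ (2 ℕ.* t ℕ.+ 1)

  seq-target : ∀ n → seq target n ≡ seq d₃ n ℚ^ t ℚ.* seq d₂ n ℚ^ (2 ℕ.* t ℕ.+ 1)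
  seq-target n = cong₂ ℚ._*_ (seq-^ d₃ t n) (seq-^ d₂ (2 ℕ.* t ℕ.+ 1) n)

  L : ℚ
  L = ℓ₃ ℚ^ t ℚ.* ℓ₂ ℚ^ (2 ℕ.* t ℕ.+ 1)

  0≤L : 0ℚ ℚ.≤ L
  0≤L = 0≤* (0≤^ t (ℚ.<⇒≤ 0<ℓ₃)) (0≤^ (2 ℕ.* t ℕ.+ 1) (ℚ.<⇒≤ 0<ℓ₂))

  settled : Eventually λ n →
    (ℓ₃ ℚ.≤ seq d₃ n) × (seq d₃ n ℚ.≤ M) × (ℓ₂ ℚ.≤ seq d₂ n) ×
    (∀ k → n ℕ.≤ k → ℚ.∣ seq d₃ k ℚ.- seq d₃ n ∣ ℚ.≤ η₃) ×
    (∀ k → n ℕ.≤ k → ℚ.∣ seq d₂ k ℚ.- seq d₂ n ∣ ℚ.≤ η₂) ×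
    (∀ k → n ℕ.≤ k → ℚ.∣ seq target k ℚ.- seq target n ∣ ℚ.≤ ξ)
  settled = d₃≥ & d₃≤ & d₂≥ &
    eventually-steady d₃ 0<η₃ & eventually-steady d₂ 0<η₂ & eventually-steady target 0<ξ

  module _ (n : ℕ) (ℓ₃≤q : ℓ₃ ℚ.≤ seq d₃ n) (q≤M : seq d₃ n ℚ.≤ M) (ℓ₂≤d : ℓ₂ ℚ.≤ seq d₂ n)
    (d₃-steady : ∀ k → n ℕ.≤ k → ℚ.∣ seq d₃ k ℚ.- seq d₃ n ∣ ℚ.≤ η₃)
    (d₂-steady : ∀ k → n ℕ.≤ k → ℚ.∣ seq d₂ k ℚ.- seq d₂ n ∣ ℚ.≤ η₂)
    (target-steady : ∀ k → n ℕ.≤ k → ℚ.∣ seq target k ℚ.- seq target n ∣ ℚ.≤ ξ)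
    (R : ℕ → ℚ) (0<R : ∀ s → 0ℚ ℚ.< R s)
    (R*κ₀≡θ : ∀ s → R s ℚ.* (2ℚ ℚ.* (seq d₂ n ℚ.* seq d₂ n)) ℚ^ s ≡ θ)
    {r : ℕ} (R≤r : ∀ s → s ℕ.< t → R s ℚ.≤ ι r)
    where

    q d : ℚ
    q = seq d₃ n
    d = seq d₂ n

    0<q : 0ℚ ℚ.< q
    0<q = ℚ.<-≤-trans 0<ℓ₃ ℓ₃≤q

    freeze-bipartite : ∀ {a b} {G : Pairs (suc a) (suc b)} →
      BipartiteRegular (fromℚ η₂) d₂ G → RationalRegular δ d G
    freeze-bipartite {a} {b} {G} regular A′ B′ = freeze d₂ {η₂} {δ}
      {edgesBetween G A′ B′} {Subset.∣ A′ ∣ ℕ.* Subset.∣ B′ ∣} {suc a ℕ.* suc b} n 0<η₂ 3η₂≤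
      (ℕ.*-mono-≤ (Subset.∣p∣≤n A′) (Subset.∣p∣≤n B′)) (ℕ.s≤s ℕ.z≤n) d₂-steady (regular A′ B′)

    freeze-hypergraph : ∀ {a b c} {E : Triples a b c} {P : TripartiteGraph a b c} →
      HypergraphRegular (fromℚ η₃) d₃ r E P → RationalHypergraphRegular (θ ℚ.* θ) q r E P
    freeze-hypergraph {E = E} {P} regular Q Q⊆P large =
      freeze d₃ {η₃} {θ ℚ.* θ} {#₃ (⋃₃ λ j → E ∩₃ K₃ (Q j))} {#₃ (⋃₃ λ j → K₃ (Q j))} {#₃ (K₃ P)}
        n 0<η₃ 3η₃≤ #W≤#K 1≤#K d₃-steady
        (regular Q Q⊆P
          (fromℚ-≤ {η₃ ℚ.* ι (#₃ (K₃ P))} {ι (#₃ (⋃₃ λ j → K₃ (Q j)))}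
            (ℚ.≤-trans {j = θ ℚ.* θ ℚ.* ι (#₃ (K₃ P))}
              (*-monoʳ {ι (#₃ (K₃ P))} {η₃} {θ ℚ.* θ} (0≤ι (#₃ (K₃ P)))
                (ℚ.≤-trans {j = 3ℚ ℚ.* η₃} (x≤3x (ℚ.<⇒≤ 0<η₃)) 3η₃≤))
              (ℚ.<⇒≤ large)))
          (fromℚ-< {η₃ ℚ.* ι (#₃ (K₃ P))} (0<* {η₃} {ι (#₃ (K₃ P))} 0<η₃ (ℚ.<-≤-trans (0<ι 0) (ι-mono 1≤#K)))))
      where
      #W≤#K : #₃ (⋃₃ λ j → K₃ (Q j)) ℕ.≤ #₃ (K₃ P)
      #W≤#K = #₃-mono (⋃K₃⊆ Q Q⊆P)
      1≤#K : 1 ℕ.≤ #₃ (K₃ P)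
      1≤#K = nonempty-of-< {#₃ (K₃ P)} {#₃ (⋃₃ λ j → K₃ (Q j))} {θ ℚ.* θ} #W≤#K large

    β≤q : β ℚ.* (1ℚ ℚ.+ M) ℚ^ t ℚ.≤ e ℚ.* (½ ℚ.* e ℚ.* q ℚ^ t)
    β≤q = ℚ.≤-trans β≤ (*-monoˡ (ℚ.<⇒≤ 0<e) (*-monoˡ
      (0≤* (ℚ.<⇒≤ (ℚ.positive⁻¹ ½)) (ℚ.<⇒≤ 0<e)) (^-monoˡ t (ℚ.<⇒≤ 0<ℓ₃) ℓ₃≤q)))

    -- The product `target` is a Cauchy sequence in its own right, so one precision ξ compares its
    -- value at n with all later values.
    unfreeze : ∀ {X m} →
      ℚ.∣ ι X ℚ.- q ℚ^ t ℚ.* d ℚ^ (2 ℕ.* t ℕ.+ 1) ℚ.* ι m ∣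
        ℚ.≤ ½ ℚ.* e ℚ.* (q ℚ^ t ℚ.* d ℚ^ (2 ℕ.* t ℕ.+ 1)) ℚ.* ι m →
      ∣ fromℕ X - target * fromℕ m ∣ ≤ ε * (target * fromℕ m)
    unfreeze {X} {m} h ζ 0<ζ = N , λ k k≥ → let ℓ₃≤ , ℓ₂≤ , e≤ , n≤k = later k k≥ in ℚ.≤-trans
      (replace-target {ι X} {seq target n} {seq target k} {L} {ι m} {e} {seq ε k} {ξ}
        (0≤ι m) (ℚ.<⇒≤ 0<e) e≤1 (ℚ.<⇒≤ 0<ξ) 0≤L 3ξ≤
        (subst (L ℚ.≤_) (sym (seq-target k))
          (*-mono (0≤^ (2 ℕ.* t ℕ.+ 1) (ℚ.<⇒≤ 0<ℓ₂)) (0≤^ t (ℚ.≤-trans (ℚ.<⇒≤ 0<ℓ₃) ℓ₃≤))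
            (^-monoˡ t (ℚ.<⇒≤ 0<ℓ₃) ℓ₃≤) (^-monoˡ (2 ℕ.* t ℕ.+ 1) (ℚ.<⇒≤ 0<ℓ₂) ℓ₂≤)))
        e≤ (target-steady k n≤k)
        (subst (λ D → ℚ.∣ ι X ℚ.- D ℚ.* ι m ∣ ℚ.≤ ½ ℚ.* e ℚ.* D ℚ.* ι m) (sym (seq-target n)) h))
      (≤-by ζ (ℚ.<⇒≤ 0<ζ) refl)
      where
      eventually : Eventually λ k → (ℓ₃ ℚ.≤ seq d₃ k) × (ℓ₂ ℚ.≤ seq d₂ k) × (e ℚ.≤ seq ε k) × (n ℕ.≤ k)
      eventually = d₃≥ & d₂≥ & ε≥ & (n , λ _ n≤k → n≤k)
      N : ℕ
      N = proj₁ eventually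
      later : ∀ k → N ℕ.≤ k → (ℓ₃ ℚ.≤ seq d₃ k) × (ℓ₂ ℚ.≤ seq d₂ k) × (e ℚ.≤ seq ε k) × (n ℕ.≤ k)
      later = proj₂ eventually

    estimate : ∀ (a b c : ℕ) → 1 ℕ.≤ a → 1 ℕ.≤ b → 1 ℕ.≤ c →
      ∀ (P : TripartiteGraph a b c) (E : Triples a b c) →
      Triad (fromℚ η₂) d₂ P → OnTriangles E P → HypergraphRegular (fromℚ η₃) d₃ r E P →
      ∃[ exceptions ] (fromℕ (length {A = Vec (Fin a) t} exceptions) ≤ ε * fromℕ (a ℕ.^ t)) × (
      ∀ (xs : Vec (Fin a) t) → xs ∉ exceptions →
      ∣ fromℕ (#₂ (jointLinkOn E xs P)) - target * fromℕ (b ℕ.* c) ∣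
        ≤ ε * (target * fromℕ (b ℕ.* c)))
    estimate (suc a) (suc b) (suc c) _ _ _ P E triad on-triangles regular =
      let exceptions , few , good = rational-estimate
            {d} {q} {M} {θ} {δ} {μ} {β} {ℓ₂} {e} {r} {t}
            0<ℓ₂ ℓ₂≤1 ℓ₂≤d 0<q q≤M 1≤M (ℚ.<⇒≤ 0<θ) θ≤1 (ℚ.<⇒≤ 0<δ) (ℚ.<⇒≤ 0<μ) μ≤1
            (ℕ.≤-trans (ℕ.s≤s ℕ.z≤n) 2≤t) 0<e
            (ℚ.≤-trans (ℚ.≤-reflexive (sym (ℚ.*-assoc 7ℚ M δ))) δ≤) β≥ β≤q R 0<R R*κ₀≡θ R≤r
            {a} {b} {c} {P} {E}
            (freeze-bipartite {G = XY P} (Triad.XY-regular triad))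
            (freeze-bipartite {G = YZ P} (Triad.YZ-regular triad))
            (freeze-bipartite {G = XZ P} (Triad.XZ-regular triad))
            on-triangles (freeze-hypergraph {E = E} {P} regular)
      in exceptions ,
         (λ ζ 0<ζ → proj₁ ε≥ , λ k k≥ → ℚ.≤-trans few (ℚ.≤-trans
            (*-monoʳ {ι (suc a ℕ.^ t)} {e} {seq ε k} (0≤ι (suc a ℕ.^ t)) (proj₂ ε≥ k k≥))
            (≤-by {seq ε k ℚ.* ι (suc a ℕ.^ t)} ζ (ℚ.<⇒≤ 0<ζ) refl))) ,
         λ xs xs∉ → unfreeze {#₂ (jointLinkOn E xs P)} {suc b ℕ.* suc c} (good xs xs∉)

  choose-r :
    ∃[ δ₂ ] ∃[ r ] (0ℝ < δ₂) × (1 ℕ.≤ r) × (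
    ∃[ N ] (∀ (a b c : ℕ) → N ℕ.≤ a → N ℕ.≤ b → N ℕ.≤ c →
    ∀ (P : TripartiteGraph a b c) (E : Triples a b c) →
    Triad δ₂ d₂ P → OnTriangles E P → HypergraphRegular (fromℚ η₃) d₃ r E P →
    ∃[ exceptions ] (fromℕ (length {A = Vec (Fin a) t} exceptions) ≤ ε * fromℕ (a ℕ.^ t)) × (
    ∀ (xs : Vec (Fin a) t) → xs ∉ exceptions →
    ∣ fromℕ (#₂ (jointLinkOn E xs P)) - target * fromℕ (b ℕ.* c) ∣
      ≤ ε * (target * fromℕ (b ℕ.* c)))))
  choose-r =
    -- R is computed from the term of d₂ at an index that depends on `η₂`; hence r is chosen last.
    let n , settled-from-n = settled
        ℓ₃≤q , q≤M , ℓ₂≤d , d₃-steady , d₂-steady , target-steady = settled-from-n n ℕ.≤-refl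
        R , 0<R , R*κ₀≡θ = quotients {θ} {seq d₂ n} 0<θ (ℚ.<-≤-trans 0<ℓ₂ ℓ₂≤d)
        r , 1≤r , R≤r = common-bound R t
    -- Nonempty classes are already large enough: all estimates are relative to the class sizes, and
    -- tuples may repeat vertices.
    in fromℚ η₂ , r , fromℚ-< 0<η₂ , 1≤r , 1 ,
       estimate n ℓ₃≤q q≤M ℓ₂≤d d₃-steady d₂-steady target-steady R 0<R R*κ₀≡θ R≤r

proposition1p2 : ∀ (t : ℕ) → 2 ℕ.≤ t →
    ∀ (ε d₃ : ℝ) → 0ℝ < ε → 0ℝ < d₃ →
    ∃[ δ₃ ] (0ℝ < δ₃) × (
    ∀ (d₂ : ℝ) → 0ℝ < d₂ →
    ∃[ δ₂ ] ∃[ r ] (0ℝ < δ₂) × (1 ℕ.≤ r) × (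
    ∃[ N ] (∀ (a b c : ℕ) → N ℕ.≤ a → N ℕ.≤ b → N ℕ.≤ c →
    ∀ (P : TripartiteGraph a b c) (E : Triples a b c) →
    Triad δ₂ d₂ P →
    OnTriangles E P →
    HypergraphRegular δ₃ d₃ r E P →
    ∃[ exceptions ] (fromℕ (length {A = Vec (Fin a) t} exceptions) ≤ ε * fromℕ (a ℕ.^ t)) × (
    ∀ (xs : Vec (Fin a) t) → xs ∉ exceptions →
    ∣ fromℕ (#₂ (jointLinkOn E xs P)) - d₃ ^ t * d₂ ^ (2 ℕ.* t ℕ.+ 1) * fromℕ (b ℕ.* c) ∣
    ≤ ε * (d₃ ^ t * d₂ ^ (2 ℕ.* t ℕ.+ 1) * fromℕ (b ℕ.* c))))))
proposition1p2 t 2≤t ε d₃ 0<ε 0<d₃ =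
  let e , 0<e , e≤1 , ε≥    = eventually-≥ {ε} 0<ε
      ℓ₃ , 0<ℓ₃ , _ , d₃≥   = eventually-≥ {d₃} 0<d₃
      M , 1≤M , d₃≤         = eventually-≤ d₃
      K                     = constants t 0<e 0<ℓ₃ 1≤M
      open Constants K
      -- This is δ₃. Approximating d₃ triples the regularity error, and the rational argument needs
      -- `θ * θ`.
      η₃ , 0<η₃ , _ , 3η₃≤  = small 0≤3 (0<* 0<θ 0<θ)
  in fromℚ η₃ , fromℚ-< 0<η₃ , λ d₂ 0<d₂ →
  let ℓ₂ , 0<ℓ₂ , ℓ₂≤1 , d₂≥ = eventually-≥ {d₂} 0<d₂
      0<ℓ₂²                  = 0<^ t (0<* 0<ℓ₂ 0<ℓ₂)
      -- δ is the bipartite regularity needed for the rational approximation of d₂; `η₂` below,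
      -- three times finer, serves as δ₂.
      δ , 0<δ , _ , δ≤       = small (0≤* 0≤7 (ℚ.≤-trans 0≤1 1≤M))
                                 (0<* 0<μ (0<* 0<ℓ₂ (0<* 0<ℓ₂² 0<ℓ₂²)))
      η₂ , 0<η₂ , _ , 3η₂≤   = small 0≤3 0<δ
      ξ , 0<ξ , _ , 3ξ≤      = small 0≤3 (0<* 0<e (0<* (0<^ t 0<ℓ₃) (0<^ (2 ℕ.* t ℕ.+ 1) 0<ℓ₂)))
  in Approximation.choose-r t 2≤t ε d₃ 0<e e≤1 ε≥ 0<ℓ₃ d₃≥ 1≤M d₃≤ K 0<η₃ 3η₃≤
       d₂ 0<ℓ₂ ℓ₂≤1 d₂≥ 0<δ δ≤ 0<η₂ 3η₂≤ 0<ξ 3ξ≤
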